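{- Suppose there is a semi-streaming algorithm for $(1-\varepsilon)$-approximate maximum cardinality matching in $n$-node $m$-edge bipartite graphs that uses $p(n,m,\varepsilon)$ passes and space $s(n,m,\varepsilon)$. Then, for any constant $c>0$, there exists a semi-streaming algorithm for $(1-O(\varepsilon))$-approximate maximum weight matching in $n$-node $m$-edge bipartite graphs with aspect ratio $W$ that uses $p\big(\Theta(n\cdot\varepsilon^{ -(3+c)}),\Theta(m\cdot\varepsilon^{ -(3+c)}),\Theta(\varepsilon)\big)$ passes and space $$O\big(s(\Theta(n\cdot\varepsilon^{ -(3+c)}),\Theta(m\cdot\varepsilon^{ -(3+c)}),\Theta(\varepsilon))\cdot\log_{\varepsilon^{ -1}}W\big).$$
   Context: Graphs are undirected; weighted graphs have edge weights in $[1,W]$, $W=\mathrm{poly}(n)$; the aspect ratio is the ratio of maximum to minimum edge weight. A matching is a set of vertex-disjoint edges; an $\alpha$-approximate maximum weight (resp. cardinality) matching is a matching whose total weight (resp. size) is at least $\alpha$ times the maximum. In the streaming model, the edges of the $n$-vertex input graph are presented in a stream in arbitrary order. A semi-streaming algorithm makes one or a few passes over the stream, uses limited memory ($O(n\,\mathrm{poly}(\log n))$), and at the end outputs a solution.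
   Formalization: The constant c, the accuracy ε, the aspect ratio W and the edge weights are taken to be rational numbers rather than real numbers. -}

module Defs where

import Algebra.Definitions.RawSemiring
open import Data.Bool.Base using (Bool)
open import Data.Fin.Base using (Fin)
open import Data.Integer.Base using (+_; ∣_∣)
open import Data.List.Base using (List; foldl; foldr; length; map)
open import Data.List.Relation.Unary.All using (All)
open import Data.List.Relation.Unary.AllPairs using (AllPairs)
open import Data.List.Relation.Unary.Any using (Any)
open import Data.Nat.Base as ℕ using (ℕ; suc)
open import Data.Nat.GeneralisedArithmetic using (fold)
open import Data.Nat.Logarithm using (⌊log₂_⌋)
open import Data.Product.Base using (Σ; Σ-syntax; _×_; _,_; proj₁; proj₂)
open import Data.Rational.Base
  using (ℚ; 0ℚ; 1ℚ; _+_; _*_; _-_; _/_; _≤_; _<_; ↥_; ↧ₙ_; +-*-rawSemiring)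
open import Data.Sum.Base using (_⊎_)
open import Data.Vec.Base using (Vec)
open import Relation.Binary.PropositionalEquality using (_≡_; _≢_)
open import Relation.Nullary.Negation using (¬_)

open Algebra.Definitions.RawSemiring +-*-rawSemiring public using (_^_)

fromℕ : ℕ → ℚ
fromℕ n = + n / 1

------------------------------------------------------------------------
-- Graphs and matchings

-- A pair stands for an undirected edge; both orientations denote the
-- same edge.
Edge : ℕ → Set
Edge n = Fin n × Fin n

SameEdge : ∀ {n} → Edge n → Edge n → Set
SameEdge (u , v) (x , y) = (u ≡ x × v ≡ y) ⊎ (u ≡ y × v ≡ x)

VertexDisjoint : ∀ {n} → Edge n → Edge n → Set
VertexDisjoint (u , v) (x , y) = u ≢ x × u ≢ y × v ≢ x × v ≢ y

-- A simple graph on Fin n together with the order (and orientations) in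
-- which its edges are presented; quantifying over Graph n therefore also
-- quantifies over all stream orders.
record Graph (n : ℕ) : Set where
  field
    edges    : List (Edge n)
    loopless : All (λ e → proj₁ e ≢ proj₂ e) edges
    simple   : AllPairs (λ e f → ¬ SameEdge e f) edges

open Graph public

-- Only the weights of the edges of the underlying graph are relevant.
record WeightedGraph (n : ℕ) : Set where
  field
    graph      : Graph n
    weight     : Edge n → ℚ
    weight-sym : ∀ u v → weight (u , v) ≡ weight (v , u)

  weightedEdges : List (Edge n × ℚ)
  weightedEdges = map (λ e → e , weight e) (edges graph)

open WeightedGraph public

WeightsIn[1,_] : ℚ → ∀ {n} → WeightedGraph n → Set
WeightsIn[1, W ] G = All (λ e → 1ℚ ≤ weight G e × weight G e ≤ W) (edges (graph G))

Bipartite : ∀ {n} → Graph n → Set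
Bipartite {n} G =
  Σ[ side ∈ (Fin n → Bool) ] All (λ e → side (proj₁ e) ≢ side (proj₂ e)) (edges G)

record IsMatching {n} (G : Graph n) (M : List (Edge n)) : Set where
  field
    subset   : All (λ e → Any (SameEdge e) (edges G)) M
    disjoint : AllPairs VertexDisjoint M

record IsApproxMaximum {n} (G : Graph n) (value : List (Edge n) → ℚ)
                       (α : ℚ) (M : List (Edge n)) : Set where
  field
    isMatching : IsMatching G M
    approx     : ∀ M* → IsMatching G M* → α * value M* ≤ value M

cardinality : ∀ {n} → List (Edge n) → ℚ
cardinality M = fromℕ (length M)

totalWeight : ∀ {n} → WeightedGraph n → List (Edge n) → ℚ
totalWeight G M = foldr (λ e w → weight G e + w) 0ℚ M

ApproxMCM : ∀ {n} → Graph n → ℚ → List (Edge n) → Set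
ApproxMCM G = IsApproxMaximum G cardinality

ApproxMWM : ∀ {n} → WeightedGraph n → ℚ → List (Edge n) → Set
ApproxMWM G = IsApproxMaximum (graph G) (totalWeight G)

------------------------------------------------------------------------
-- Streaming algorithms

-- Space is the number of bits retained between consecutive stream items;
-- as usual in this model, the computation done while processing a single
-- item is not charged.  The solution is computed from the final memory.
-- The algorithm is notified of the end of each pass, but a pass counter,
-- if it needs one, has to be kept in memory.
record StreamAlgorithm (Item Output : Set) (passes space : ℕ) : Set where
  field
    init    : Vec Bool space
    step    : Vec Bool space → Item → Vec Bool space
    endPass : Vec Bool space → Vec Bool space
    output  : Vec Bool space → Output

  onePass : List Item → Vec Bool space → Vec Bool space
  onePass stream memory = endPass (foldl step memory stream)

  run : List Item → Output
  run stream = output (fold init (onePass stream) passes)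

open StreamAlgorithm public

-- The size parameters n, m (and W, ε) are given to the algorithm in
-- advance.  As usual m is a bound: the algorithm for parameter m works for
-- graphs with at most m edges.  The bipartition is not given.
SolvesBipartiteMCM : (p s : ℕ → ℕ → ℚ → ℕ) → Set
SolvesBipartiteMCM p s =
  ∀ n m ε → 0ℚ < ε → ε < 1ℚ →
  Σ[ A ∈ StreamAlgorithm (Edge n) (List (Edge n)) (p n m ε) (s n m ε) ]
    (∀ (G : Graph n) → Bipartite G → length (edges G) ℕ.≤ m →
     ApproxMCM G (1ℚ - ε) (run A (edges G)))

-- Here the approximation ratio is 1 - κ ε.
SolvesBipartiteMWM : (κ : ℚ) (p s : ℕ → ℕ → ℚ → ℚ → ℕ) → Set
SolvesBipartiteMWM κ p s =
  ∀ n m W ε → 1ℚ ≤ W → 0ℚ < ε → ε < 1ℚ →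
  Σ[ A ∈ StreamAlgorithm (Edge n × ℚ) (List (Edge n)) (p n m W ε) (s n m W ε) ]
    (∀ (G : WeightedGraph n) → Bipartite (graph G) →
     length (edges (graph G)) ℕ.≤ m → WeightsIn[1, W ] G →
     ApproxMWM G (1ℚ - κ * ε) (run A (weightedEdges G)))

-- C · n · (log n)^k, where the logarithm is 1 + ⌊log₂ n⌋.
polylogSpace : (C k n : ℕ) → ℕ
polylogSpace C k n = C ℕ.* (n ℕ.* suc ⌊log₂ n ⌋ ℕ.^ k)

-- Space O(n poly(log n)) for every fixed ε; a simple graph has m ≤ n².
SemiStreaming : (ℕ → ℕ → ℚ → ℕ) → Set
SemiStreaming s =
  ∀ ε → 0ℚ < ε → ε < 1ℚ →
  Σ[ C ∈ ℕ ] Σ[ k ∈ ℕ ]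
    (∀ n m → m ℕ.≤ n ℕ.* n → s n m ε ℕ.≤ polylogSpace C k n)

-- The same in the weighted case, under W = poly(n), i.e. W ≤ a n^d.
SemiStreamingWeighted : (ℕ → ℕ → ℚ → ℚ → ℕ) → Set
SemiStreamingWeighted s =
  ∀ ε → 0ℚ < ε → ε < 1ℚ → (a d : ℕ) →
  Σ[ C ∈ ℕ ] Σ[ k ∈ ℕ ]
    (∀ n m W → m ℕ.≤ n ℕ.* n → 1ℚ ≤ W → W ≤ fromℕ (a ℕ.* n ℕ.^ d) →
     s n m W ε ℕ.≤ polylogSpace C k n)

------------------------------------------------------------------------
-- Asymptotic bounds

-- lo · x · ε^(-r) ≤ y ≤ hi · x · ε^(-r) for nonnegative x, y and a
-- rational exponent r = a / b ≥ 0, with both inequalities raised to the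
-- b-th power and multiplied by ε^a.
ScaledBy : (lo hi ε r : ℚ) (x y : ℕ) → Set
ScaledBy lo hi ε r x y =
  (lo * fromℕ x) ^ b ≤ fromℕ y ^ b * ε ^ a ×
  fromℕ y ^ b * ε ^ a ≤ (hi * fromℕ x) ^ b
  where
  a b : ℕ
  a = ∣ ↥ r ∣
  b = ↧ₙ r

-- σ ≤ B · max(1, log_{1/ε} W) for 0 < ε < 1 ≤ W:  the second alternative is
-- (1/ε)^σ ≤ W^B.  The maximum with 1 matters only if W < 1/ε.
AtMostTimesLog : (ε W : ℚ) (B σ : ℕ) → Set
AtMostTimesLog ε W B σ = σ ℕ.≤ B ⊎ 1ℚ ≤ W ^ B * ε ^ σ

-- p′ and s′ are p and C · s · log_{1/ε} W, with p and s evaluated at a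
-- common triple (Θ(n ε^(-(3+c))) , Θ(m ε^(-(3+c))) , Θ(ε)) in the range of
-- parameters where p and s are meaningful.
ReductionBounds : (c lo hi : ℚ) (C : ℕ) (p s : ℕ → ℕ → ℚ → ℕ)
                  (p′ s′ : ℕ → ℕ → ℚ → ℚ → ℕ) → Set
ReductionBounds c lo hi C p s p′ s′ =
  ∀ n m W ε → 1ℚ ≤ W → 0ℚ < ε → ε < 1ℚ →
  Σ[ n′ ∈ ℕ ] Σ[ m′ ∈ ℕ ] Σ[ ε′ ∈ ℚ ]
    ( ScaledBy lo hi ε (fromℕ 3 + c) n n′
    × ScaledBy lo hi ε (fromℕ 3 + c) m m′
    × lo * ε ≤ ε′ × ε′ ≤ hi * ε × ε′ < 1ℚ
    × p′ n m W ε ≡ p n′ m′ ε′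
    × AtMostTimesLog ε W (C ℕ.* s n′ m′ ε′) (s′ n m W ε) )

{-# OPTIONS --safe #-}
-- Unfolding replaces a vertex by K copies and an edge ab of integral weight w by the w edges
-- joining the i-th copy of a to the (w - 1 - i)-th copy of b.  An integral dual solution of the
-- weighted problem is a vertex cover of the unfolded graph, so a near-maximum matching of the
-- unfolded graph folds to a set of edges containing a near-maximum weight matching.
--
-- With q ≈ 1/ε and ρ ≈ ε^(-c), the weights are split into about log_ρ W cores of ratio ρ, each
-- padded by a factor q on either side; in the resulting window of ratio q² ρ the weights are
-- integers between q and q³ ρ, which is the blow-up of the unfolding.  One instance of the
-- unweighted algorithm per window runs in parallel, and a heaviest matching in the union of the
-- folded solutions is returned.
--
-- To compare it with an optimal matching N, treat the windows from light to heavy.  If M is the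
-- solution of the current window, cut the paths of N ∪ M at the edges of N that lie in the core or
-- outside the window, and switch from N to M on the pieces that end in a core edge and in no
-- edge above the window.  A switched piece loses at most one edge below the window, and an
-- unswitched core edge is charged to an edge above the window: both cost a 1/q fraction of what
-- they are charged to.  Heavy edges are never created for later windows, so the charges to an edge
-- sum up to a geometric series.
module Submission where

open import Algebra.Bundles using (CommutativeRing)
import Algebra.Properties.CommutativeSemiring.Exp as CommutativeExp
import Algebra.Properties.Semiring.Exp as Exp
open import Data.Bool.Base using (Bool; true; false; if_then_else_; not; _∧_; _∨_; T)
open import Data.Bool.Properties using (T?)
open import Data.Fin.Base using (Fin; toℕ; fromℕ<; combine; remQuot; inject≤; opposite)
open import Data.Fin.Properties using (_≟_; any?)
import Data.Fin.Properties as Fin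
open import Data.Integer.Base as ℤ using (-[1+_]; ∣_∣)
import Data.Integer.Properties as ℤ
open import Data.List.Base
  using (List; []; _∷_; _++_; map; concatMap; filter; length; allFin; tabulate; upTo; foldl)
open import Data.List.Extrema.Nat using (argmax; argmax-all; f[xs]≤f[argmax])
import Data.List.Membership.DecPropositional as DecMembership
open import Data.List.Membership.Propositional using (_∈_; _∉_; find; lose)
open import Data.List.Membership.Propositional.Properties
  using (∈-++⁺ˡ; ∈-++⁺ʳ; ∈-++⁻; ∈-∃++; ∈-allFin; ∈-filter⁺; ∈-filter⁻; ∈-map⁺; ∈-map⁻; ∈-concatMap⁺; ∈-concatMap⁻; ∈-tabulate⁺; ∈-tabulate⁻; ∈-upTo⁺)
import Data.List.Properties as List
open import Data.List.Relation.Unary.All using (All; []; _∷_)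
import Data.List.Relation.Unary.All as All
import Data.List.Relation.Unary.All.Properties as All
open import Data.List.Relation.Unary.AllPairs using (AllPairs; []; _∷_)
import Data.List.Relation.Unary.AllPairs as AllPairs
import Data.List.Relation.Unary.AllPairs.Properties as AllPairs
open import Data.List.Relation.Unary.Any using (Any; here; there)
import Data.List.Relation.Unary.Any as Any
open import Data.List.Relation.Unary.Unique.Propositional using (Unique)
import Data.List.Relation.Unary.Unique.Propositional.Properties as Unique
open import Data.Nat.Base
open import Data.Nat.Coprimality using (1-coprimeTo)
import Data.Nat.Coprimality as Coprimality
open import Data.Nat.GeneralisedArithmetic using (fold)
open import Data.Nat.Induction using (<-wellFounded)
open import Data.Nat.Logarithm using (⌊log₂_⌋; ⌊log₂⌋-mono-≤; ⌊log₂[2*b]⌋≡1+⌊log₂b⌋; ⌊log₂[2^n]⌋≡n)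
open import Data.Nat.Properties hiding (_≟_)
import Data.Nat.Properties as ℕ
open import Data.Nat.Tactic.RingSolver using (solve-∀)
open import Data.Product.Base using (Σ-syntax; ∃; ∃-syntax; _×_; _,_; proj₁; proj₂)
open import Data.Rational.Base as ℚ using (ℚ; mkℚ; 0ℚ; 1ℚ; *≤*; *<*; ↥_; ↧ₙ_)
import Data.Rational.Properties as ℚ
open import Data.Rational.Solver using (module +-*-Solver)
import Data.Rational.Unnormalised.Base as ℚᵘ
import Data.Rational.Unnormalised.Properties as ℚᵘ
open import Data.Sum.Base using (_⊎_; inj₁; inj₂; [_,_]′)
open import Data.Vec.Base as Vec using (Vec)
open import Data.Vec.Functional using (updateAt)
open import Data.Vec.Functional.Properties using (updateAt-updates; updateAt-minimal)
import Data.Vec.Properties as Vec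
open import Defs renaming (_^_ to _^ℚ_)
open import Function.Base using (_∘_; id)
open import Induction.WellFounded using (Acc; acc)
open import Relation.Binary.PropositionalEquality
  using (_≡_; _≢_; refl; sym; trans; cong; cong₂; subst; module ≡-Reasoning)
open import Relation.Nullary using (¬_; Dec; yes; no; does; contradiction; ¬?)
open import Relation.Nullary.Decidable using (_×-dec_)

-- Finite sums

∑ : {A : Set} → List A → (A → ℕ) → ℕ
∑ []       f = 0
∑ (x ∷ xs) f = f x + ∑ xs f

∑-mono-All : {A : Set} {f g : A → ℕ} {xs : List A} → All (λ x → f x ≤ g x) xs → ∑ xs f ≤ ∑ xs g
∑-mono-All []       = z≤n
∑-mono-All (p ∷ ps) = +-mono-≤ p (∑-mono-All ps)

∑-mono : {A : Set} {f g : A → ℕ} (xs : List A) → (∀ x → f x ≤ g x) → ∑ xs f ≤ ∑ xs g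
∑-mono xs p = ∑-mono-All (All.universal p xs)

∑-cong-All : {A : Set} {f g : A → ℕ} {xs : List A} → All (λ x → f x ≡ g x) xs → ∑ xs f ≡ ∑ xs g
∑-cong-All []       = refl
∑-cong-All (p ∷ ps) = cong₂ _+_ p (∑-cong-All ps)

∑-cong : {A : Set} {f g : A → ℕ} (xs : List A) → (∀ x → f x ≡ g x) → ∑ xs f ≡ ∑ xs g
∑-cong xs p = ∑-cong-All (All.universal p xs)

∑-zero : {A : Set} (xs : List A) → ∑ xs (λ _ → 0) ≡ 0
∑-zero []       = refl
∑-zero (x ∷ xs) = ∑-zero xs

∑-const : {A : Set} (c : ℕ) (xs : List A) → ∑ xs (λ _ → c) ≡ length xs * c
∑-const c []       = refl
∑-const c (x ∷ xs) = cong (c +_) (∑-const c xs)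

+-interchange : ∀ a b c d → (a + b) + (c + d) ≡ (a + c) + (b + d)
+-interchange = solve-∀

∑-+ : {A : Set} (f g : A → ℕ) (xs : List A) → ∑ xs (λ x → f x + g x) ≡ ∑ xs f + ∑ xs g
∑-+ f g []       = refl
∑-+ f g (x ∷ xs) = trans (cong (f x + g x +_) (∑-+ f g xs)) (+-interchange (f x) (g x) _ _)

∑-* : {A : Set} (c : ℕ) (f : A → ℕ) (xs : List A) → ∑ xs (λ x → c * f x) ≡ c * ∑ xs f
∑-* c f []       = sym (*-zeroʳ c)
∑-* c f (x ∷ xs) = trans (cong (c * f x +_) (∑-* c f xs)) (sym (*-distribˡ-+ c (f x) _))

∑-++ : {A : Set} (f : A → ℕ) (xs ys : List A) → ∑ (xs ++ ys) f ≡ ∑ xs f + ∑ ys f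
∑-++ f []       ys = refl
∑-++ f (x ∷ xs) ys = trans (cong (f x +_) (∑-++ f xs ys)) (sym (+-assoc (f x) _ _))

∑-map : {A B : Set} (f : B → ℕ) (h : A → B) (xs : List A) → ∑ (map h xs) f ≡ ∑ xs (f ∘ h)
∑-map f h []       = refl
∑-map f h (x ∷ xs) = cong (f (h x) +_) (∑-map f h xs)

∑-concatMap : {A B : Set} (f : B → ℕ) (h : A → List B) (xs : List A) →
              ∑ (concatMap h xs) f ≡ ∑ xs (λ x → ∑ (h x) f)
∑-concatMap f h []       = refl
∑-concatMap f h (x ∷ xs) =
  trans (∑-++ f (h x) (concatMap h xs)) (cong (∑ (h x) f +_) (∑-concatMap f h xs))

∑-swap : {A B : Set} (f : A → B → ℕ) (xs : List A) (ys : List B) →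
         ∑ xs (λ x → ∑ ys (f x)) ≡ ∑ ys (λ y → ∑ xs (λ x → f x y))
∑-swap f []       ys = sym (∑-zero ys)
∑-swap f (x ∷ xs) ys = trans (cong (∑ ys (f x) +_) (∑-swap f xs ys)) (sym (∑-+ (f x) _ ys))

∑-partition : {A : Set} {P : A → Set} (P? : ∀ x → Dec (P x)) (f : A → ℕ) (xs : List A) →
              ∑ xs f ≡ ∑ (filter P? xs) f + ∑ (filter (¬? ∘ P?) xs) f
∑-partition P? f []       = refl
∑-partition P? f (x ∷ xs) with does (P? x)
... | true  = trans (cong (f x +_) (∑-partition P? f xs)) (sym (+-assoc (f x) _ _))
... | false = trans (cong (f x +_) (∑-partition P? f xs)) (x∙yz≈y∙xz (f x) (∑ (filter P? xs) f) _)
  where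
  x∙yz≈y∙xz : ∀ a b c → a + (b + c) ≡ b + (a + c)
  x∙yz≈y∙xz = solve-∀

∑-filter-≤ : {A : Set} {P : A → Set} (P? : ∀ x → Dec (P x)) (f : A → ℕ) (xs : List A) →
             ∑ (filter P? xs) f ≤ ∑ xs f
∑-filter-≤ P? f xs = ≤-trans (m≤m+n _ _) (≤-reflexive (sym (∑-partition P? f xs)))

∑-⊆ : {A : Set} {f : A → ℕ} {xs ys : List A} → Unique xs →
      (∀ {x} → x ∈ xs → f x ≡ 0 ⊎ x ∈ ys) → ∑ xs f ≤ ∑ ys f
∑-⊆ []       _ = z≤n
∑-⊆ {f = f} {x ∷ xs} {ys} (x∉ ∷ u) sub with sub (here refl)
... | inj₁ fx≡0 rewrite fx≡0 = ∑-⊆ u (sub ∘ there)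
... | inj₂ x∈ys with ∈-∃++ x∈ys
...   | ps , qs , refl = begin
  f x + ∑ xs f               ≤⟨ +-monoʳ-≤ (f x) (∑-⊆ {ys = ps ++ qs} u sub′) ⟩
  f x + ∑ (ps ++ qs) f       ≡⟨ cong (f x +_) (∑-++ f ps qs) ⟩
  f x + (∑ ps f + ∑ qs f)    ≡⟨ shuffle (f x) (∑ ps f) (∑ qs f) ⟩
  ∑ ps f + (f x + ∑ qs f)    ≡⟨ ∑-++ f ps (x ∷ qs) ⟨
  ∑ (ps ++ x ∷ qs) f         ∎
  where
  open ≤-Reasoning
  shuffle : ∀ a b c → a + (b + c) ≡ b + (a + c)
  shuffle = solve-∀
  sub′ : ∀ {z} → z ∈ xs → f z ≡ 0 ⊎ z ∈ ps ++ qs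
  sub′ z∈ with sub (there z∈)
  ... | inj₁ fz≡0 = inj₁ fz≡0
  ... | inj₂ z∈ys with ∈-++⁻ ps z∈ys
  ...   | inj₁ z∈ps         = inj₂ (∈-++⁺ˡ z∈ps)
  ...   | inj₂ (there z∈qs) = inj₂ (∈-++⁺ʳ ps z∈qs)
  ...   | inj₂ (here refl)  = contradiction refl (All.lookup x∉ z∈)

allFin-unique : ∀ n → Unique (allFin n)
allFin-unique = Unique.allFin⁺

∑-strict : {A : Set} {f g : A → ℕ} {xs : List A} → (∀ x → f x ≤ g x) →
           ∀ {a} → a ∈ xs → f a < g a → ∑ xs f < ∑ xs g
∑-strict {xs = x ∷ xs} f≤g (here refl) fa<ga = +-mono-<-≤ fa<ga (∑-mono xs f≤g)
∑-strict {xs = x ∷ xs} f≤g (there a∈)  fa<ga = +-mono-≤-< (f≤g x) (∑-strict f≤g a∈ fa<ga)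

[_≈_] : ∀ {n} → Fin n → Fin n → ℕ
[ i ≈ j ] = if does (i ≟ j) then 1 else 0

≈-refl : ∀ {n} (i : Fin n) → [ i ≈ i ] ≡ 1
≈-refl i with i ≟ i
... | yes _   = refl
... | no i≢i = contradiction refl i≢i

≈-off : ∀ {n} {i j : Fin n} → i ≢ j → [ i ≈ j ] ≡ 0
≈-off {i = i} {j} i≢j with i ≟ j
... | yes i≡j = contradiction i≡j i≢j
... | no _    = refl

∑-pick : ∀ {n} (f : Fin n → ℕ) (i : Fin n) → ∑ (allFin n) (λ j → [ i ≈ j ] * f j) ≡ f i
∑-pick {n} f i = ≤-antisym
  (≤-trans (∑-⊆ {ys = i ∷ []} (allFin-unique n) support) (≤-reflexive value))
  (≤-trans (≤-reflexive (sym value)) (∑-⊆ {xs = i ∷ []} ([] ∷ []) (λ _ → inj₂ (∈-allFin _))))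
  where
  value : ∑ (i ∷ []) (λ j → [ i ≈ j ] * f j) ≡ f i
  value rewrite ≈-refl i = trans (+-identityʳ _) (+-identityʳ _)
  support : ∀ {j} → j ∈ allFin n → [ i ≈ j ] * f j ≡ 0 ⊎ j ∈ i ∷ []
  support {j} _ with i ≟ j
  ... | yes refl = inj₂ (here refl)
  ... | no _     = inj₁ refl

≤-by-cancel : ∀ {a b l r} → a ≤ b → l + b ≤ r + a → l ≤ r
≤-by-cancel {a} {b} {l} {r} a≤b p = +-cancelʳ-≤ b l r (≤-trans p (+-monoʳ-≤ r a≤b))

∑-∈ : {A : Set} (f : A → ℕ) {x : A} {xs : List A} → x ∈ xs → f x ≤ ∑ xs f
∑-∈ f (here refl) = m≤m+n _ _
∑-∈ f (there x∈)  = ≤-trans (∑-∈ f x∈) (m≤n+m _ _)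

select : {A : Set} → (A → Bool) → List A → List A
select b = filter (T? ∘ b)

∑-select : {A : Set} (b : A → Bool) (f : A → ℕ) (xs : List A) →
           ∑ (select b xs) f ≡ ∑ xs (λ x → if b x then f x else 0)
∑-select b f []       = refl
∑-select b f (x ∷ xs) with b x
... | true  = cong (f x +_) (∑-select b f xs)
... | false = ∑-select b f xs

∈-select⁻ : {A : Set} (b : A → Bool) {x : A} (xs : List A) → x ∈ select b xs → x ∈ xs × T (b x)
∈-select⁻ b xs = ∈-filter⁻ (T? ∘ b) {xs = xs}

-- Approximate weighted König duality by an auction with unit price steps

-- A left vertex u that is unmatched and has y u > 0 either takes a saturated edge, evicting the
-- partner of its right end v and raising z v by one, or else can afford to lower y u by one.
module Auction {A : Set} {a b : ℕ} (E : List A) (l : A → Fin a) (r : A → Fin b) (wt : A → ℕ) where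

  record State : Set where
    field
      M        : List A
      y        : Fin a → ℕ
      z        : Fin b → ℕ
      M⊆E      : All (_∈ E) M
      disjoint : AllPairs (λ e f → l e ≢ l f × r e ≢ r f) M
      cover    : All (λ e → wt e ≤ y (l e) + z (r e)) E
      tight    : All (λ e → y (l e) + z (r e) ≤ suc (wt e)) M
      support  : ∀ v → z v ≡ 0 ⊎ v ∈ map r M

  open State

  Final : State → Set
  Final s = ∀ u → y s u ≡ 0 ⊎ u ∈ map l (M s)

  bound : ℕ
  bound = suc (∑ E wt)

  measure : State → ℕ
  measure s = ∑ (allFin a) (y s) + ∑ (allFin b) (λ v → bound ∸ z s v)

  ≤-updateAt : ∀ {n} (f : Fin n → ℕ) (g : ℕ → ℕ) i → f i ≤ g (f i) → ∀ j → f j ≤ updateAt f i g j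
  ≤-updateAt f g i p j with j ≟ i
  ... | yes refl = ≤-trans p (≤-reflexive (sym (updateAt-updates i f)))
  ... | no j≢i  = ≤-reflexive (sym (updateAt-minimal j i f j≢i))

  updateAt-≤ : ∀ {n} (f : Fin n → ℕ) (g : ℕ → ℕ) i → g (f i) ≤ f i → ∀ j → updateAt f i g j ≤ f j
  updateAt-≤ f g i p j with j ≟ i
  ... | yes refl = ≤-trans (≤-reflexive (updateAt-updates i f)) p
  ... | no j≢i  = ≤-reflexive (updateAt-minimal j i f j≢i)

  module Bid (s : State) (u : Fin a) (u∉ : u ∉ map l (M s)) (yu≢0 : y s u ≢ 0) where

    assign : ∀ e → e ∈ E → l e ≡ u → y s u + z s (r e) ≤ wt e → State
    assign e e∈E refl saturated = record
      { M        = e ∷ filter keep? (M s)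
      ; y        = y s
      ; z        = z′
      ; M⊆E      = e∈E ∷ All.filter⁺ keep? (M⊆E s)
      ; disjoint = All.tabulate new-disjoint ∷ AllPairs.filter⁺ keep? (disjoint s)
      ; cover    = All.map (λ {f} p → ≤-trans p (+-monoʳ-≤ (y s (l f)) (z≤z′ (r f)))) (cover s)
      ; tight    = ≤-trans (≤-reflexive (cong (y s (l e) +_) (updateAt-updates (r e) (z s))))
                     (≤-trans (≤-reflexive (+-suc _ _)) (s≤s saturated))
                   ∷ All.tabulate old-tight
      ; support  = support′
      }
      where
      keep? : ∀ f → Dec (r f ≢ r e)
      keep? f = ¬? (r f ≟ r e)
      z′ : Fin b → ℕ
      z′ = updateAt (z s) (r e) suc
      z≤z′ : ∀ v → z s v ≤ z′ v
      z≤z′ = ≤-updateAt (z s) suc (r e) (n≤1+n _)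
      new-disjoint : ∀ {f} → f ∈ filter keep? (M s) → l e ≢ l f × r e ≢ r f
      new-disjoint f∈ with ∈-filter⁻ keep? f∈
      ... | f∈M , rf≢re = (λ le≡lf → u∉ (subst (_∈ map l (M s)) (sym le≡lf) (∈-map⁺ l f∈M))) , rf≢re ∘ sym
      old-tight : ∀ {f} → f ∈ filter keep? (M s) → y s (l f) + z′ (r f) ≤ suc (wt f)
      old-tight {f} f∈ with ∈-filter⁻ keep? f∈
      ... | f∈M , rf≢re rewrite updateAt-minimal (r f) (r e) {f = suc} (z s) rf≢re = All.lookup (tight s) f∈M
      support′ : ∀ v → z′ v ≡ 0 ⊎ v ∈ r e ∷ map r (filter keep? (M s))
      support′ v with v ≟ r e
      ... | yes v≡re = inj₂ (here v≡re)
      ... | no v≢re with support s v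
      ...   | inj₁ zv≡0 = inj₁ (trans (updateAt-minimal v (r e) (z s) v≢re) zv≡0)
      ...   | inj₂ v∈ with ∈-map⁻ r v∈
      ...     | f , f∈M , refl = inj₂ (there (∈-map⁺ r (∈-filter⁺ keep? f∈M v≢re)))

    assign-decreases : ∀ e e∈E le≡u sat → measure (assign e e∈E le≡u sat) < measure s
    assign-decreases e e∈E refl sat = +-monoʳ-< (∑ (allFin a) (y s))
      (∑-strict (λ v → ∸-monoʳ-≤ bound (≤-updateAt (z s) suc (r e) (n≤1+n _) v)) (∈-allFin (r e))
        (subst (λ t → bound ∸ t < bound ∸ z s (r e)) (sym (updateAt-updates (r e) (z s)))
          (∸-monoʳ-< (n<1+n _) (s≤s (≤-trans (m+n≤o⇒n≤o (y s u) sat) (∑-∈ wt e∈E))))))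

    lower : ¬ Any (λ e → l e ≡ u × y s u + z s (r e) ≤ wt e) E → State
    lower unsaturated = record
      { M        = M s
      ; y        = y′
      ; z        = z s
      ; M⊆E      = M⊆E s
      ; disjoint = disjoint s
      ; cover    = All.tabulate cover′
      ; tight    = All.map (λ {f} p → ≤-trans (+-monoˡ-≤ (z s (r f)) (y′≤y (l f))) p) (tight s)
      ; support  = support s
      }
      where
      y′ : Fin a → ℕ
      y′ = updateAt (y s) u pred
      y′≤y : ∀ v → y′ v ≤ y s v
      y′≤y = updateAt-≤ (y s) pred u pred[n]≤n
      cover′ : ∀ {e} → e ∈ E → wt e ≤ y′ (l e) + z s (r e)
      cover′ {e} e∈E with l e ≟ u
      ... | no le≢u rewrite updateAt-minimal (l e) u {f = pred} (y s) le≢u = All.lookup (cover s) e∈E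
      ... | yes refl rewrite updateAt-updates (l e) {f = pred} (y s) =
        s≤s⁻¹ (<-≤-trans (≰⇒> (λ le → unsaturated (lose e∈E (refl , le))))
          (≤-reflexive (cong (_+ z s (r e)) (sym (suc-pred (y s u) {{≢-nonZero yu≢0}})))))

    lower-decreases : ∀ unsat → measure (lower unsat) < measure s
    lower-decreases unsat = +-monoˡ-< _
      (∑-strict (updateAt-≤ (y s) pred u pred[n]≤n) (∈-allFin u)
        (subst (_< y s u) (sym (updateAt-updates u (y s)))
          (≤-reflexive (suc-pred (y s u) {{≢-nonZero yu≢0}}))))

  advance : (s : State) → Final s ⊎ ∃[ s′ ] measure s′ < measure s
  advance s with any? (λ u → ¬? (y s u ℕ.≟ 0) ×-dec ¬? (DecMembership._∈?_ _≟_ u (map l (M s))))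
  ... | no done = inj₁ final
    where
    final : Final s
    final u with y s u ℕ.≟ 0 | DecMembership._∈?_ _≟_ u (map l (M s))
    ... | yes p | _     = inj₁ p
    ... | no _  | yes q = inj₂ q
    ... | no p  | no q  = contradiction (u , p , q) done
  ... | yes (u , yu≢0 , u∉) with Any.any? (λ e → l e ≟ u ×-dec (y s u + z s (r e) ≤? wt e)) E
  ...   | no unsat = inj₂ (lower unsat , lower-decreases unsat)
    where open Bid s u u∉ yu≢0
  ...   | yes sat with find sat
  ...     | e , e∈E , le≡u , p = inj₂ (assign e e∈E le≡u p , assign-decreases e e∈E le≡u p)
    where open Bid s u u∉ yu≢0

  start : State
  start = record
    { M = [] ; y = λ _ → ∑ E wt ; z = λ _ → 0 ; M⊆E = [] ; disjoint = []
    ; cover = All.tabulate (λ e∈E → ≤-trans (∑-∈ wt e∈E) (m≤m+n _ 0)) ; tight = [] ; support = λ _ → inj₁ refl }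

  run-auction : (s : State) → Acc _<_ (measure s) → ∃ Final
  run-auction s (acc rec) with advance s
  ... | inj₁ final     = s , final
  ... | inj₂ (s′ , lt) = run-auction s′ (rec lt)

  abstract
    duality : Σ[ M ∈ List A ] Σ[ y ∈ (Fin a → ℕ) ] Σ[ z ∈ (Fin b → ℕ) ]
      ( All (_∈ E) M
      × AllPairs (λ e f → l e ≢ l f × r e ≢ r f) M
      × All (λ e → wt e ≤ y (l e) + z (r e)) E
      × ∑ (allFin a) y + ∑ (allFin b) z ≤ ∑ M (suc ∘ wt) )
    duality with run-auction start (<-wellFounded _)
    ... | s , final = M s , y s , z s , M⊆E s , disjoint s , cover s , (begin
      ∑ (allFin a) (y s) + ∑ (allFin b) (z s)
        ≤⟨ +-mono-≤ (∑-⊆ {ys = map l (M s)} (allFin-unique a) (λ _ → final _))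
                    (∑-⊆ {ys = map r (M s)} (allFin-unique b) (λ _ → support s _)) ⟩
      ∑ (map l (M s)) (y s) + ∑ (map r (M s)) (z s)
        ≡⟨ cong₂ _+_ (∑-map (y s) l (M s)) (∑-map (z s) r (M s)) ⟩
      ∑ (M s) (y s ∘ l) + ∑ (M s) (z s ∘ r)
        ≡⟨ ∑-+ _ _ (M s) ⟨
      ∑ (M s) (λ e → y s (l e) + z s (r e))
        ≤⟨ ∑-mono-All (tight s) ⟩
      ∑ (M s) (suc ∘ wt) ∎)
      where open ≤-Reasoning

-- Matchings and components

Loopless : ∀ {n} → Edge n → Set
Loopless e = proj₁ e ≢ proj₂ e

record Matching {n} (M : List (Edge n)) : Set where
  constructor matching
  field
    no-loops : All Loopless M
    disjoint : AllPairs VertexDisjoint M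

open Matching

VertexDisjoint-sym : ∀ {n} {e f : Edge n} → VertexDisjoint e f → VertexDisjoint f e
VertexDisjoint-sym (p , q , r , s) = p ∘ sym , r ∘ sym , q ∘ sym , s ∘ sym

filter-matching : ∀ {n} {P : Edge n → Set} (P? : ∀ e → Dec (P e)) {M} → Matching M → Matching (filter P? M)
filter-matching P? (matching l d) = matching (All.filter⁺ P? l) (AllPairs.filter⁺ P? d)

++-matching : ∀ {n} {M N : List (Edge n)} → Matching M → Matching N →
              (∀ {e f} → e ∈ M → f ∈ N → VertexDisjoint e f) → Matching (M ++ N)
++-matching (matching l d) (matching l′ d′) cross =
  matching (All.++⁺ l l′) (AllPairs.++⁺ d d′ (All.tabulate (λ e∈ → All.tabulate (cross e∈))))

endpoints : ∀ {n} → List (Edge n) → List (Fin n)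
endpoints = concatMap (λ e → proj₁ e ∷ proj₂ e ∷ [])

∑-endpoints : ∀ {n} (f : Fin n → ℕ) (L : List (Edge n)) →
              ∑ (endpoints L) f ≡ ∑ L (λ e → f (proj₁ e) + f (proj₂ e))
∑-endpoints f L = trans (∑-concatMap f _ L)
  (∑-cong L (λ e → cong (f (proj₁ e) +_) (+-identityʳ _)))

endpoints-unique : ∀ {n} {M : List (Edge n)} → Matching M → Unique (endpoints M)
endpoints-unique (matching []      [])      = []
endpoints-unique (matching (l ∷ ls) (d ∷ ds)) =
  (l ∷ avoid (λ (p , q , _) → p , q) d) ∷ avoid (λ (_ , _ , p , q) → p , q) d ∷ endpoints-unique (matching ls ds)
  where
  avoid : ∀ {e M x} → (∀ {f} → VertexDisjoint e f → x ≢ proj₁ f × x ≢ proj₂ f) →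
          All (VertexDisjoint e) M → All (x ≢_) (endpoints M)
  avoid side []       = []
  avoid side (d ∷ ds) = proj₁ (side d) ∷ proj₂ (side d) ∷ avoid side ds

∑-matching-≤ : ∀ {n} {M : List (Edge n)} (f : Fin n → ℕ) → Matching M →
               ∑ M (λ e → f (proj₁ e) + f (proj₂ e)) ≤ ∑ (allFin n) f
∑-matching-≤ {M = M} f m = ≤-trans (≤-reflexive (sym (∑-endpoints f M)))
  (∑-⊆ (endpoints-unique m) (λ _ → inj₂ (∈-allFin _)))

incidence : ∀ {n} → (Fin n → Fin n) → Fin n → Edge n → ℕ
incidence comp κ e = [ comp (proj₁ e) ≈ κ ] + [ comp (proj₂ e) ≈ κ ]

merge : ∀ {n} → Fin n → Fin n → Fin n → Fin n
merge α β κ = if does (κ ≟ β) then α else κ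

merge-target : ∀ {n} {α β : Fin n} → α ≢ β → ∀ γ → [ merge α β γ ≈ α ] ≡ [ γ ≈ α ] + [ γ ≈ β ]
merge-target {α = α} {β} α≢β γ with γ ≟ β
... | no _     = sym (+-identityʳ _)
... | yes refl = trans (≈-refl α) (cong (_+ 1) (sym (≈-off (α≢β ∘ sym))))

merge-source : ∀ {n} {α β : Fin n} → α ≢ β → ∀ γ → [ merge α β γ ≈ β ] ≡ 0
merge-source {α = α} {β} α≢β γ with γ ≟ β
... | no γ≢β = ≈-off γ≢β
... | yes _   = ≈-off α≢β

merge-other : ∀ {n} {α β κ : Fin n} → κ ≢ α → κ ≢ β → ∀ γ → [ merge α β γ ≈ κ ] ≡ [ γ ≈ κ ]
merge-other {β = β} κ≢α κ≢β γ with γ ≟ β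
... | no _     = refl
... | yes refl = trans (≈-off (κ≢α ∘ sym)) (sym (≈-off (κ≢β ∘ sym)))

-- A connected graph has at most one vertex more than it has edges.
components : ∀ {n} (L : List (Edge n)) → Σ[ comp ∈ (Fin n → Fin n) ]
  ( All (λ e → comp (proj₁ e) ≡ comp (proj₂ e)) L
  × (∀ κ → 2 * ∑ (allFin n) (λ x → [ comp x ≈ κ ]) ≤ 2 + ∑ L (incidence comp κ)) )
components {n} [] = id , [] , λ κ → *-monoʳ-≤ 2 {y = 1} (≤-trans
  (∑-⊆ {ys = κ ∷ []} (allFin-unique n) support) (≤-reflexive (trans (+-identityʳ _) (≈-refl κ))))
  where
  support : ∀ {κ j} → j ∈ allFin n → [ j ≈ κ ] ≡ 0 ⊎ j ∈ κ ∷ []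
  support {κ} {j} _ with j ≟ κ
  ... | yes refl = inj₂ (here refl)
  ... | no _     = inj₁ refl
components {n} (e ∷ L) with components L
... | comp , joined , small with comp (proj₁ e) ≟ comp (proj₂ e)
...   | yes same = comp , same ∷ joined , λ κ → ≤-trans (small κ) (+-monoʳ-≤ 2 (m≤n+m _ _))
...   | no differ = comp′ , trans (merge-α _) (sym merge-β) ∷ All.map (cong (merge α β)) joined , small′
  where
  α β : Fin n
  α = comp (proj₁ e)
  β = comp (proj₂ e)
  comp′ : Fin n → Fin n
  comp′ = merge α β ∘ comp
  merge-β : merge α β β ≡ α
  merge-β with β ≟ β
  ... | yes _   = refl
  ... | no β≢β = contradiction refl β≢β
  merge-α : ∀ γ → merge γ β γ ≡ γ
  merge-α γ with γ ≟ β
  ... | yes _ = refl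
  ... | no _  = refl
  rearrange : ∀ x y → (2 + x) + (2 + y) ≡ 2 + (2 + (x + y))
  rearrange = solve-∀
  small′ : ∀ κ → 2 * ∑ (allFin n) (λ x → [ comp′ x ≈ κ ]) ≤ 2 + ∑ (e ∷ L) (incidence comp′ κ)
  small′ κ with κ ≟ α | κ ≟ β
  ... | yes refl | _ = begin
    2 * ∑ (allFin n) (λ x → [ comp′ x ≈ α ])
      ≡⟨ cong (2 *_) (∑-cong (allFin n) (merge-target differ ∘ comp)) ⟩
    2 * ∑ (allFin n) (λ x → [ comp x ≈ α ] + [ comp x ≈ β ])
      ≡⟨ cong (2 *_) (∑-+ _ _ (allFin n)) ⟩
    2 * (∑ (allFin n) (λ x → [ comp x ≈ α ]) + ∑ (allFin n) (λ x → [ comp x ≈ β ]))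
      ≡⟨ *-distribˡ-+ 2 (∑ (allFin n) (λ x → [ comp x ≈ α ])) _ ⟩
    2 * ∑ (allFin n) (λ x → [ comp x ≈ α ]) + 2 * ∑ (allFin n) (λ x → [ comp x ≈ β ])
      ≤⟨ +-mono-≤ (small α) (small β) ⟩
    (2 + ∑ L (incidence comp α)) + (2 + ∑ L (incidence comp β))
      ≡⟨ rearrange (∑ L (incidence comp α)) _ ⟩
    2 + (2 + (∑ L (incidence comp α) + ∑ L (incidence comp β)))
      ≡⟨ cong (2 +_) (cong₂ _+_ (sym new) (trans (sym (∑-+ _ _ L)) (∑-cong L old))) ⟩
    2 + ∑ (e ∷ L) (incidence comp′ α) ∎
    where
    open ≤-Reasoning
    new : incidence comp′ α e ≡ 2
    new rewrite merge-α α | merge-β | ≈-refl α = refl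
    old : ∀ f → incidence comp α f + incidence comp β f ≡ incidence comp′ α f
    old f = trans (+-interchange [ comp (proj₁ f) ≈ α ] _ _ _)
      (sym (cong₂ _+_ (merge-target differ (comp (proj₁ f))) (merge-target differ (comp (proj₂ f)))))
  ... | no _ | yes refl = ≤-trans (≤-reflexive (cong (2 *_)
    (trans (∑-cong (allFin n) (merge-source differ ∘ comp)) (∑-zero (allFin n))))) z≤n
  ... | no κ≢α | no κ≢β = begin
    2 * ∑ (allFin n) (λ x → [ comp′ x ≈ κ ])
      ≡⟨ cong (2 *_) (∑-cong (allFin n) (other ∘ comp)) ⟩
    2 * ∑ (allFin n) (λ x → [ comp x ≈ κ ])
      ≤⟨ small κ ⟩
    2 + ∑ L (incidence comp κ)
      ≡⟨ cong (2 +_) (∑-cong L (λ f → cong₂ _+_ (other (comp (proj₁ f))) (other (comp (proj₂ f))))) ⟨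
    2 + ∑ L (incidence comp′ κ)
      ≤⟨ +-monoʳ-≤ 2 (m≤n+m _ _) ⟩
    2 + ∑ (e ∷ L) (incidence comp′ κ) ∎
    where
    open ≤-Reasoning
    other : ∀ γ → [ merge α β γ ≈ κ ] ≡ [ γ ≈ κ ]
    other = merge-other κ≢α κ≢β

-- The exchange step of matching composition

𝟙 : Bool → ℕ
𝟙 b = if b then 1 else 0

∑-fibre-incidence : ∀ {n} (comp : Fin n → Fin n) (ι : Edge n → ℕ) (g : Fin n → ℕ) (N : List (Edge n)) →
  ∑ N (λ e → ι e * (g (comp (proj₁ e)) + g (comp (proj₂ e)))) ≡
  ∑ (allFin n) (λ κ → g κ * ∑ N (λ e → ι e * incidence comp κ e))
∑-fibre-incidence {n} comp ι g N = sym (begin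
  ∑ (allFin n) (λ κ → g κ * ∑ N (λ e → ι e * incidence comp κ e))
    ≡⟨ ∑-cong (allFin n) (λ κ → sym (∑-* (g κ) _ N)) ⟩
  ∑ (allFin n) (λ κ → ∑ N (λ e → g κ * (ι e * incidence comp κ e)))
    ≡⟨ ∑-swap _ (allFin n) N ⟩
  ∑ N (λ e → ∑ (allFin n) (λ κ → g κ * (ι e * incidence comp κ e)))
    ≡⟨ ∑-cong N pointwise ⟩
  ∑ N (λ e → ι e * (g (comp (proj₁ e)) + g (comp (proj₂ e)))) ∎)
  where
  open ≡-Reasoning
  rearrange : ∀ g i x y → g * (i * (x + y)) ≡ i * (x * g + y * g)
  rearrange = solve-∀
  pointwise : ∀ e → ∑ (allFin n) (λ κ → g κ * (ι e * incidence comp κ e)) ≡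
              ι e * (g (comp (proj₁ e)) + g (comp (proj₂ e)))
  pointwise e = begin
    ∑ (allFin n) (λ κ → g κ * (ι e * incidence comp κ e))
      ≡⟨ ∑-cong (allFin n) (λ κ → rearrange (g κ) (ι e) [ comp (proj₁ e) ≈ κ ] [ comp (proj₂ e) ≈ κ ]) ⟩
    ∑ (allFin n) (λ κ → ι e * ([ comp (proj₁ e) ≈ κ ] * g κ + [ comp (proj₂ e) ≈ κ ] * g κ))
      ≡⟨ ∑-* (ι e) _ (allFin n) ⟩
    ι e * ∑ (allFin n) (λ κ → [ comp (proj₁ e) ≈ κ ] * g κ + [ comp (proj₂ e) ≈ κ ] * g κ)
      ≡⟨ cong (ι e *_) (∑-+ _ _ (allFin n)) ⟩
    ι e * (∑ (allFin n) (λ κ → [ comp (proj₁ e) ≈ κ ] * g κ) + ∑ (allFin n) (λ κ → [ comp (proj₂ e) ≈ κ ] * g κ))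
      ≡⟨ cong (ι e *_) (cong₂ _+_ (∑-pick g (comp (proj₁ e))) (∑-pick g (comp (proj₂ e)))) ⟩
    ι e * (g (comp (proj₁ e)) + g (comp (proj₂ e))) ∎

data Class : Set where
  light middle target heavy : Class

is : Class → Class → Bool
is light  light  = true
is middle middle = true
is target target = true
is heavy  heavy  = true
is _      _      = false

-- The window is [lo , q t₁) and the edges of N in its core [q lo , t₁) are to be removed.  Every
-- component of M and the middle edges of N meets at most two of the other edges of N; it is
-- switched from N to M when it meets a target edge but no heavy one.
module Exchange {n : ℕ} (v : Edge n → ℕ) (q lo t₁ : ℕ) where

  Bound : Class → ℕ → Set
  Bound light  x = x < lo
  Bound middle x = lo ≤ x × x < q * t₁
  Bound target x = (lo ≤ x × x < q * t₁) × (q * lo ≤ x × x < t₁)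
  Bound heavy  x = q * t₁ ≤ x

  InWindow : Edge n → Set
  InWindow e = lo ≤ v e × v e < q * t₁

  classify : ∀ x → Σ[ c ∈ Class ] Bound c x × (c ≡ middle → ¬ (q * lo ≤ x × x < t₁))
  classify x with lo ≤? x | x <? q * t₁ | (q * lo ≤? x) ×-dec (x <? t₁)
  ... | no lo≰x | _        | _     = light , ≰⇒> lo≰x , λ ()
  ... | yes _    | no x≮hi  | _     = heavy , ≮⇒≥ x≮hi , λ ()
  ... | yes p    | yes q    | yes r = target , ((p , q) , r) , λ ()
  ... | yes p    | yes q    | no r  = middle , (p , q) , λ _ → r

  cls : Edge n → Class
  cls e = proj₁ (classify (v e))

  cls-bound : ∀ e → Bound (cls e) (v e)
  cls-bound e = proj₁ (proj₂ (classify (v e)))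

  past-target : 1 ≤ q → ∀ {e} → T (not (is target (cls e))) → q * lo ≤ v e → t₁ ≤ v e
  past-target 1≤q {e} not-target qlo≤v with cls e | cls-bound e | proj₂ (proj₂ (classify (v e)))
  ... | light  | v<lo  | _   =
    contradiction (≤-<-trans (≤-trans (m≤n*m lo q {{>-nonZero 1≤q}}) qlo≤v) v<lo) (n≮n _)
  ... | middle | _     | gap = ≮⇒≥ (λ v<t₁ → gap refl (qlo≤v , v<t₁))
  ... | heavy  | hi≤v  | _   = ≤-trans (m≤n*m t₁ q {{>-nonZero 1≤q}}) hi≤v

  ι : Class → Edge n → ℕ
  ι c e = 𝟙 (is c (cls e))

  middle-or-target : Class → Bool
  middle-or-target c = is middle c ∨ is target c

  module _ {M N : List (Edge n)} (mM : Matching M) (mN : Matching N) where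

    L : List (Edge n)
    L = M ++ select (is middle ∘ cls) N

    comp : Fin n → Fin n
    comp = proj₁ (components L)

    share : Class → Fin n → ℕ
    share c κ = ∑ N (λ e → ι c e * incidence comp κ e)

    share-total : ∀ κ → share light κ + share middle κ + (share target κ + share heavy κ) ≡ ∑ N (incidence comp κ)
    share-total κ = sym (begin
      ∑ N (incidence comp κ)
        ≡⟨ ∑-cong N (λ e → split (cls e) (incidence comp κ e)) ⟩
      ∑ N (λ e → ι light e * incidence comp κ e + ι middle e * incidence comp κ e
                + (ι target e * incidence comp κ e + ι heavy e * incidence comp κ e))
        ≡⟨ ∑-+ _ _ N ⟩
      ∑ N (λ e → ι light e * incidence comp κ e + ι middle e * incidence comp κ e)
        + ∑ N (λ e → ι target e * incidence comp κ e + ι heavy e * incidence comp κ e)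
        ≡⟨ cong₂ _+_ (∑-+ _ _ N) (∑-+ _ _ N) ⟩
      share light κ + share middle κ + (share target κ + share heavy κ) ∎)
      where
      open ≡-Reasoning
      split : ∀ c x → x ≡ 𝟙 (is light c) * x + 𝟙 (is middle c) * x + (𝟙 (is target c) * x + 𝟙 (is heavy c) * x)
      split light  = solve-∀
      split middle = solve-∀
      split target = solve-∀
      split heavy  = solve-∀

    share-≤-2 : ∀ κ → share light κ + share target κ + share heavy κ ≤ 2
    share-≤-2 κ = ≤-by-cancel {a = 2 * size + (m + (l + r + (t + h)))} {b = (2 + (m + r)) + (size + size)}
      (+-mono-≤ small (+-mono-≤ (∑-matching-≤ indicator mM)
        (≤-trans (≤-reflexive (share-total κ)) (∑-matching-≤ indicator mN))))
      (≤-reflexive (rearrange size l m r t h))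
      where
      indicator : Fin n → ℕ
      indicator x = [ comp x ≈ κ ]
      size m l r t h : ℕ
      size = ∑ (allFin n) indicator
      m = ∑ M (incidence comp κ)
      l = share light κ
      r = share middle κ
      t = share target κ
      h = share heavy κ
      rearrange : ∀ s l m r t h → (l + t + h) + ((2 + (m + r)) + (s + s)) ≡ 2 + (2 * s + (m + (l + r + (t + h))))
      rearrange = solve-∀
      select-middle : ∑ (select (is middle ∘ cls) N) (incidence comp κ) ≡ r
      select-middle = trans (∑-select _ _ N) (∑-cong N (λ e → if-𝟙 (is middle (cls e)) (incidence comp κ e)))
        where
        if-𝟙 : ∀ b x → (if b then x else 0) ≡ 𝟙 b * x
        if-𝟙 true  x = sym (*-identityˡ x)
        if-𝟙 false x = refl
      small : 2 * size ≤ 2 + (m + r)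
      small = ≤-trans (proj₂ (proj₂ (components L)) κ)
        (≤-reflexive (cong (2 +_) (trans (∑-++ _ M _) (cong (m +_) select-middle))))

    switch : ℕ → ℕ → Bool
    switch zero    t = not (t ≡ᵇ 0)
    switch (suc _) t = false

    switch-light : ∀ l t h → l + t + h ≤ 2 → 𝟙 (switch h t) * l ≤ t
    switch-light l t       (suc h) _ = z≤n
    switch-light l zero    zero    _ = z≤n
    switch-light l (suc t) zero    p = ≤-trans (≤-reflexive (*-identityˡ l))
      (≤-trans (s≤s⁻¹ (≤-trans (s≤s (m≤m+n l t)) (≤-trans (≤-reflexive (sym (+-suc l t)))
        (≤-trans (≤-reflexive (sym (+-identityʳ _))) p)))) (s≤s z≤n))

    switch-target : ∀ l t h → l + t + h ≤ 2 → 𝟙 (not (switch h t)) * t ≤ h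
    switch-target l zero    h       _ = ≤-trans (≤-reflexive (*-zeroʳ (𝟙 (not (switch h 0))))) z≤n
    switch-target l (suc t) zero    _ = z≤n
    switch-target l (suc t) (suc h) p = ≤-trans (≤-reflexive (*-identityˡ (suc t)))
      (≤-trans (s≤s⁻¹ (≤-trans (s≤s (≤-trans (m≤n+m (suc t) l) (m≤m+n _ h)))
        (≤-trans (≤-reflexive (sym (+-suc _ h))) p))) (s≤s z≤n))

    D : Fin n → Bool
    D κ = switch (share heavy κ) (share target κ)

    d : Fin n → Bool
    d = D ∘ comp

    charge : ∀ (g : Fin n → Bool) c c′ → (∀ κ → 𝟙 (g κ) * share c κ ≤ share c′ κ) →
      ∑ N (λ e → ι c e * (𝟙 (g (comp (proj₁ e))) + 𝟙 (g (comp (proj₂ e))))) ≤ 2 * ∑ N (ι c′)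
    charge g c c′ p = begin
      ∑ N (λ e → ι c e * (𝟙 (g (comp (proj₁ e))) + 𝟙 (g (comp (proj₂ e)))))
        ≡⟨ ∑-fibre-incidence comp (ι c) (𝟙 ∘ g) N ⟩
      ∑ (allFin n) (λ κ → 𝟙 (g κ) * share c κ)
        ≤⟨ ∑-mono (allFin n) (λ κ → ≤-trans (p κ) (≤-reflexive (sym (*-identityˡ _)))) ⟩
      ∑ (allFin n) (λ κ → 1 * share c′ κ)
        ≡⟨ ∑-fibre-incidence comp (ι c′) (λ _ → 1) N ⟨
      ∑ N (λ e → ι c′ e * 2)
        ≡⟨ trans (∑-cong N (λ e → *-comm (ι c′ e) 2)) (∑-* 2 _ N) ⟩
      2 * ∑ N (ι c′) ∎
      where open ≤-Reasoning

    charge-light : ∑ N (λ e → ι light e * (𝟙 (d (proj₁ e)) + 𝟙 (d (proj₂ e)))) ≤ 2 * ∑ N (ι target)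
    charge-light = charge D light target (λ κ → switch-light (share light κ) _ _ (share-≤-2 κ))

    charge-target : ∑ N (λ e → ι target e * (𝟙 (not (d (proj₁ e))) + 𝟙 (not (d (proj₂ e))))) ≤ 2 * ∑ N (ι heavy)
    charge-target = charge (not ∘ D) target heavy (λ κ → switch-target (share light κ) _ _ (share-≤-2 κ))

    d-joined : ∀ {e} → e ∈ L → d (proj₁ e) ≡ d (proj₂ e)
    d-joined e∈L = cong D (All.lookup (proj₁ (proj₂ (components L))) e∈L)

    d-heavy : ∀ {e} → e ∈ N → cls e ≡ heavy → d (proj₁ e) ≡ false × d (proj₂ e) ≡ false
    d-heavy {e} e∈N eq = not-switched (at (m≤m+n _ _) (≈-refl (comp (proj₁ e))))
                       , not-switched (at (m≤n+m _ [ comp (proj₁ e) ≈ _ ]) (≈-refl (comp (proj₂ e))))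
      where
      at : ∀ {κ x} → x ≤ incidence comp κ e → x ≡ 1 → 1 ≤ share heavy κ
      at {κ} x≤ refl = ≤-trans (≤-trans x≤ (≤-reflexive
        (trans (sym (*-identityˡ _)) (cong (λ c → 𝟙 (is heavy c) * incidence comp κ e) (sym eq)))))
        (∑-∈ (λ e → ι heavy e * incidence comp κ e) e∈N)
      not-switched : ∀ {h t} → 1 ≤ h → switch h t ≡ false
      not-switched (s≤s _) = refl

    in-M in-N kept : Edge n → Bool
    in-M e = d (proj₁ e) ∧ d (proj₂ e)
    in-N e = not (d (proj₁ e)) ∧ not (d (proj₂ e))
    kept e = in-N e ∧ not (is target (cls e))

    swapped : Edge n → Bool
    swapped e = in-M e ∧ middle-or-target (cls e)

    exchanged : List (Edge n)
    exchanged = select in-M M ++ select kept N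

    competitor : List (Edge n)
    competitor = select in-N M ++ select swapped N

    ∧-T : ∀ {a b} → T (a ∧ b) → a ≡ true × b ≡ true
    ∧-T {true} {true} _ = refl , refl

    not-∧-T : ∀ {a b} → T (not a ∧ not b) → a ≡ false × b ≡ false
    not-∧-T {false} {false} _ = refl , refl

    ∧-T₁ : ∀ {a b} → T (a ∧ b) → T a
    ∧-T₁ {true} _ = _

    true≢false : ∀ {x y} → d x ≡ true → d y ≡ false → x ≢ y
    true≢false p q refl with trans (sym p) q
    ... | ()

    separated : ∀ {e f} → T (in-M e) → T (in-N f) → VertexDisjoint e f
    separated {e} {f} p q =
      let e₁ , e₂ = ∧-T {d (proj₁ e)} {d (proj₂ e)} p
          f₁ , f₂ = not-∧-T {d (proj₁ f)} {d (proj₂ f)} q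
      in true≢false e₁ f₁ , true≢false e₁ f₂ , true≢false e₂ f₁ , true≢false e₂ f₂

    exchanged-matching : Matching exchanged
    exchanged-matching = ++-matching (filter-matching _ mM) (filter-matching _ mN)
      (λ e∈ f∈ → separated (proj₂ (∈-select⁻ in-M M e∈)) (∧-T₁ (proj₂ (∈-select⁻ kept N f∈))))

    competitor-matching : Matching competitor
    competitor-matching = ++-matching (filter-matching _ mM) (filter-matching _ mN)
      (λ e∈ f∈ → VertexDisjoint-sym
        (separated (∧-T₁ (proj₂ (∈-select⁻ swapped N f∈))) (proj₂ (∈-select⁻ in-N M e∈))))

    competitor-window : All InWindow M → All InWindow competitor
    competitor-window window = All.++⁺ (All.filter⁺ (T? ∘ in-N) window) (All.tabulate in-window)
      where
      bound : ∀ c {b x} → Bound c x → T (b ∧ middle-or-target c) → lo ≤ x × x < q * t₁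
      bound middle p       _ = p
      bound target (p , _) _ = p
      bound light {true} _ ()
      bound light {false} _ ()
      bound heavy {true} _ ()
      bound heavy {false} _ ()
      in-window : ∀ {e} → e ∈ select swapped N → InWindow e
      in-window {e} e∈ = bound (cls e) {in-M e} (cls-bound e) (proj₂ (∈-select⁻ swapped N e∈))

    lost : ∀ w x i → q * x ≤ w → q * x ≤ w * suc i
    lost w x i p = ≤-trans p (m≤m*n w (suc i))

    cost : ∀ c a b x → Bound c x → (c ≡ middle → a ≡ b) → (c ≡ heavy → a ≡ false × b ≡ false) →
      q * x ≤ q * (if (not a ∧ not b) ∧ not (is target c) then x else 0)
            + q * (if (a ∧ b) ∧ middle-or-target c then x else 0)
            + (q * lo * (𝟙 (is light c) * (𝟙 a + 𝟙 b))
              + q * t₁ * (𝟙 (is target c) * (𝟙 (not a) + 𝟙 (not b))))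
    cost light false false x _ _ _ = ≤-trans (m≤m+n (q * x) _) (m≤m+n _ _)
    cost light false true  x p _ _ = ≤-trans (lost (q * lo) x 0 (*-monoʳ-≤ q (<⇒≤ p)))
      (≤-trans (m≤m+n _ _) (m≤n+m _ (q * 0 + q * 0)))
    cost light true  false x p _ _ = ≤-trans (lost (q * lo) x 0 (*-monoʳ-≤ q (<⇒≤ p)))
      (≤-trans (m≤m+n _ _) (m≤n+m _ (q * 0 + q * 0)))
    cost light true  true  x p _ _ = ≤-trans (lost (q * lo) x 1 (*-monoʳ-≤ q (<⇒≤ p)))
      (≤-trans (m≤m+n _ _) (m≤n+m _ (q * 0 + q * 0)))
    cost middle false b x _ mid _ rewrite sym (mid refl) = ≤-trans (m≤m+n (q * x) _) (m≤m+n _ _)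
    cost middle true  b x _ mid _ rewrite sym (mid refl) = ≤-trans (m≤n+m (q * x) (q * 0)) (m≤m+n _ _)
    cost target true  true  x _ _ _ = ≤-trans (m≤n+m (q * x) (q * 0)) (m≤m+n _ _)
    cost target true  false x (_ , _ , p) _ _ = ≤-trans (lost (q * t₁) x 0 (*-monoʳ-≤ q (<⇒≤ p)))
      (≤-trans (m≤n+m _ (q * lo * 0)) (m≤n+m _ (q * 0 + q * 0)))
    cost target false true  x (_ , _ , p) _ _ = ≤-trans (lost (q * t₁) x 0 (*-monoʳ-≤ q (<⇒≤ p)))
      (≤-trans (m≤n+m _ (q * lo * 0)) (m≤n+m _ (q * 0 + q * 0)))
    cost target false false x (_ , _ , p) _ _ = ≤-trans (lost (q * t₁) x 1 (*-monoʳ-≤ q (<⇒≤ p)))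
      (≤-trans (m≤n+m _ (q * lo * 0)) (m≤n+m _ (q * 0 + q * 0)))
    cost heavy a b x _ _ hvy with hvy refl
    ... | refl , refl = ≤-trans (m≤m+n (q * x) _) (m≤m+n _ _)

    exchange : ∀ {E} → q * ∑ competitor v ≤ q * ∑ M v + E →
      q * ∑ N v ≤ q * ∑ exchanged v + E
                + (2 * ∑ N (λ e → ι target e * v e) + 2 * (q * t₁ * ∑ N (ι heavy)))
    exchange {E} near = begin
      q * ∑ N v
        ≡⟨ ∑-* q v N ⟨
      ∑ N (λ e → q * v e)
        ≤⟨ ∑-mono-All (All.tabulate edge-cost) ⟩
      ∑ N (λ e → q * keep e + q * swap e + (q * lo * light-cost e + q * t₁ * target-cost e))
        ≡⟨ trans (∑-+ _ _ N) (cong₂ _+_ (trans (∑-+ _ _ N) (cong₂ _+_ (∑-* q keep N) (∑-* q swap N)))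
             (trans (∑-+ _ _ N) (cong₂ _+_ (∑-* (q * lo) light-cost N) (∑-* (q * t₁) target-cost N)))) ⟩
      q * ∑ N keep + q * ∑ N swap + (q * lo * ∑ N light-cost + q * t₁ * ∑ N target-cost)
        ≤⟨ +-mono-≤ gain (+-mono-≤ light-loss target-loss) ⟩
      q * ∑ exchanged v + E + (2 * ∑ N (λ e → ι target e * v e) + 2 * (q * t₁ * ∑ N (ι heavy))) ∎
      where
      open ≤-Reasoning
      keep swap light-cost target-cost : Edge n → ℕ
      keep e = if kept e then v e else 0
      swap e = if swapped e then v e else 0
      light-cost e = ι light e * (𝟙 (d (proj₁ e)) + 𝟙 (d (proj₂ e)))
      target-cost e = ι target e * (𝟙 (not (d (proj₁ e))) + 𝟙 (not (d (proj₂ e))))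
      edge-cost : ∀ {e} → e ∈ N →
        q * v e ≤ q * keep e + q * swap e + (q * lo * light-cost e + q * t₁ * target-cost e)
      edge-cost {e} e∈N = cost (cls e) (d (proj₁ e)) (d (proj₂ e)) (v e) (cls-bound e)
        (λ eq → d-joined (∈-++⁺ʳ M (∈-filter⁺ (T? ∘ is middle ∘ cls) e∈N (subst (T ∘ is middle) (sym eq) _))))
        (d-heavy e∈N)
      M-split : ∑ M v ≡ ∑ (select in-M M) v + ∑ (select in-N M) v
      M-split = trans (∑-cong-All (All.tabulate pointwise))
        (trans (∑-+ _ _ M) (sym (cong₂ _+_ (∑-select in-M v M) (∑-select in-N v M))))
        where
        same : ∀ a b x → a ≡ b → x ≡ (if a ∧ b then x else 0) + (if not a ∧ not b then x else 0)
        same true  _ x refl = sym (+-identityʳ x)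
        same false _ x refl = refl
        pointwise : ∀ {e} → e ∈ M → v e ≡ (if in-M e then v e else 0) + (if in-N e then v e else 0)
        pointwise {e} e∈M = same (d (proj₁ e)) _ (v e) (d-joined (∈-++⁺ˡ e∈M))
      rearrange₁ : ∀ q x y z w e → q * z + q * w + (q * (x + y) + e) ≡ (q * (x + z) + e) + q * (y + w)
      rearrange₁ = solve-∀
      gain : q * ∑ N keep + q * ∑ N swap ≤ q * ∑ exchanged v + E
      gain = ≤-by-cancel near (≤-reflexive (trans
        (cong₂ (λ s t → s + (q * t + E))
          (cong₂ (λ s t → q * s + q * t) (sym (∑-select kept v N)) (sym (∑-select swapped v N))) M-split)
        (trans (rearrange₁ q (∑ (select in-M M) v) (∑ (select in-N M) v) (∑ (select kept N) v) (∑ (select swapped N) v) E)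
          (sym (cong₂ (λ s t → (q * s + E) + q * t) (∑-++ v (select in-M M) _) (∑-++ v (select in-N M) _))))))
      rearrange₂ : ∀ c x → c * (2 * x) ≡ 2 * (c * x)
      rearrange₂ = solve-∀
      light-loss : q * lo * ∑ N light-cost ≤ 2 * ∑ N (λ e → ι target e * v e)
      light-loss = begin
        q * lo * ∑ N light-cost             ≤⟨ *-monoʳ-≤ (q * lo) charge-light ⟩
        q * lo * (2 * ∑ N (ι target))       ≡⟨ rearrange₂ (q * lo) _ ⟩
        2 * (q * lo * ∑ N (ι target))       ≡⟨ cong (2 *_) (∑-* (q * lo) _ N) ⟨
        2 * ∑ N (λ e → q * lo * ι target e) ≤⟨ *-monoʳ-≤ 2 (∑-mono N (λ e → large (cls e) (cls-bound e))) ⟩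
        2 * ∑ N (λ e → ι target e * v e)    ∎
        where
        large : ∀ c {x} → Bound c x → q * lo * 𝟙 (is target c) ≤ 𝟙 (is target c) * x
        large light  _ = ≤-reflexive (*-zeroʳ (q * lo))
        large middle _ = ≤-reflexive (*-zeroʳ (q * lo))
        large heavy  _ = ≤-reflexive (*-zeroʳ (q * lo))
        large target {x} (_ , p , _) = ≤-trans (≤-reflexive (*-identityʳ _))
          (≤-trans p (≤-reflexive (sym (*-identityˡ x))))
      target-loss : q * t₁ * ∑ N target-cost ≤ 2 * (q * t₁ * ∑ N (ι heavy))
      target-loss = ≤-trans (*-monoʳ-≤ (q * t₁) charge-target) (≤-reflexive (rearrange₂ (q * t₁) _))

-- Composition of the windows

∑< : (ℕ → ℕ) → ℕ → ℕ
∑< f zero    = 0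
∑< f (suc k) = ∑< f k + f k

∑<-mono : ∀ {f g} k → (∀ j → f j ≤ g j) → ∑< f k ≤ ∑< g k
∑<-mono zero    p = z≤n
∑<-mono (suc k) p = +-mono-≤ (∑<-mono k p) (p k)

∑<-+ : ∀ f g k → ∑< (λ j → f j + g j) k ≡ ∑< f k + ∑< g k
∑<-+ f g zero    = refl
∑<-+ f g (suc k) = trans (cong (_+ (f k + g k)) (∑<-+ f g k)) (+-interchange (∑< f k) _ _ _)

∑<-* : ∀ c f k → ∑< (λ j → c * f j) k ≡ c * ∑< f k
∑<-* c f zero    = sym (*-zeroʳ c)
∑<-* c f (suc k) = trans (cong (_+ c * f k) (∑<-* c f k)) (sym (*-distribˡ-+ c _ _))

∑<-∑ : {A : Set} (f : ℕ → A → ℕ) (xs : List A) (k : ℕ) →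
       ∑< (λ j → ∑ xs (f j)) k ≡ ∑ xs (λ x → ∑< (λ j → f j x) k)
∑<-∑ f xs zero    = sym (∑-zero xs)
∑<-∑ f xs (suc k) = trans (cong (_+ ∑ xs (f k)) (∑<-∑ f xs k)) (sym (∑-+ _ _ xs))

∑<-first : ∀ f k → ∑< f (suc k) ≡ f 0 + ∑< (f ∘ suc) k
∑<-first f zero    = +-comm 0 (f 0)
∑<-first f (suc k) = trans (cong (_+ f (suc k)) (∑<-first f k)) (+-assoc (f 0) _ _)

∑<-shift : ∀ f → (∀ j → f j ≤ 1) → ∀ J k → ∑< f k ≤ J + ∑< (λ j → f (j + J)) k
∑<-shift f f≤1 zero    k = ∑<-mono k (λ j → ≤-reflexive (cong f (sym (+-identityʳ j))))
∑<-shift f f≤1 (suc J) k = begin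
  ∑< f k                                      ≤⟨ m≤m+n _ _ ⟩
  ∑< f (suc k)                                ≡⟨ ∑<-first f k ⟩
  f 0 + ∑< (f ∘ suc) k                        ≤⟨ +-mono-≤ (f≤1 0) (∑<-shift (f ∘ suc) (f≤1 ∘ suc) J k) ⟩
  suc (J + ∑< (λ j → f (suc (j + J))) k)      ≤⟨ s≤s (+-monoʳ-≤ J (∑<-mono k (λ j →
                                                   ≤-reflexive (cong f (sym (+-suc j J)))))) ⟩
  suc (J + ∑< (λ j → f (j + suc J)) k)        ∎
  where open ≤-Reasoning

below : ℕ → ℕ → ℕ
below t x = 𝟙 (t ≤ᵇ x)

below-1 : ∀ {t x} → t ≤ x → below t x ≡ 1
below-1 {t} {x} t≤x with t ≤ᵇ x | ≤⇒≤ᵇ t≤x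
... | true | _ = refl

below-0 : ∀ {t x} → x < t → below t x ≡ 0
below-0 {t} {x} x<t with t ≤ᵇ x | ≤ᵇ⇒≤ t x
... | true  | t≤x = contradiction (<-≤-trans x<t (t≤x _)) (n≮n _)
... | false | _   = refl

below-≤-1 : ∀ t x → below t x ≤ 1
below-≤-1 t x with t ≤ᵇ x
... | true  = ≤-refl
... | false = z≤n

module Doubling (b : ℕ → ℕ) (doubling : ∀ j → 2 * b j ≤ b (suc j)) where

  b-mono : ∀ j i → b j ≤ b (j + i)
  b-mono j zero    = ≤-reflexive (cong b (sym (+-identityʳ j)))
  b-mono j (suc i) = ≤-trans (b-mono j i) (≤-trans (m≤m+n _ _) (≤-trans (doubling (j + i))
    (≤-reflexive (cong b (sym (+-suc j i))))))

  geometric : ∀ k → ∑< b (suc k) ≤ 2 * b k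
  geometric zero    = m≤m+n _ _
  geometric (suc k) = ≤-trans (+-monoˡ-≤ (b (suc k)) (≤-trans (geometric k) (doubling k)))
    (≤-reflexive (cong (b (suc k) +_) (sym (+-identityʳ _))))

  ∑-below : ∀ x k → ∑< (λ j → b j * below (b j) x) k ≤ 2 * x
  ∑-below x zero    = z≤n
  ∑-below x (suc k) with b k ≤? x
  ... | yes bk≤x rewrite below-1 bk≤x = ≤-trans (+-monoˡ-≤ _ (∑<-mono k (λ j →
                     ≤-trans (*-monoʳ-≤ (b j) (below-≤-1 (b j) x)) (≤-reflexive (*-identityʳ _)))))
                   (≤-trans (≤-reflexive (cong (∑< b k +_) (*-identityʳ _)))
                   (≤-trans (geometric k) (*-monoʳ-≤ 2 bk≤x)))
  ... | no bk≰x rewrite below-0 (≰⇒> bk≰x) = ≤-trans (≤-reflexive (trans (cong (∑< (λ j → b j * below (b j) x) k +_) (*-zeroʳ (b k)))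
                     (+-identityʳ _))) (∑-below x k)

module Capped (b : ℕ → ℕ) (doubling : ∀ j → 2 * b j ≤ b (suc j)) where

  open Doubling b doubling

  capped : (hi : ℕ → ℕ) → ℕ → ℕ → ℕ
  capped hi y j = below (b j) (2 * y) * (2 * (y ⊓ hi j))

  ∑-capped : ∀ hi J → (∀ j → hi j ≤ b (j + J)) → ∀ y k → ∑< (capped hi y) k ≤ (2 * J + 8) * y
  ∑-capped hi J hi≤ y k = ≤-by-cancel {a = a} {b = a} ≤-refl (≤-trans sum (≤-reflexive (regroup J y _)))
    where
    c : ℕ → ℕ
    c j = b (j + J)
    B : ℕ → ℕ
    B j = below (b j) (2 * y)
    regroup : ∀ J y s → 2 * (2 * (2 * y)) + 2 * y * (J + s) ≡ (2 * J + 8) * y + 2 * y * s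
    regroup = solve-∀
    a : ℕ
    a = 2 * y * ∑< (λ j → B (j + J)) k
    pointwise : ∀ j → capped hi y j + 2 * y * B (j + J) ≤ 2 * (c j * B (j + J)) + 2 * y * B j
    pointwise j with b j ≤? 2 * y | b (j + J) ≤? 2 * y
    ... | no b≰ | yes b≤ = contradiction (≤-trans (b-mono j J) b≤) b≰
    ... | no p  | no r rewrite below-0 (≰⇒> p) | below-0 (≰⇒> r) = ≤-trans (≤-reflexive (*-zeroʳ (2 * y))) z≤n
    ... | yes p | yes r rewrite below-1 p | below-1 r = +-monoˡ-≤ (2 * y * 1) (≤-trans (≤-reflexive (*-identityˡ _))
      (*-monoʳ-≤ 2 (≤-trans (m⊓n≤n y (hi j)) (≤-trans (hi≤ j) (≤-reflexive (sym (*-identityʳ _)))))))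
    ... | yes p | no r rewrite below-1 p | below-0 (≰⇒> r) = ≤-trans (≤-reflexive (trans (cong (1 * (2 * (y ⊓ hi j)) +_) (*-zeroʳ (2 * y)))
      (trans (+-identityʳ _) (*-identityˡ _))))
      (≤-trans (*-monoʳ-≤ 2 (m⊓n≤m y (hi j))) (≤-trans (≤-reflexive (sym (*-identityʳ _))) (m≤n+m _ (2 * (c j * 0)))))
    sum : ∑< (capped hi y) k + a ≤ 2 * (2 * (2 * y)) + 2 * y * (J + ∑< (λ j → B (j + J)) k)
    sum = begin
      ∑< (capped hi y) k + 2 * y * ∑< (λ j → B (j + J)) k
        ≡⟨ cong (∑< (capped hi y) k +_) (sym (∑<-* (2 * y) _ k)) ⟩
      ∑< (capped hi y) k + ∑< (λ j → 2 * y * B (j + J)) k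
        ≡⟨ ∑<-+ _ _ k ⟨
      ∑< (λ j → capped hi y j + 2 * y * B (j + J)) k
        ≤⟨ ∑<-mono k pointwise ⟩
      ∑< (λ j → 2 * (c j * B (j + J)) + 2 * y * B j) k
        ≡⟨ trans (∑<-+ _ _ k) (cong₂ _+_ (∑<-* 2 _ k) (∑<-* (2 * y) _ k)) ⟩
      2 * ∑< (λ j → c j * B (j + J)) k + 2 * y * ∑< B k
        ≤⟨ +-mono-≤ (*-monoʳ-≤ 2 (Shifted.∑-below (2 * y) k))
             (*-monoʳ-≤ (2 * y) (∑<-shift B (λ j → below-≤-1 (b j) (2 * y)) J k)) ⟩
      2 * (2 * (2 * y)) + 2 * y * (J + ∑< (λ j → B (j + J)) k) ∎
      where
      open ≤-Reasoning
      module Shifted = Doubling c (doubling ∘ (_+ J))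

-- The i-th window [lo i , hi i) pads its core [t i , t (suc i)) by a factor q on both sides.
module Composition {n : ℕ} (v : Edge n → ℕ) (q ρ : ℕ) (1≤q : 1 ≤ q) (2≤ρ : 2 ≤ ρ) (P H : Edge n → Set) where

  lo t hi : ℕ → ℕ
  lo i = q * ρ ^ i
  t  i = q * lo i
  hi i = q * t (suc i)

  InWindow : ℕ → Edge n → Set
  InWindow i = Exchange.InWindow v q (lo i) (t (suc i))

  ρ^-doubling : ∀ i → 2 * ρ ^ i ≤ ρ ^ suc i
  ρ^-doubling i = *-monoˡ-≤ (ρ ^ i) 2≤ρ

  scale-doubling : ∀ c {x y} → 2 * x ≤ y → 2 * (c * x) ≤ c * y
  scale-doubling c {x} p = ≤-trans (≤-reflexive (swap c x)) (*-monoʳ-≤ c p)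
    where
    swap : ∀ c x → 2 * (c * x) ≡ c * (2 * x)
    swap = solve-∀

  lo-doubling : ∀ i → 2 * lo i ≤ lo (suc i)
  lo-doubling i = scale-doubling q (ρ^-doubling i)

  t-doubling : ∀ i → 2 * t i ≤ t (suc i)
  t-doubling i = scale-doubling q (lo-doubling i)

  hi-doubling : ∀ i → 2 * hi i ≤ hi (suc i)
  hi-doubling i = scale-doubling q (t-doubling (suc i))

  doubling⇒mono : ∀ {x y} → 2 * x ≤ y → x ≤ y
  doubling⇒mono = ≤-trans (m≤m+n _ _)

  module Windows (k : ℕ) (M : ℕ → List (Edge n)) (E Φ : ℕ → ℕ)
    (M-matching : ∀ i → Matching (M i)) (M⊆P : ∀ i → All P (M i)) (M⊆H : ∀ {i} → i < k → All H (M i))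
    (M-window : ∀ i → All (InWindow i) (M i))
    (near : ∀ i X → Matching X → All P X → All (InWindow i) X → q * ∑ X v ≤ q * ∑ (M i) v + E i)
    (small : ∀ i X → Matching X → All P X → All (InWindow i) X → ∑ X v ≤ Φ i)
    (N₀ : List (Edge n)) (N₀-matching : Matching N₀) (N₀⊆P : All P N₀)
    (N₀-large : All (λ e → t 0 ≤ v e) N₀) where

    above : List (Edge n) → ℕ → ℕ
    above N h = ∑ N (λ e → below h (v e))

    loss : ℕ → ℕ
    loss j = E j + (2 * Φ j + 2 * (hi j * above N₀ (hi j)))

    record Stage (i : ℕ) : Set where
      field
        N         : List (Edge n)
        isMatch   : Matching N
        N⊆P       : All P N
        cleared   : All (λ e → H e ⊎ t i ≤ v e) N
        fewHeavy  : ∀ h → q * t i ≤ h → above N h ≤ above N₀ h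
        value     : q * ∑ N₀ v ≤ q * ∑ N v + ∑< loss i

    stage : ∀ i → i ≤ k → Stage i
    stage zero _ = record
      { N = N₀ ; isMatch = N₀-matching ; N⊆P = N₀⊆P ; cleared = All.map inj₂ N₀-large
      ; fewHeavy = λ _ _ → ≤-refl ; value = ≤-reflexive (sym (+-identityʳ _)) }
    stage (suc i) i<k = record
      { N        = exchanged mM isMatch
      ; isMatch  = exchanged-matching mM isMatch
      ; N⊆P      = All.++⁺ (All.filter⁺ (T? ∘ in-M mM isMatch) (M⊆P i)) (All.filter⁺ (T? ∘ kept mM isMatch) N⊆P)
      ; cleared  = All.++⁺ (All.map inj₁ (All.filter⁺ (T? ∘ in-M mM isMatch) (M⊆H i<k))) (All.tabulate cleared′)
      ; fewHeavy = fewHeavy′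
      ; value    = ≤-trans value (≤-trans (+-monoˡ-≤ (∑< loss i) step-value) (≤-reflexive regroup))
      }
      where
      open Stage (stage i (<⇒≤ i<k))
      open Exchange v q (lo i) (t (suc i)) hiding (InWindow)
      mM : Matching (M i)
      mM = M-matching i
      ∧-T₂ : ∀ {a b} → T (a ∧ b) → T b
      ∧-T₂ {true} p = p
      cleared′ : ∀ {e} → e ∈ select (kept mM isMatch) N → H e ⊎ t (suc i) ≤ v e
      cleared′ {e} e∈ = [ inj₁ , (λ t≤v → inj₂ (past-target 1≤q {e} not-target t≤v)) ]′
        (All.lookup cleared (proj₁ (∈-select⁻ (kept mM isMatch) N e∈)))
        where
        not-target : T (not (is target (cls e)))
        not-target = ∧-T₂ {in-N mM isMatch e} (proj₂ (∈-select⁻ (kept mM isMatch) N e∈))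
      fewHeavy′ : ∀ h → hi i ≤ h → above (exchanged mM isMatch) h ≤ above N₀ h
      fewHeavy′ h hi≤h = begin
        above (exchanged mM isMatch) h
          ≡⟨ ∑-++ _ (select (in-M mM isMatch) (M i)) _ ⟩
        above (select (in-M mM isMatch) (M i)) h + above (select (kept mM isMatch) N) h
          ≤⟨ +-mono-≤ (∑-filter-≤ _ _ (M i)) (∑-filter-≤ _ _ N) ⟩
        above (M i) h + above N h
          ≡⟨ cong (_+ above N h) (trans (∑-cong-All (All.map (λ w → below-0 (<-≤-trans (proj₂ w) hi≤h)) (M-window i))) (∑-zero (M i))) ⟩
        above N h
          ≤⟨ fewHeavy h (≤-trans (*-monoʳ-≤ q (doubling⇒mono (t-doubling i))) hi≤h) ⟩
        above N₀ h ∎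
        where open ≤-Reasoning
      targets : ∑ N (λ e → ι target e * v e) ≤ Φ i
      targets = begin
        ∑ N (λ e → ι target e * v e)
          ≡⟨ ∑-cong N (λ e → 𝟙-if (is target (cls e)) (v e)) ⟩
        ∑ N (λ e → if is target (cls e) then v e else 0)
          ≡⟨ ∑-select (is target ∘ cls) v N ⟨
        ∑ (select (is target ∘ cls) N) v
          ≤⟨ small i _ (filter-matching _ isMatch) (All.filter⁺ (T? ∘ is target ∘ cls) N⊆P)
               (All.tabulate (λ {e} e∈ → window (cls e) (cls-bound e)
                 (proj₂ (∈-select⁻ (is target ∘ cls) N e∈)))) ⟩
        Φ i ∎
        where
        open ≤-Reasoning
        𝟙-if : ∀ b x → 𝟙 b * x ≡ (if b then x else 0)
        𝟙-if true  x = *-identityˡ x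
        𝟙-if false x = refl
        window : ∀ c {x} → Bound c x → T (is target c) → lo i ≤ x × x < hi i
        window target (w , _) _ = w
      heavies : ∑ N (ι heavy) ≤ above N₀ (hi i)
      heavies = ≤-trans (∑-mono N (λ e → heavy-above (cls e) (cls-bound e)))
        (fewHeavy (hi i) (*-monoʳ-≤ q (doubling⇒mono (t-doubling i))))
        where
        heavy-above : ∀ c {x} → Bound c x → 𝟙 (is heavy c) ≤ below (hi i) x
        heavy-above light  _ = z≤n
        heavy-above middle _ = z≤n
        heavy-above target _ = z≤n
        heavy-above heavy  p = ≤-reflexive (sym (below-1 p))
      step-value : q * ∑ N v ≤ q * ∑ (exchanged mM isMatch) v + loss i
      step-value = begin
        q * ∑ N v
          ≤⟨ exchange mM isMatch (near i _ (competitor-matching mM isMatch)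
               (All.++⁺ (All.filter⁺ (T? ∘ in-N mM isMatch) (M⊆P i)) (All.filter⁺ (T? ∘ swapped mM isMatch) N⊆P))
               (competitor-window mM isMatch (M-window i))) ⟩
        q * ∑ (exchanged mM isMatch) v + E i + (2 * ∑ N (λ e → ι target e * v e) + 2 * (hi i * ∑ N (ι heavy)))
          ≤⟨ +-monoʳ-≤ (q * ∑ (exchanged mM isMatch) v + E i)
               (+-mono-≤ (*-monoʳ-≤ 2 targets) (*-monoʳ-≤ 2 (*-monoʳ-≤ (hi i) heavies))) ⟩
        q * ∑ (exchanged mM isMatch) v + E i + (2 * Φ i + 2 * (hi i * above N₀ (hi i)))
          ≡⟨ +-assoc (q * ∑ (exchanged mM isMatch) v) (E i) _ ⟩
        q * ∑ (exchanged mM isMatch) v + loss i ∎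
        where open ≤-Reasoning
      regroup : q * ∑ (exchanged mM isMatch) v + loss i + ∑< loss i ≡ q * ∑ (exchanged mM isMatch) v + (∑< loss i + loss i)
      regroup = trans (+-assoc (q * ∑ (exchanged mM isMatch) v) (loss i) _) (cong (q * ∑ (exchanged mM isMatch) v +_) (+-comm (loss i) (∑< loss i)))

    ∑-loss : ∑< loss k ≤ ∑< E k + 2 * ∑< Φ k + 4 * ∑ N₀ v
    ∑-loss = begin
      ∑< loss k
        ≡⟨ trans (∑<-+ E _ k) (cong (∑< E k +_) (trans (∑<-+ _ _ k)
             (cong₂ _+_ (∑<-* 2 Φ k) (∑<-* 2 _ k)))) ⟩
      ∑< E k + (2 * ∑< Φ k + 2 * ∑< (λ j → hi j * above N₀ (hi j)) k)
        ≤⟨ +-monoʳ-≤ (∑< E k) (+-monoʳ-≤ (2 * ∑< Φ k) (*-monoʳ-≤ 2 heavy-sum)) ⟩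
      ∑< E k + (2 * ∑< Φ k + 2 * (2 * ∑ N₀ v))
        ≡⟨ regroup (∑< E k) (2 * ∑< Φ k) (∑ N₀ v) ⟩
      ∑< E k + 2 * ∑< Φ k + 4 * ∑ N₀ v ∎
      where
      open ≤-Reasoning
      regroup : ∀ a b c → a + (b + 2 * (2 * c)) ≡ a + b + 4 * c
      regroup = solve-∀
      heavy-sum : ∑< (λ j → hi j * above N₀ (hi j)) k ≤ 2 * ∑ N₀ v
      heavy-sum = begin
        ∑< (λ j → hi j * above N₀ (hi j)) k
          ≤⟨ ∑<-mono k (λ j → ≤-reflexive (sym (∑-* (hi j) _ N₀))) ⟩
        ∑< (λ j → ∑ N₀ (λ e → hi j * below (hi j) (v e))) k
          ≡⟨ ∑<-∑ _ N₀ k ⟩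
        ∑ N₀ (λ e → ∑< (λ j → hi j * below (hi j) (v e)) k)
          ≤⟨ ∑-mono N₀ (λ e → Doubling.∑-below hi hi-doubling (v e) k) ⟩
        ∑ N₀ (λ e → 2 * v e)
          ≡⟨ ∑-* 2 v N₀ ⟩
        2 * ∑ N₀ v ∎

    abstract
      composition : (∀ {e} → P e → v e < t k) →
        Σ[ N ∈ List (Edge n) ] (Matching N × All P N × All H N
          × q * ∑ N₀ v ≤ q * ∑ N v + (∑< E k + 2 * ∑< Φ k + 4 * ∑ N₀ v))
      composition bounded = N , isMatch , N⊆P , All.zipWith in-H (N⊆P , cleared)
        , ≤-trans value (+-monoʳ-≤ _ ∑-loss)
        where
        open Stage (stage k ≤-refl)
        in-H : ∀ {e} → P e × (H e ⊎ t k ≤ v e) → H e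
        in-H (_  , inj₁ He)  = He
        in-H (Pe , inj₂ t≤v) = contradiction (≤-<-trans t≤v (bounded Pe)) (n≮n _)

  module Capacity (y : Fin n → ℕ) (covered : ∀ {e} → P e → v e ≤ y (proj₁ e) + y (proj₂ e)) where

    open Capped lo lo-doubling

    capacity : ℕ → ℕ
    capacity i = ∑ (allFin n) (λ x → capped hi (y x) i)

    capacity-bound : ∀ i X → Matching X → All P X → All (InWindow i) X → ∑ X v ≤ capacity i
    capacity-bound i X mX X⊆P window = ≤-trans (∑-mono-All (All.zipWith pointwise (X⊆P , window)))
      (∑-matching-≤ (λ x → capped hi (y x) i) mX)
      where
      half : ∀ x z w → w ≤ x + z → z ≤ x → lo i ≤ w → w < hi i → w ≤ capped hi x i
      half x z w w≤ z≤x lo≤w w<hi = ≤-trans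
        (≤-trans (⊓-glb w≤2x (≤-trans (<⇒≤ w<hi) (m≤m+n _ _)))
          (≤-reflexive (sym (*-distribˡ-⊓ 2 x (hi i)))))
        (≤-reflexive (trans (sym (*-identityˡ _)) (cong (_* (2 * (x ⊓ hi i))) (sym (below-1 (≤-trans lo≤w w≤2x))))))
        where
        w≤2x : w ≤ 2 * x
        w≤2x = ≤-trans w≤ (≤-trans (+-monoʳ-≤ x z≤x) (≤-reflexive (cong (x +_) (sym (+-identityʳ x)))))
      pointwise : ∀ {e} → P e × InWindow i e → v e ≤ capped hi (y (proj₁ e)) i + capped hi (y (proj₂ e)) i
      pointwise {e} (Pe , lo≤v , v<hi) with ≤-total (y (proj₁ e)) (y (proj₂ e))
      ... | inj₁ y₁≤y₂ = ≤-trans (half (y (proj₂ e)) (y (proj₁ e)) (v e)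
                           (≤-trans (covered Pe) (≤-reflexive (+-comm (y (proj₁ e)) _))) y₁≤y₂ lo≤v v<hi) (m≤n+m _ _)
      ... | inj₂ y₂≤y₁ = ≤-trans (half (y (proj₁ e)) (y (proj₂ e)) (v e) (covered Pe) y₂≤y₁ lo≤v v<hi) (m≤m+n _ _)

    ∑-capacity : ∀ J → q * q * ρ ≤ ρ ^ J → ∀ k → ∑< capacity k ≤ (2 * J + 8) * ∑ (allFin n) y
    ∑-capacity J large k = begin
      ∑< capacity k
        ≡⟨ ∑<-∑ _ (allFin n) k ⟩
      ∑ (allFin n) (λ x → ∑< (capped hi (y x)) k)
        ≤⟨ ∑-mono (allFin n) (λ x → ∑-capped hi J hi≤lo (y x) k) ⟩
      ∑ (allFin n) (λ x → (2 * J + 8) * y x)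
        ≡⟨ ∑-* (2 * J + 8) y (allFin n) ⟩
      (2 * J + 8) * ∑ (allFin n) y ∎
      where
      open ≤-Reasoning
      regroup : ∀ q ρ x → q * (q * (q * (ρ * x))) ≡ q * (x * (q * q * ρ))
      regroup = solve-∀
      hi≤lo : ∀ j → hi j ≤ lo (j + J)
      hi≤lo j = ≤-trans (≤-reflexive (regroup q ρ (ρ ^ j)))
        (*-monoʳ-≤ q (≤-trans (*-monoʳ-≤ (ρ ^ j) large) (≤-reflexive (sym (^-distribˡ-+-* ρ j J)))))

-- Duality for bipartite graphs and unfolding

module _ {n : ℕ} (side : Fin n → Bool) where

  left right : Edge n → Fin n
  left  (a , b) = if side a then a else b
  right (a , b) = if side a then b else a

  Crossing : Edge n → Set
  Crossing e = side (proj₁ e) ≢ side (proj₂ e)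

  AtSide : Edge n → Fin n → Set
  AtSide e x = side x ≡ true × left e ≡ x ⊎ side x ≡ false × right e ≡ x

  at-side : ∀ e → Crossing e → AtSide e (proj₁ e) × AtSide e (proj₂ e)
  at-side (a , b) differ = by-cases (side a) (side b) refl refl
    where
    by-cases : ∀ p q → side a ≡ p → side b ≡ q → AtSide (a , b) a × AtSide (a , b) b
    by-cases true  true  p q = contradiction (trans p (sym q)) differ
    by-cases false false p q = contradiction (trans p (sym q)) differ
    by-cases true  false p q rewrite p = inj₁ (refl , refl) , inj₂ (q , refl)
    by-cases false true  p q rewrite p = inj₂ (refl , refl) , inj₁ (q , refl)

  crossing⇒disjoint : ∀ {e f} → Crossing e → Crossing f → left e ≢ left f × right e ≢ right f → VertexDisjoint e f
  crossing⇒disjoint {e} {f} ce cf (l≢ , r≢) with at-side e ce | at-side f cf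
  ... | e₁ , e₂ | f₁ , f₂ = apart e₁ f₁ , apart e₁ f₂ , apart e₂ f₁ , apart e₂ f₂
    where
    apart : ∀ {x y} → AtSide e x → AtSide f y → x ≢ y
    apart (inj₁ (_ , p)) (inj₁ (_ , q)) refl = l≢ (trans p (sym q))
    apart (inj₂ (_ , p)) (inj₂ (_ , q)) refl = r≢ (trans p (sym q))
    apart (inj₁ (p , _)) (inj₂ (q , _)) refl = contradiction (trans (sym p) q) λ ()
    apart (inj₂ (p , _)) (inj₁ (q , _)) refl = contradiction (trans (sym p) q) λ ()

  abstract
    bipartite-duality : (E : List (Edge n × ℕ)) → All (Crossing ∘ proj₁) E →
      Σ[ M ∈ List (Edge n × ℕ) ] Σ[ y ∈ (Fin n → ℕ) ]
        ( All (_∈ E) M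
        × Matching (map proj₁ M)
        × All (λ (e , w) → w ≤ y (proj₁ e) + y (proj₂ e)) E
        × ∑ (allFin n) y ≤ ∑ M (suc ∘ proj₂) )
    bipartite-duality E crossing with Auction.duality E (left ∘ proj₁) (right ∘ proj₁) proj₂
    ... | M , y , z , M⊆E , disjoint , cover , value =
      M , Y , M⊆E , matching (All.map⁺ (All.map loopless′ M⊆E)) (AllPairs.map⁺ (disjoint′ M⊆E disjoint))
        , All.tabulate cover′ , ≤-trans Y≤ value
      where
      Y : Fin n → ℕ
      Y x = if side x then y x else z x
      loopless′ : ∀ {e} → e ∈ E → Loopless (proj₁ e)
      loopless′ e∈E p = All.lookup crossing e∈E (cong side p)
      cover′ : ∀ {e} → e ∈ E → proj₂ e ≤ Y (proj₁ (proj₁ e)) + Y (proj₂ (proj₁ e))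
      cover′ {(a , b) , w} e∈E = by-cases (side a) (side b) refl refl (All.lookup cover e∈E)
        where
        by-cases : ∀ p q → side a ≡ p → side b ≡ q → w ≤ y (left (a , b)) + z (right (a , b)) → w ≤ Y a + Y b
        by-cases true  true  p q _ = contradiction (trans p (sym q)) (All.lookup crossing e∈E)
        by-cases false false p q _ = contradiction (trans p (sym q)) (All.lookup crossing e∈E)
        by-cases true  false p q c rewrite p | q = c
        by-cases false true  p q c rewrite p | q = ≤-trans c (≤-reflexive (+-comm (y b) (z a)))
      Y≤ : ∑ (allFin n) Y ≤ ∑ (allFin n) y + ∑ (allFin n) z
      Y≤ = ≤-trans (∑-mono (allFin n) pointwise) (≤-reflexive (∑-+ y z (allFin n)))
        where
        pointwise : ∀ x → Y x ≤ y x + z x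
        pointwise x with side x
        ... | true  = m≤m+n _ _
        ... | false = m≤n+m _ _
      disjoint′ : ∀ {M} → All (_∈ E) M →
        AllPairs (λ e f → left (proj₁ e) ≢ left (proj₁ f) × right (proj₁ e) ≢ right (proj₁ f)) M →
        AllPairs (λ e f → VertexDisjoint (proj₁ e) (proj₁ f)) M
      disjoint′ []         []       = []
      disjoint′ (e∈ ∷ M⊆E) (d ∷ ds) =
        All.zipWith (λ (f∈ , r) → crossing⇒disjoint (All.lookup crossing e∈) (All.lookup crossing f∈) r) (M⊆E , d)
        ∷ disjoint′ M⊆E ds

SameEdge-sym : ∀ {n} {e f : Edge n} → SameEdge e f → SameEdge f e
SameEdge-sym (inj₁ (p , q)) = inj₁ (sym p , sym q)
SameEdge-sym (inj₂ (p , q)) = inj₂ (sym q , sym p)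

disjoint⇒¬SameEdge : ∀ {n} {e f : Edge n} → VertexDisjoint e f → ¬ SameEdge e f
disjoint⇒¬SameEdge (p , _ , _ , _) (inj₁ (eq , _)) = p eq
disjoint⇒¬SameEdge (_ , q , _ , _) (inj₂ (eq , _)) = q eq

module Unfolding {n : ℕ} (q K : ℕ) where

  base : Fin (n * K) → Fin n
  base x = proj₁ (remQuot {n} K x)

  level : Fin (n * K) → ℕ
  level x = toℕ (proj₂ (remQuot {n} K x))

  base-combine : ∀ (a : Fin n) (i : Fin K) → base (combine a i) ≡ a
  base-combine a i = cong proj₁ (Fin.remQuot-combine a i)

  level-combine : ∀ (a : Fin n) (i : Fin K) → level (combine a i) ≡ toℕ i
  level-combine a i = cong (toℕ ∘ proj₂) (Fin.remQuot-combine a i)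

  copies : Edge n → (ω : ℕ) → ω ≤ K → List (Edge (n * K))
  copies (a , b) ω ω≤K =
    tabulate {n = ω} (λ i → combine a (inject≤ i ω≤K) , combine b (inject≤ (opposite i) ω≤K))

  unfold : Edge n × ℕ → List (Edge (n * K))
  unfold (e , ω) with q ≤? ω ×-dec ω <? K
  ... | yes (_ , ω<K) = copies e ω (<⇒≤ ω<K)
  ... | no _          = []

  refold : Edge (n * K) → Edge n × ℕ
  refold (x , y) = (base x , base y) , suc (level x + level y)

  InRange : ℕ → Set
  InRange ω = q ≤ ω × ω < K

  ∈-copies⁻ : ∀ e ω ω≤K {f} → f ∈ copies e ω ω≤K → refold f ≡ (e , ω)
  ∈-copies⁻ (a , b) ω ω≤K f∈ with ∈-tabulate⁻ f∈
  ... | i , refl = cong₂ _,_ (cong₂ _,_ (base-combine a _) (base-combine b _)) (begin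
    suc (level (combine a (inject≤ i ω≤K)) + level (combine b (inject≤ (opposite i) ω≤K)))
      ≡⟨ cong₂ (λ s t → suc (s + t)) (trans (level-combine a _) (Fin.toℕ-inject≤ i ω≤K))
           (trans (level-combine b _) (trans (Fin.toℕ-inject≤ (opposite i) ω≤K) (Fin.opposite-prop i))) ⟩
    suc (toℕ i) + (ω ∸ suc (toℕ i))
      ≡⟨ m+[n∸m]≡n (Fin.toℕ<n i) ⟩
    ω ∎)
    where open ≡-Reasoning

  ∈-copies⁺ : ∀ ω (ω≤K : ω ≤ K) f → proj₂ (refold f) ≡ ω → f ∈ copies (proj₁ (refold f)) ω ω≤K
  ∈-copies⁺ ω ω≤K (x , y) refl = subst (_∈ copies (base x , base y) ω ω≤K) (cong₂ _,_ fst snd) (∈-tabulate⁺ {f = copy} i)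
    where
    copy : Fin ω → Edge (n * K)
    copy i = combine (base x) (inject≤ i ω≤K) , combine (base y) (inject≤ (opposite i) ω≤K)
    i : Fin ω
    i = fromℕ< (s≤s (m≤m+n (level x) (level y)))
    rebuild : ∀ z j → toℕ j ≡ level z → combine (base z) j ≡ z
    rebuild z j eq = trans (cong (combine (base z)) (Fin.toℕ-injective eq)) (Fin.combine-remQuot {n} K z)
    toℕ-i : toℕ i ≡ level x
    toℕ-i = Fin.toℕ-fromℕ< _
    fst : combine (base x) (inject≤ i ω≤K) ≡ x
    fst = rebuild x _ (trans (Fin.toℕ-inject≤ i ω≤K) toℕ-i)
    snd : combine (base y) (inject≤ (opposite i) ω≤K) ≡ y
    snd = rebuild y _ (trans (Fin.toℕ-inject≤ (opposite i) ω≤K) (trans (Fin.opposite-prop i)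
      (trans (cong (λ j → suc (level x + level y) ∸ suc j) toℕ-i) (m+n∸m≡n (level x) (level y)))))

  ∈-unfold⁻ : ∀ e ω {f} → f ∈ unfold (e , ω) → refold f ≡ (e , ω) × InRange ω
  ∈-unfold⁻ e ω f∈ with q ≤? ω ×-dec ω <? K
  ... | yes (q≤ω , ω<K) = ∈-copies⁻ e ω (<⇒≤ ω<K) f∈ , q≤ω , ω<K

  ∈-unfold⁺ : ∀ {e ω f} → refold f ≡ (e , ω) → InRange ω → f ∈ unfold (e , ω)
  ∈-unfold⁺ {ω = ω} {f} refl r with q ≤? ω ×-dec ω <? K
  ... | yes (_ , ω<K) = ∈-copies⁺ ω (<⇒≤ ω<K) f refl
  ... | no ¬r         = contradiction r ¬r

  copies-disjoint : ∀ e ω ω≤K → Loopless e → AllPairs VertexDisjoint (copies e ω ω≤K)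
  copies-disjoint (a , b) ω ω≤K a≢b = AllPairs.tabulate⁺ (λ {i} {j} i≢j →
      (λ p → i≢j (Fin.inject≤-injective ω≤K ω≤K i j (Fin.combine-injectiveʳ a _ a _ p)))
    , (λ p → a≢b (Fin.combine-injectiveˡ a _ b _ p))
    , (λ p → a≢b (sym (Fin.combine-injectiveˡ b _ a _ p)))
    , (λ p → i≢j (opposite-injective (Fin.inject≤-injective ω≤K ω≤K (opposite i) (opposite j)
                   (Fin.combine-injectiveʳ b _ b _ p)))))
    where
    opposite-injective : ∀ {i j : Fin ω} → opposite i ≡ opposite j → i ≡ j
    opposite-injective p = trans (sym (Fin.opposite-involutive _))
      (trans (cong opposite p) (Fin.opposite-involutive _))

  unfold-disjoint : ∀ e ω → Loopless e → AllPairs VertexDisjoint (unfold (e , ω))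
  unfold-disjoint e ω l with q ≤? ω ×-dec ω <? K
  ... | yes (_ , ω<K) = copies-disjoint e ω (<⇒≤ ω<K) l
  ... | no _          = []

  length-unfold : ∀ e ω → InRange ω → length (unfold (e , ω)) ≡ ω
  length-unfold e ω r with q ≤? ω ×-dec ω <? K
  ... | yes _ = List.length-tabulate _
  ... | no ¬r = contradiction r ¬r

  length-unfold-≤ : ∀ e ω → length (unfold (e , ω)) ≤ K
  length-unfold-≤ e ω with q ≤? ω ×-dec ω <? K
  ... | yes (_ , ω<K) = ≤-trans (≤-reflexive (List.length-tabulate {n = ω} _)) (<⇒≤ ω<K)
  ... | no _          = z≤n

  length-concatMap : {A B : Set} (h : A → List B) (xs : List A) →
    length (concatMap h xs) ≡ ∑ xs (length ∘ h)
  length-concatMap h []       = refl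
  length-concatMap h (x ∷ xs) = trans (List.length-++ (h x)) (cong (length (h x) +_) (length-concatMap h xs))

  count-below : ∀ Y → ∑ (allFin K) (λ i → below (suc (toℕ i)) Y) ≤ Y
  count-below Y = begin
    ∑ (allFin K) (λ i → below (suc (toℕ i)) Y)
      ≡⟨ ∑-map (λ j → below (suc j) Y) toℕ (allFin K) ⟨
    ∑ (map toℕ (allFin K)) (λ j → below (suc j) Y)
      ≤⟨ ∑-⊆ {ys = upTo Y} (Unique.map⁺ Fin.toℕ-injective (allFin-unique K)) (λ {j} _ → support j) ⟩
    ∑ (upTo Y) (λ j → below (suc j) Y)
      ≤⟨ ∑-mono (upTo Y) (λ j → below-≤-1 (suc j) Y) ⟩
    ∑ (upTo Y) (λ _ → 1)
      ≡⟨ trans (∑-const 1 (upTo Y)) (trans (*-identityʳ _) (List.length-upTo Y)) ⟩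
    Y ∎
    where
    open ≤-Reasoning
    support : ∀ j → below (suc j) Y ≡ 0 ⊎ j ∈ upTo Y
    support j with j <? Y
    ... | yes j<Y = inj₂ (∈-upTo⁺ j<Y)
    ... | no j≮Y  = inj₁ (below-0 (s≤s (≮⇒≥ j≮Y)))

  -- A cover y of the folded edges yields the vertex cover { (x , i) : i < y x } of the unfolded ones.
  unfolded-cover : ∀ {M} (y : Fin n → ℕ) → Matching M →
    All (λ f → suc (level (proj₁ f) + level (proj₂ f)) ≤ y (base (proj₁ f)) + y (base (proj₂ f))) M →
    length M ≤ ∑ (allFin n) y
  unfolded-cover {M} y mM covered = begin
    length M                                  ≡⟨ trans (∑-const 1 M) (*-identityʳ _) ⟨
    ∑ M (λ _ → 1)                             ≤⟨ ∑-mono-All (All.map (λ {f} → hit {proj₁ f} {proj₂ f}) covered) ⟩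
    ∑ M (λ f → c (proj₁ f) + c (proj₂ f))    ≤⟨ ∑-matching-≤ c mM ⟩
    ∑ (allFin (n * K)) c                      ≤⟨ ∑-⊆ (allFin-unique (n * K)) (λ {x} _ → inj₂ (listed x)) ⟩
    ∑ (concatMap (λ a → map (combine a) (allFin K)) (allFin n)) c
                                              ≡⟨ ∑-concatMap c _ (allFin n) ⟩
    ∑ (allFin n) (λ a → ∑ (map (combine a) (allFin K)) c)
                                              ≤⟨ ∑-mono (allFin n) column ⟩
    ∑ (allFin n) y                            ∎
    where
    open ≤-Reasoning
    c : Fin (n * K) → ℕ
    c x = below (suc (level x)) (y (base x))
    hit : ∀ {x z} → suc (level x + level z) ≤ y (base x) + y (base z) → 1 ≤ c x + c z
    hit {x} {z} p with suc (level x) ≤? y (base x)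
    ... | yes q = ≤-trans (≤-reflexive (sym (below-1 q))) (m≤m+n _ _)
    ... | no ¬q = ≤-trans (≤-reflexive (sym (below-1 z-covered))) (m≤n+m _ (c x))
      where
      z-covered : suc (level z) ≤ y (base z)
      z-covered = +-cancelˡ-≤ (level x) _ _ (≤-trans (≤-reflexive (+-suc (level x) (level z)))
        (≤-trans p (+-monoˡ-≤ (y (base z)) (s≤s⁻¹ (≰⇒> ¬q)))))
    listed : ∀ x → x ∈ concatMap (λ a → map (combine a) (allFin K)) (allFin n)
    listed x = ∈-concatMap⁺ _ (lose (∈-allFin (base x))
      (subst (_∈ map (combine (base x)) (allFin K)) (Fin.combine-remQuot {n} K x) (∈-map⁺ _ (∈-allFin _))))
    column : ∀ a → ∑ (map (combine a) (allFin K)) c ≤ y a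
    column a = begin
      ∑ (map (combine a) (allFin K)) c
        ≡⟨ ∑-map c (combine a) (allFin K) ⟩
      ∑ (allFin K) (c ∘ combine a)
        ≡⟨ ∑-cong (allFin K) (λ i → cong₂ (λ l b → below (suc l) (y b)) (level-combine a i) (base-combine a i)) ⟩
      ∑ (allFin K) (λ i → below (suc (toℕ i)) (y a))
        ≤⟨ count-below (y a) ⟩
      y a ∎

module UnfoldedGraph {n : ℕ} (q K : ℕ) (G : Graph n) (ω : Edge n → ℕ)
  (ω-sym : ∀ {e f} → SameEdge e f → ω e ≡ ω f) where

  open Unfolding {n} q K

  InG : Edge n → Set
  InG e = Any (SameEdge e) (edges G)

  InG-loopless : ∀ {e} → InG e → Loopless e
  InG-loopless e∈G with find e∈G
  ... | g , g∈ , inj₁ (refl , refl) = All.lookup (loopless G) g∈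
  ... | g , g∈ , inj₂ (refl , refl) = All.lookup (loopless G) g∈ ∘ sym

  expand : Edge n → List (Edge (n * K))
  expand e = unfold (e , ω e)

  unfolded : List (Edge n) → List (Edge (n * K))
  unfolded = concatMap expand

  ∈-expand⁻ : ∀ {e f} → f ∈ expand e → (base (proj₁ f) ≡ proj₁ e × base (proj₂ f) ≡ proj₂ e) × InRange (ω e)
  ∈-expand⁻ {e} f∈ with ∈-unfold⁻ e (ω e) f∈
  ... | eq , r = (cong (proj₁ ∘ proj₁) eq , cong (proj₂ ∘ proj₁) eq) , r

  ∈-unfolded⁻ : ∀ N {f} → f ∈ unfolded N → Σ[ e ∈ Edge n ] e ∈ N × f ∈ expand e
  ∈-unfolded⁻ N f∈ = find (∈-concatMap⁻ expand {xs = N} f∈)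

  unfolded-pairs : ∀ {R S : ∀ {m} → Edge m → Edge m → Set} →
    (∀ {e} → InG e → AllPairs R (expand e)) →
    (∀ {e e′ f f′} → S e e′ → f ∈ expand e → f′ ∈ expand e′ → R f f′) →
    ∀ {N} → All InG N → AllPairs S N → AllPairs R (unfolded N)
  unfolded-pairs within across N⊆G pairs = AllPairs.concat⁺ (All.map⁺ (All.map within N⊆G))
    (AllPairs.map⁺ (AllPairs.map (λ s → All.tabulate (λ f∈ → All.tabulate (λ f′∈ → across s f∈ f′∈))) pairs))

  expand-apart : ∀ {e e′ f f′} → VertexDisjoint e e′ → f ∈ expand e → f′ ∈ expand e′ → VertexDisjoint f f′
  expand-apart (p , q , r , s) f∈ f′∈ with ∈-expand⁻ f∈ | ∈-expand⁻ f′∈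
  ... | (refl , refl) , _ | (refl , refl) , _ =
    p ∘ cong base , q ∘ cong base , r ∘ cong base , s ∘ cong base

  expand-differ : ∀ {e e′ f f′} → ¬ SameEdge e e′ → f ∈ expand e → f′ ∈ expand e′ → ¬ SameEdge f f′
  expand-differ differ f∈ f′∈ same with ∈-expand⁻ f∈ | ∈-expand⁻ f′∈ | same
  ... | (refl , refl) , _ | (refl , refl) , _ | inj₁ (p , q) = differ (inj₁ (cong base p , cong base q))
  ... | (refl , refl) , _ | (refl , refl) , _ | inj₂ (p , q) = differ (inj₂ (cong base p , cong base q))

  expand-loopless : ∀ {e f} → Loopless e → f ∈ expand e → Loopless f
  expand-loopless l f∈ p with ∈-expand⁻ f∈
  ... | (refl , refl) , _ = l (cong base p)

  edges⊆G : All InG (edges G)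
  edges⊆G = All.tabulate (λ e∈ → lose e∈ (inj₁ (refl , refl)))

  U : Graph (n * K)
  U = record
    { edges    = unfolded (edges G)
    ; loopless = All.tabulate loopless′
    ; simple   = unfolded-pairs {R = λ e f → ¬ SameEdge e f} {S = λ e f → ¬ SameEdge e f}
        (λ {e} e∈G → AllPairs.map disjoint⇒¬SameEdge (unfold-disjoint e (ω e) (InG-loopless e∈G)))
        expand-differ edges⊆G (simple G)
    }
    where
    loopless′ : ∀ {f} → f ∈ unfolded (edges G) → Loopless f
    loopless′ f∈ with ∈-unfolded⁻ (edges G) f∈
    ... | e , e∈ , f∈e = expand-loopless (All.lookup (loopless G) e∈) f∈e

  U-bipartite : Bipartite G → Bipartite U
  U-bipartite (side , crossing) = side ∘ base , All.tabulate crossing′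
    where
    crossing′ : ∀ {f} → f ∈ unfolded (edges G) → side (base (proj₁ f)) ≢ side (base (proj₂ f))
    crossing′ f∈ with ∈-unfolded⁻ (edges G) f∈
    ... | e , e∈ , f∈e with ∈-expand⁻ f∈e
    ...   | (refl , refl) , _ = All.lookup crossing e∈

  U-size : ∀ {m} → length (edges G) ≤ m → length (edges U) ≤ m * K
  U-size {m} G≤m = begin
    length (unfolded (edges G))           ≡⟨ length-concatMap expand (edges G) ⟩
    ∑ (edges G) (length ∘ expand)         ≤⟨ ∑-mono (edges G) (λ e → length-unfold-≤ e (ω e)) ⟩
    ∑ (edges G) (λ _ → K)                 ≡⟨ ∑-const K (edges G) ⟩
    length (edges G) * K                  ≤⟨ *-monoˡ-≤ K G≤m ⟩
    m * K                                 ∎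
    where open ≤-Reasoning

  expand-InG : ∀ {e f} → InG e → f ∈ expand e → Any (SameEdge f) (edges U)
  expand-InG {e} {f} e∈G f∈ with find e∈G | ∈-unfold⁻ e (ω e) f∈
  ... | g , g∈ , inj₁ (refl , refl) | _ = lose (∈-concatMap⁺ expand (lose g∈ f∈)) (inj₁ (refl , refl))
  ... | g , g∈ , inj₂ (refl , refl) | eq , r =
    lose (∈-concatMap⁺ expand (lose g∈ (∈-unfold⁺ flipped (subst InRange same r)))) (inj₂ (refl , refl))
    where
    same : ω e ≡ ω g
    same = ω-sym (inj₂ (refl , refl))
    flipped : refold (proj₂ f , proj₁ f) ≡ (g , ω g)
    flipped = cong₂ _,_ (cong (λ z → proj₂ (proj₁ z) , proj₁ (proj₁ z)) eq)
      (trans (cong suc (+-comm (level (proj₂ f)) _)) (trans (cong proj₂ eq) same))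

  unfolded-matching : ∀ {N} → Matching N → All InG N → IsMatching U (unfolded N)
  unfolded-matching {N} mN N⊆G = record
    { subset   = All.tabulate subset′
    ; disjoint = unfolded-pairs {R = VertexDisjoint} {S = VertexDisjoint}
        (λ {e} e∈G → unfold-disjoint e (ω e) (InG-loopless e∈G)) expand-apart N⊆G (disjoint mN)
    }
    where
    subset′ : ∀ {f} → f ∈ unfolded N → Any (SameEdge f) (edges U)
    subset′ f∈ with ∈-unfolded⁻ N f∈
    ... | e , e∈ , f∈e = expand-InG (All.lookup N⊆G e∈) f∈e

  length-unfolded : ∀ {N} → All (InRange ∘ ω) N → length (unfolded N) ≡ ∑ N ω
  length-unfolded {N} window = trans (length-concatMap expand N)
    (∑-cong-All (All.map (λ {e} → length-unfold e (ω e)) window))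

  Faithful : Edge n × ℕ → Set
  Faithful (e , w) = InG e × w ≡ ω e × InRange w

  module _ {M′ : List (Edge (n * K))} (isM′ : IsMatching U M′) where

    open IsMatching isM′ renaming (disjoint to M′-disjoint)

    refold-faithful : All Faithful (map refold M′)
    refold-faithful = All.map⁺ (All.map faithful subset)
      where
      faithful : ∀ {f} → Any (SameEdge f) (edges U) → Faithful (refold f)
      faithful {f} f∈U with find f∈U
      ... | h , h∈ , same with ∈-unfolded⁻ (edges G) h∈
      ...   | g , g∈ , h∈g = transfer same (∈-unfold⁻ g (ω g) h∈g)
        where
        transfer : ∀ {f} → SameEdge f h → refold h ≡ (g , ω g) × InRange (ω g) → Faithful (refold f)
        transfer {f} s (eq , r) = lose g∈ same-base , weight-eq , subst InRange (trans (ω-sym (SameEdge-sym same-base)) (sym weight-eq)) r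
          where
          refold-same : ∀ {f h} → SameEdge f h →
            SameEdge (proj₁ (refold f)) (proj₁ (refold h)) × proj₂ (refold f) ≡ proj₂ (refold h)
          refold-same (inj₁ (refl , refl)) = inj₁ (refl , refl) , refl
          refold-same {x , y} (inj₂ (refl , refl)) = inj₂ (refl , refl) , cong suc (+-comm (level x) (level y))
          same-base : SameEdge (proj₁ (refold f)) g
          same-base = subst (SameEdge (proj₁ (refold f))) (cong proj₁ eq) (proj₁ (refold-same s))
          weight-eq : proj₂ (refold f) ≡ ω (proj₁ (refold f))
          weight-eq = trans (proj₂ (refold-same s)) (trans (cong proj₂ eq) (ω-sym (SameEdge-sym same-base)))

    M′-matching : Matching M′
    M′-matching = matching (All.map loopless′ subset) M′-disjoint
      where
      loopless′ : ∀ {f} → Any (SameEdge f) (edges U) → Loopless f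
      loopless′ f∈U with find f∈U
      ... | h , h∈ , inj₁ (refl , refl) = All.lookup (loopless U) h∈
      ... | h , h∈ , inj₂ (refl , refl) = All.lookup (loopless U) h∈ ∘ sym

    abstract
      refolded-matching : Bipartite G → Σ[ M ∈ List (Edge n × ℕ) ]
        (All (_∈ map refold M′) M × Matching (map proj₁ M) × length M′ ≤ ∑ M (suc ∘ proj₂))
      refolded-matching (side , crossing) =
        let M , y , M⊆ , mM , cover , value =
              bipartite-duality side (map refold M′) (All.map (λ f → crosses (proj₁ f)) refold-faithful)
        in M , M⊆ , mM , ≤-trans (unfolded-cover y M′-matching (All.map⁻ cover)) value
        where
        crosses : ∀ {e} → InG e → Crossing side e
        crosses e∈G with find e∈G
        ... | g , g∈ , inj₁ (refl , refl) = All.lookup crossing g∈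
        ... | g , g∈ , inj₂ (refl , refl) = All.lookup crossing g∈ ∘ sym

-- Approximation in integral weights

search : {P : ℕ → Set} → (∀ j → Dec (P j)) → ℕ → ℕ
search P? zero    = 0
search P? (suc b) = if does (P? 0) then 0 else suc (search (P? ∘ suc) b)

search-sound : {P : ℕ → Set} (P? : ∀ j → Dec (P j)) (b : ℕ) → P b → P (search P? b)
search-sound P? zero    Pb = Pb
search-sound P? (suc b) Pb with P? 0
... | yes P0 = P0
... | no _   = search-sound (P? ∘ suc) b Pb

search-least : {P : ℕ → Set} (P? : ∀ j → Dec (P j)) (b : ℕ) → ∀ {j} → j < search P? b → ¬ P j
search-least P? (suc b) j<s with P? 0
search-least P? (suc b) {zero}  _   | no ¬P0 = ¬P0
search-least P? (suc b) {suc j} j<s | no _   = search-least (P? ∘ suc) b (s≤s⁻¹ j<s)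

quot : ℕ → ℕ → ℕ
quot x u = search (λ j → x <? suc j * u) x

<-quot : ∀ x {u} → 1 ≤ u → x < suc (quot x u) * u
<-quot x {u} 1≤u = search-sound (λ j → x <? suc j * u) x
  (≤-trans (≤-reflexive (sym (*-identityʳ (suc x)))) (*-monoʳ-≤ (suc x) 1≤u))

quot-≤ : ∀ x u → quot x u * u ≤ x
quot-≤ x u = go (quot x u) ≤-refl
  where
  go : ∀ j → j ≤ quot x u → j * u ≤ x
  go zero    _ = z≤n
  go (suc j) p = ≮⇒≥ (search-least (λ j → x <? suc j * u) x p)

module WeightReduction {n : ℕ} (q ρ : ℕ) (1≤q : 1 ≤ q) (2≤ρ : 2 ≤ ρ) (J : ℕ) (q²ρ≤ρ^J : q * q * ρ ≤ ρ ^ J)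
  (G : Graph n) (bipartite : Bipartite G) (v : Edge n → ℕ) (v-sym : ∀ {e f} → SameEdge e f → v e ≡ v f) (k : ℕ)
  (v-bounds : ∀ {e} → e ∈ edges G → q * (q * 1) ≤ v e × v e < q * (q * ρ ^ k)) where

  K : ℕ
  K = q * q * q * ρ

  1≤ρ^ : ∀ i → 1 ≤ ρ ^ i
  1≤ρ^ i = m^n>0 ρ {{>-nonZero (≤-trans (s≤s z≤n) 2≤ρ)}} i

  ω : ℕ → Edge n → ℕ
  ω i e = quot (v e) (ρ ^ i)

  ω-sym : ∀ i {e f} → SameEdge e f → ω i e ≡ ω i f
  ω-sym i same = cong (λ x → quot x (ρ ^ i)) (v-sym same)

  module Window (i : ℕ) = UnfoldedGraph q K G (ω i) (ω-sym i)
  open Unfolding {n} q K using (refold; InRange)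

  InG : Edge n → Set
  InG e = Any (SameEdge e) (edges G)

  InG-elim : {P : Edge n → Set} → (∀ {e f} → SameEdge e f → P f → P e) →
    (∀ {e} → e ∈ edges G → P e) → ∀ {e} → InG e → P e
  InG-elim transfer p e∈G with find e∈G
  ... | g , g∈ , same = transfer same (p g∈)

  InG-bounds : ∀ {e} → InG e → q * (q * 1) ≤ v e × v e < q * (q * ρ ^ k)
  InG-bounds = InG-elim (λ same → subst (λ x → q * (q * 1) ≤ x × x < q * (q * ρ ^ k)) (sym (v-sym same))) v-bounds

  v-positive : ∀ {e} → InG e → 1 ≤ v e
  v-positive e∈G = ≤-trans (*-mono-≤ 1≤q (*-mono-≤ 1≤q (≤-refl {1}))) (proj₁ (InG-bounds e∈G))

  module C = Composition v q ρ 1≤q 2≤ρ InG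

  K-scale : ∀ i → K * ρ ^ i ≡ q * (q * (q * ρ ^ suc i))
  K-scale i = regroup q ρ (ρ ^ i)
    where
    regroup : ∀ q ρ x → q * q * q * ρ * x ≡ q * (q * (q * (ρ * x)))
    regroup = solve-∀

  range⇒window : ∀ {i e} → InRange (ω i e) → q * ρ ^ i ≤ v e × v e < q * (q * (q * ρ ^ suc i))
  range⇒window {i} {e} (q≤ω , ω<K) =
      ≤-trans (*-monoˡ-≤ (ρ ^ i) q≤ω) (quot-≤ (v e) (ρ ^ i))
    , <-≤-trans (<-quot (v e) (1≤ρ^ i)) (≤-trans (*-monoˡ-≤ (ρ ^ i) ω<K) (≤-reflexive (K-scale i)))

  window⇒range : ∀ {i e} → q * ρ ^ i ≤ v e × v e < q * (q * (q * ρ ^ suc i)) → InRange (ω i e)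
  window⇒range {i} {e} (lo≤v , v<hi) =
      s≤s⁻¹ (*-cancelʳ-< (ρ ^ i) q (suc (ω i e)) (≤-<-trans lo≤v (<-quot (v e) (1≤ρ^ i))))
    , *-cancelʳ-< (ρ ^ i) (ω i e) K (≤-<-trans (quot-≤ (v e) (ρ ^ i)) (<-≤-trans v<hi (≤-reflexive (sym (K-scale i)))))

  v≤ : ∀ i e → v e ≤ ρ ^ i * ω i e + ρ ^ i
  v≤ i e = ≤-trans (<⇒≤ (<-quot (v e) (1≤ρ^ i))) (≤-reflexive (trans (+-comm (ρ ^ i) _)
    (cong (_+ ρ ^ i) (*-comm (ω i e) _))))

  ≤v : ∀ i e → ρ ^ i * ω i e ≤ v e
  ≤v i e = ≤-trans (≤-reflexive (*-comm (ρ ^ i) _)) (quot-≤ (v e) (ρ ^ i))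

  κ : ℕ
  κ = 12 * (2 * J + 8) + 6

  module Combine (M′ : ∀ i → List (Edge (n * K))) (isM′ : ∀ i → IsMatching (Window.U i) (M′ i))
    (approx : ∀ i X → IsMatching (Window.U i) X → q * length X ≤ q * length (M′ i) + 2 * length X)
    (candidates : List (Edge n × ℕ))
    (sound : ∀ {e w} → (e , w) ∈ candidates → Σ[ i ∈ ℕ ] Σ[ w′ ∈ ℕ ] (e , w′) ∈ map refold (M′ i) × w ≡ ρ ^ i * w′)
    (complete : ∀ {i e w} → i < k → (e , w) ∈ map refold (M′ i) → (e , ρ ^ i * w) ∈ candidates)
    (O : List (Edge n × ℕ)) (O⊆ : All (_∈ candidates) O)
    (O-maximal : ∀ L → All (_∈ candidates) L → Matching (map proj₁ L) → ∑ L proj₂ ≤ ∑ O proj₂) where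

    faithful : ∀ i → All (Window.Faithful i) (map refold (M′ i))
    faithful i = Window.refold-faithful i (isM′ i)

    H : Edge n → Set
    H e = Σ[ w ∈ ℕ ] (e , w) ∈ candidates × q * v e ≤ q * w + v e

    M⁺ : ∀ i → List (Edge n × ℕ)
    M⁺ i = proj₁ (Window.refolded-matching i (isM′ i) bipartite)

    M : ∀ i → List (Edge n)
    M i = map proj₁ (M⁺ i)

    M⁺⊆ : ∀ i → All (_∈ map refold (M′ i)) (M⁺ i)
    M⁺⊆ i = proj₁ (proj₂ (Window.refolded-matching i (isM′ i) bipartite))

    M-matching : ∀ i → Matching (M i)
    M-matching i = proj₁ (proj₂ (proj₂ (Window.refolded-matching i (isM′ i) bipartite)))

    M-value : ∀ i → length (M′ i) ≤ ∑ (M⁺ i) (suc ∘ proj₂)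
    M-value i = proj₂ (proj₂ (proj₂ (Window.refolded-matching i (isM′ i) bipartite)))

    M⁺-faithful : ∀ i → All (Window.Faithful i) (M⁺ i)
    M⁺-faithful i = All.map (All.lookup (faithful i)) (M⁺⊆ i)

    M⊆G : ∀ i → All InG (M i)
    M⊆G i = All.map⁺ (All.map proj₁ (M⁺-faithful i))

    M-range : ∀ i → All (InRange ∘ ω i) (M i)
    M-range i = All.map⁺ (All.map (λ (_ , eq , r) → subst InRange eq r) (M⁺-faithful i))

    M-window : ∀ i → All (C.InWindow H i) (M i)
    M-window i = All.map (λ {e} → range⇒window {i} {e}) (M-range i)

    q-unit : ∀ {i e} → InRange (ω i e) → q * ρ ^ i ≤ v e
    q-unit {i} {e} r = proj₁ (range⇒window {i} {e} r)

    M⊆H : ∀ {i} → i < k → All H (M i)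
    M⊆H {i} i<k = All.map⁺ (All.zipWith in-H (M⁺⊆ i , M⁺-faithful i))
      where
      in-H : ∀ {p} → p ∈ map refold (M′ i) × Window.Faithful i p → H (proj₁ p)
      in-H {e , w} (p∈ , _ , refl , r) = ρ ^ i * w , complete i<k p∈ , (begin
        q * v e                          ≤⟨ *-monoʳ-≤ q (v≤ i e) ⟩
        q * (ρ ^ i * w + ρ ^ i)          ≡⟨ *-distribˡ-+ q (ρ ^ i * w) _ ⟩
        q * (ρ ^ i * w) + q * ρ ^ i      ≤⟨ +-monoʳ-≤ _ (q-unit {i} {e} r) ⟩
        q * (ρ ^ i * w) + v e            ∎)
        where open ≤-Reasoning

    near-optimal : ∀ i X → Matching X → All InG X → All (C.InWindow H i) X →
      q * ∑ X v ≤ q * ∑ (M i) v + (∑ (M i) v + 3 * ∑ X v)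
    near-optimal i X mX X⊆G window = begin
      q * ∑ X v
        ≤⟨ *-monoʳ-≤ q (upper X) ⟩
      q * (u * ∑ X (ω i) + u * length X)
        ≡⟨ regroup₁ q u (∑ X (ω i)) (length X) ⟩
      u * (q * ∑ X (ω i)) + q * u * length X
        ≤⟨ +-mono-≤ (*-monoʳ-≤ u unfolded-bound) (units X-range) ⟩
      u * (q * (∑ (M i) (ω i) + length (M i)) + 2 * ∑ X (ω i)) + ∑ X v
        ≡⟨ regroup₂ q u (∑ (M i) (ω i)) (length (M i)) (∑ X (ω i)) (∑ X v) ⟩
      q * (u * ∑ (M i) (ω i)) + q * u * length (M i) + (2 * (u * ∑ X (ω i)) + ∑ X v)
        ≤⟨ +-mono-≤ (+-mono-≤ (*-monoʳ-≤ q (lower (M i))) (units (M-range i))) (+-monoˡ-≤ (∑ X v) (*-monoʳ-≤ 2 (lower X))) ⟩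
      q * ∑ (M i) v + ∑ (M i) v + (2 * ∑ X v + ∑ X v)
        ≡⟨ regroup₃ (q * ∑ (M i) v) (∑ (M i) v) (∑ X v) ⟩
      q * ∑ (M i) v + (∑ (M i) v + 3 * ∑ X v) ∎
      where
      open ≤-Reasoning
      u : ℕ
      u = ρ ^ i
      regroup₁ : ∀ q u s l → q * (u * s + u * l) ≡ u * (q * s) + q * u * l
      regroup₁ = solve-∀
      regroup₂ : ∀ q u a b c d → u * (q * (a + b) + 2 * c) + d ≡ q * (u * a) + q * u * b + (2 * (u * c) + d)
      regroup₂ = solve-∀
      regroup₃ : ∀ a b c → a + b + (2 * c + c) ≡ a + (b + 3 * c)
      regroup₃ = solve-∀
      X-range : All (InRange ∘ ω i) X
      X-range = All.map (λ {e} → window⇒range {i} {e}) window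
      upper : ∀ L → ∑ L v ≤ u * ∑ L (ω i) + u * length L
      upper L = ≤-trans (∑-mono L (v≤ i)) (≤-reflexive (trans (∑-+ _ _ L)
        (cong₂ _+_ (∑-* u (ω i) L) (trans (∑-const u L) (*-comm _ u)))))
      lower : ∀ L → u * ∑ L (ω i) ≤ ∑ L v
      lower L = ≤-trans (≤-reflexive (sym (∑-* u (ω i) L))) (∑-mono L (≤v i))
      units : ∀ {L} → All (InRange ∘ ω i) L → q * u * length L ≤ ∑ L v
      units {L} range = ≤-trans (≤-reflexive (trans (*-comm (q * u) _) (sym (∑-const (q * u) L))))
        (∑-mono-All (All.map (λ {e} r → q-unit {i} {e} r) range))
      M-sum : ∑ (M⁺ i) (suc ∘ proj₂) ≡ ∑ (M i) (ω i) + length (M i)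
      M-sum = trans (∑-cong-All (All.map (λ (_ , eq , _) → trans (cong suc eq) (+-comm 1 _)) (M⁺-faithful i)))
        (trans (∑-+ _ (λ _ → 1) (M⁺ i)) (cong₂ _+_ (sym (∑-map (ω i) proj₁ (M⁺ i)))
          (trans (∑-const 1 (M⁺ i)) (trans (*-identityʳ _) (sym (List.length-map proj₁ (M⁺ i)))))))
      unfolded-bound : q * ∑ X (ω i) ≤ q * (∑ (M i) (ω i) + length (M i)) + 2 * ∑ X (ω i)
      unfolded-bound = subst (λ s → q * s ≤ q * (∑ (M i) (ω i) + length (M i)) + 2 * s)
        (Window.length-unfolded i X-range)
        (≤-trans (approx i _ (Window.unfolded-matching i mX X⊆G))
          (+-monoˡ-≤ _ (*-monoʳ-≤ q (≤-trans (M-value i) (≤-reflexive M-sum)))))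

    dual : Σ[ L ∈ List (Edge n × ℕ) ] Σ[ y ∈ (Fin n → ℕ) ]
      ( All (_∈ map (λ e → e , v e) (edges G)) L × Matching (map proj₁ L)
      × All (λ (e , w) → w ≤ y (proj₁ e) + y (proj₂ e)) (map (λ e → e , v e) (edges G))
      × ∑ (allFin n) y ≤ ∑ L (suc ∘ proj₂) )
    dual = bipartite-duality (proj₁ bipartite) _ (All.map⁺ (proj₂ bipartite))

    N̂ : List (Edge n)
    N̂ = map proj₁ (proj₁ dual)

    N̂-matching : Matching N̂
    N̂-matching = proj₁ (proj₂ (proj₂ (proj₂ dual)))

    y : Fin n → ℕ
    y = proj₁ (proj₂ dual)

    N̂-listed : All (λ (e , w) → InG e × w ≡ v e) (proj₁ dual)
    N̂-listed = All.map listed (proj₁ (proj₂ (proj₂ dual)))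
      where
      listed : ∀ {p} → p ∈ map (λ e → e , v e) (edges G) → InG (proj₁ p) × proj₂ p ≡ v (proj₁ p)
      listed p∈ with ∈-map⁻ _ p∈
      ... | e , e∈ , refl = lose e∈ (inj₁ (refl , refl)) , refl

    N̂⊆G : All InG N̂
    N̂⊆G = All.map⁺ (All.map proj₁ N̂-listed)

    covered : ∀ {e} → InG e → v e ≤ y (proj₁ e) + y (proj₂ e)
    covered = InG-elim transfer (All.lookup (All.map⁻ (proj₁ (proj₂ (proj₂ (proj₂ (proj₂ dual)))))))
      where
      transfer : ∀ {e f} → SameEdge e f → v f ≤ y (proj₁ f) + y (proj₂ f) → v e ≤ y (proj₁ e) + y (proj₂ e)
      transfer (inj₁ (refl , refl)) p = p
      transfer {a , b} (inj₂ (refl , refl)) p =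
        ≤-trans (≤-reflexive (v-sym (inj₂ (refl , refl)))) (≤-trans p (≤-reflexive (+-comm (y b) _)))

    ∑y≤ : ∑ (allFin n) y ≤ 2 * ∑ N̂ v
    ∑y≤ = ≤-trans (proj₂ (proj₂ (proj₂ (proj₂ (proj₂ dual))))) (≤-trans
      (∑-mono-All (All.map double N̂-listed))
      (≤-reflexive (trans (∑-* 2 (v ∘ proj₁) (proj₁ dual)) (cong (2 *_) (sym (∑-map v proj₁ (proj₁ dual)))))))
      where
      double : ∀ {p} → InG (proj₁ p) × proj₂ p ≡ v (proj₁ p) → suc (proj₂ p) ≤ 2 * v (proj₁ p)
      double {e , _} (e∈G , refl) = +-mono-≤ (v-positive e∈G) (m≤m+n (v e) 0)

    ∑-≤-N̂ : ∀ {N} → Matching N → All InG N → ∑ N v ≤ 2 * ∑ N̂ v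
    ∑-≤-N̂ mN N⊆G = ≤-trans (∑-mono-All (All.map covered N⊆G)) (≤-trans (∑-matching-≤ y mN) ∑y≤)

    open C.Capacity H y covered

    Φ : ℕ → ℕ
    Φ = capacity

    near : ∀ i X → Matching X → All InG X → All (C.InWindow H i) X → q * ∑ X v ≤ q * ∑ (M i) v + 4 * Φ i
    near i X mX X⊆G window = ≤-trans (near-optimal i X mX X⊆G window) (+-monoʳ-≤ (q * ∑ (M i) v)
      (≤-trans (+-mono-≤ (capacity-bound i (M i) (M-matching i) (M⊆G i) (M-window i))
                         (*-monoʳ-≤ 3 (capacity-bound i X mX X⊆G window)))
        ≤-refl))

    O-value : ∑ O proj₂ ≤ ∑ (map proj₁ O) v
    O-value = ≤-trans (∑-mono-All (All.map undervalued O⊆)) (≤-reflexive (sym (∑-map v proj₁ O)))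
      where
      undervalued : ∀ {p} → p ∈ candidates → proj₂ p ≤ v (proj₁ p)
      undervalued {e , w} p∈ =
        let i , _ , p′∈ , scaled = sound p∈
            _ , weight , _ = All.lookup (faithful i) p′∈
        in ≤-trans (≤-reflexive (trans scaled (cong (ρ ^ i *_) weight))) (≤v i e)

    O⊆G : All InG (map proj₁ O)
    O⊆G = All.map⁺ (All.map inG O⊆)
      where
      inG : ∀ {p} → p ∈ candidates → InG (proj₁ p)
      inG {e , w} p∈ =
        let i , _ , p′∈ , _ = sound p∈
        in proj₁ (All.lookup (faithful i) p′∈)

    beaten : ∀ {N} → Matching N → All InG N → All H N → q * ∑ N v ≤ q * ∑ (map proj₁ O) v + 2 * ∑ N̂ v
    beaten {N} mN N⊆G N⊆H = begin
      q * ∑ N v                             ≤⟨ priced N⊆H ⟩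
      q * ∑ (prices N⊆H) proj₂ + ∑ N v      ≤⟨ +-mono-≤ (*-monoʳ-≤ q (≤-trans
                                                   (O-maximal _ (prices-⊆ N⊆H) (subst Matching (sym (prices-edges N⊆H)) mN))
                                                   O-value))
                                                 (∑-≤-N̂ mN N⊆G) ⟩
      q * ∑ (map proj₁ O) v + 2 * ∑ N̂ v   ∎
      where
      open ≤-Reasoning
      prices : ∀ {N} → All H N → List (Edge n × ℕ)
      prices []                      = []
      prices (_∷_ {x = e} (w , _) h) = (e , w) ∷ prices h
      prices-edges : ∀ {N} (h : All H N) → map proj₁ (prices h) ≡ N
      prices-edges []      = refl
      prices-edges (_ ∷ h) = cong (_ ∷_) (prices-edges h)
      prices-⊆ : ∀ {N} (h : All H N) → All (_∈ candidates) (prices h)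
      prices-⊆ []                = []
      prices-⊆ ((_ , p∈ , _) ∷ h) = p∈ ∷ prices-⊆ h
      priced : ∀ {N} (h : All H N) → q * ∑ N v ≤ q * ∑ (prices h) proj₂ + ∑ N v
      priced [] = ≤-trans (≤-reflexive (*-zeroʳ q)) z≤n
      priced {e ∷ N} ((w , _ , p) ∷ h) = begin
        q * (v e + ∑ N v)                                       ≡⟨ *-distribˡ-+ q (v e) _ ⟩
        q * v e + q * ∑ N v                                     ≤⟨ +-mono-≤ p (priced h) ⟩
        q * w + v e + (q * ∑ (prices h) proj₂ + ∑ N v)          ≡⟨ regroup q w (v e) (∑ (prices h) proj₂) (∑ N v) ⟩
        q * (w + ∑ (prices h) proj₂) + (v e + ∑ N v)            ∎
        where
        regroup : ∀ q w x s r → q * w + x + (q * s + r) ≡ q * (w + s) + (x + r)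
        regroup = solve-∀

    against-dual : ∀ N₀ → Matching N₀ → All InG N₀ →
      q * ∑ N₀ v ≤ q * ∑ (map proj₁ O) v + ((12 * (2 * J + 8) + 2) * ∑ N̂ v + 4 * ∑ N₀ v)
    against-dual N₀ mN₀ N₀⊆G = conclude
      (C.Windows.composition H k M (λ i → 4 * Φ i) Φ M-matching M⊆G M⊆H M-window near
        capacity-bound N₀ mN₀ N₀⊆G (All.map (proj₁ ∘ InG-bounds) N₀⊆G) (proj₂ ∘ InG-bounds))
      where
      open ≤-Reasoning
      regroup : ∀ a c x b → a + 2 * x + (c * x + b) ≡ a + ((c + 2) * x + b)
      regroup = solve-∀
      collect₁ : ∀ x → 4 * x + 2 * x ≡ 6 * x
      collect₁ = solve-∀
      collect₂ : ∀ c x → 6 * (c * (2 * x)) ≡ 12 * c * x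
      collect₂ = solve-∀
      windows : ∑< (λ i → 4 * Φ i) k + 2 * ∑< Φ k ≤ 12 * (2 * J + 8) * ∑ N̂ v
      windows = begin
        ∑< (λ i → 4 * Φ i) k + 2 * ∑< Φ k      ≡⟨ cong (_+ 2 * ∑< Φ k) (∑<-* 4 Φ k) ⟩
        4 * ∑< Φ k + 2 * ∑< Φ k                ≡⟨ collect₁ (∑< Φ k) ⟩
        6 * ∑< Φ k                             ≤⟨ *-monoʳ-≤ 6 (≤-trans (∑-capacity J q²ρ≤ρ^J k)
                                                    (*-monoʳ-≤ (2 * J + 8) ∑y≤)) ⟩
        6 * ((2 * J + 8) * (2 * ∑ N̂ v))       ≡⟨ collect₂ (2 * J + 8) (∑ N̂ v) ⟩
        12 * (2 * J + 8) * ∑ N̂ v              ∎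
      conclude : Σ[ N ∈ List (Edge n) ] (Matching N × All InG N × All H N
        × q * ∑ N₀ v ≤ q * ∑ N v + (∑< (λ i → 4 * Φ i) k + 2 * ∑< Φ k + 4 * ∑ N₀ v)) →
        q * ∑ N₀ v ≤ q * ∑ (map proj₁ O) v + ((12 * (2 * J + 8) + 2) * ∑ N̂ v + 4 * ∑ N₀ v)
      conclude (N , mN , N⊆G , N⊆H , value) = begin
        q * ∑ N₀ v
          ≤⟨ value ⟩
        q * ∑ N v + (∑< (λ i → 4 * Φ i) k + 2 * ∑< Φ k + 4 * ∑ N₀ v)
          ≤⟨ +-mono-≤ (beaten mN N⊆G N⊆H) (+-monoˡ-≤ (4 * ∑ N₀ v) windows) ⟩
        q * ∑ (map proj₁ O) v + 2 * ∑ N̂ v + (12 * (2 * J + 8) * ∑ N̂ v + 4 * ∑ N₀ v)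
          ≡⟨ regroup (q * ∑ (map proj₁ O) v) (12 * (2 * J + 8)) (∑ N̂ v) (4 * ∑ N₀ v) ⟩
        q * ∑ (map proj₁ O) v + ((12 * (2 * J + 8) + 2) * ∑ N̂ v + 4 * ∑ N₀ v) ∎

    approximate-large : ∀ N → Matching N → All InG N → ∑ N̂ v ≤ ∑ N v →
      q * ∑ N v ≤ q * ∑ (map proj₁ O) v + κ * ∑ N v
    approximate-large N mN N⊆G N̂≤N = ≤-trans (against-dual N mN N⊆G) (+-monoʳ-≤ (q * ∑ (map proj₁ O) v)
      (≤-trans (+-monoˡ-≤ (4 * ∑ N v) (*-monoʳ-≤ (12 * (2 * J + 8) + 2) N̂≤N))
        (≤-reflexive (collect (12 * (2 * J + 8)) (∑ N v)))))
      where
      collect : ∀ c x → (c + 2) * x + 4 * x ≡ (c + 6) * x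
      collect = solve-∀

    approximate : ∀ N → Matching N → All InG N → q * ∑ N v ≤ q * ∑ (map proj₁ O) v + κ * ∑ N v
    approximate N mN N⊆G with ≤-total (∑ N̂ v) (∑ N v) | ≤-total q κ
    ... | inj₁ N̂≤N | _        = approximate-large N mN N⊆G N̂≤N
    ... | inj₂ _   | inj₁ q≤κ = ≤-trans (*-monoˡ-≤ (∑ N v) q≤κ) (m≤n+m _ _)
    ... | inj₂ N≤N̂ | inj₂ κ≤q = begin
      q * ∑ N v                                  ≡⟨ cong (_* ∑ N v) (sym (m∸n+n≡m κ≤q)) ⟩
      (q ∸ κ + κ) * ∑ N v                        ≡⟨ *-distribʳ-+ (∑ N v) (q ∸ κ) κ ⟩
      (q ∸ κ) * ∑ N v + κ * ∑ N v                ≤⟨ +-monoˡ-≤ (κ * ∑ N v) (≤-trans (*-monoʳ-≤ (q ∸ κ) N≤N̂) N̂≤O) ⟩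
      q * ∑ (map proj₁ O) v + κ * ∑ N v          ∎
      where
      open ≤-Reasoning
      N̂≤O : (q ∸ κ) * ∑ N̂ v ≤ q * ∑ (map proj₁ O) v
      N̂≤O = +-cancelʳ-≤ (κ * ∑ N̂ v) _ _ (≤-trans
        (≤-reflexive (trans (sym (*-distribʳ-+ (∑ N̂ v) (q ∸ κ) κ)) (cong (_* ∑ N̂ v) (m∸n+n≡m κ≤q))))
        (approximate-large N̂ N̂-matching N̂⊆G ≤-refl))

-- Heaviest matchings and composition of streaming algorithms

lists : {C : Set} → ℕ → List C → List (List C)
lists zero    cs = [] ∷ []
lists (suc b) cs = [] ∷ concatMap (λ c → map (c ∷_) (lists b cs)) cs

∈-lists⁺ : {C : Set} (b : ℕ) {cs : List C} {L : List C} → All (_∈ cs) L → length L ≤ b → L ∈ lists b cs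
∈-lists⁺ zero    []         _       = here refl
∈-lists⁺ (suc b) []         _       = here refl
∈-lists⁺ (suc b) (c∈ ∷ L⊆) (s≤s p) = there (∈-concatMap⁺ _ (lose c∈ (∈-map⁺ _ (∈-lists⁺ b L⊆ p))))

∈-lists⁻ : {C : Set} (b : ℕ) {cs : List C} {L : List C} → L ∈ lists b cs → All (_∈ cs) L
∈-lists⁻ zero    (here refl) = []
∈-lists⁻ (suc b) (here refl) = []
∈-lists⁻ (suc b) {cs} (there L∈) with find (∈-concatMap⁻ (λ c → map (c ∷_) (lists b cs)) {xs = cs} L∈)
... | c , c∈ , L∈c with ∈-map⁻ (c ∷_) L∈c
...   | L′ , L′∈ , refl = c∈ ∷ ∈-lists⁻ b L′∈

length-matching : ∀ {n} {M : List (Edge n)} → Matching M → length M ≤ n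
length-matching {n} {M} mM = begin
  length M                  ≡⟨ trans (∑-const 1 M) (*-identityʳ _) ⟨
  ∑ M (λ _ → 1)             ≤⟨ ∑-mono M (λ _ → s≤s z≤n) ⟩
  ∑ M (λ _ → 1 + 1)         ≤⟨ ∑-matching-≤ (λ _ → 1) mM ⟩
  ∑ (allFin n) (λ _ → 1)    ≡⟨ trans (∑-const 1 (allFin n)) (trans (*-identityʳ _) (List.length-tabulate {n = n} id)) ⟩
  n                         ∎
  where open ≤-Reasoning

module Heaviest {n : ℕ} (candidates : List (Edge n × ℕ)) where

  IsDisjoint : List (Edge n × ℕ) → Set
  IsDisjoint L = AllPairs VertexDisjoint (map proj₁ L)

  isDisjoint? : ∀ L → Dec (IsDisjoint L)
  isDisjoint? L = AllPairs.allPairs? disjoint? (map proj₁ L)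
    where
    disjoint? : ∀ e f → Dec (VertexDisjoint e f)
    disjoint? (u , v) (x , y) = ¬? (u ≟ x) ×-dec ¬? (u ≟ y) ×-dec ¬? (v ≟ x) ×-dec ¬? (v ≟ y)

  options : List (List (Edge n × ℕ))
  options = filter isDisjoint? (lists n candidates)

  heaviest : List (Edge n × ℕ)
  heaviest = argmax (λ L → ∑ L proj₂) [] options

  heaviest-valid : All (_∈ candidates) heaviest × IsDisjoint heaviest
  heaviest-valid = argmax-all (λ L → ∑ L proj₂) {P = λ L → All (_∈ candidates) L × IsDisjoint L} ([] , []) (All.tabulate valid)
    where
    valid : ∀ {L} → L ∈ options → All (_∈ candidates) L × IsDisjoint L
    valid L∈ with ∈-filter⁻ isDisjoint? {xs = lists n candidates} L∈
    ... | L∈lists , d = ∈-lists⁻ n L∈lists , d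

  heaviest-maximal : ∀ L → All (_∈ candidates) L → Matching (map proj₁ L) → ∑ L proj₂ ≤ ∑ heaviest proj₂
  heaviest-maximal L L⊆ mL = All.lookup (f[xs]≤f[argmax] {f = λ L → ∑ L proj₂} [] options)
    (∈-filter⁺ isDisjoint? (∈-lists⁺ n L⊆ (≤-trans (≤-reflexive (sym (List.length-map proj₁ L))) (length-matching mL)))
      (disjoint mL))

expandStream : {I J O : Set} {p s : ℕ} → (I → List J) → StreamAlgorithm J O p s → StreamAlgorithm I O p s
expandStream h A = record
  { init = init A ; step = λ x i → foldl (step A) x (h i) ; endPass = endPass A ; output = output A }

foldl-concatMap : {I J S : Set} (g : S → J → S) (h : I → List J) (x : S) (is : List I) →
  foldl g x (concatMap h is) ≡ foldl (λ x i → foldl g x (h i)) x is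
foldl-concatMap g h x []       = refl
foldl-concatMap g h x (i ∷ is) =
  trans (List.foldl-++ g x (h i) (concatMap h is)) (foldl-concatMap g h (foldl g x (h i)) is)

fold-cong : {S : Set} {g h : S → S} → (∀ x → g x ≡ h x) → ∀ x p → fold x g p ≡ fold x h p
fold-cong         g≗h x zero    = refl
fold-cong {h = h} g≗h x (suc p) = trans (g≗h _) (cong h (fold-cong g≗h x p))

run-expandStream : {I J O : Set} {p s : ℕ} (h : I → List J) (A : StreamAlgorithm J O p s) (is : List I) →
  run (expandStream h A) is ≡ run A (concatMap h is)
run-expandStream {p = p} h A is = cong (output A)
  (fold-cong (λ x → cong (endPass A) (sym (foldl-concatMap (step A) h x is))) (init A) p)

mapOutput : {I O Q : Set} {p s : ℕ} → (O → Q) → StreamAlgorithm I O p s → StreamAlgorithm I Q p s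
mapOutput g A = record { init = init A ; step = step A ; endPass = endPass A ; output = g ∘ output A }

module _ {I O Q : Set} {p s t : ℕ} (A : StreamAlgorithm I O p s) (B : StreamAlgorithm I Q p t) where

  onBoth : (Vec Bool s → Vec Bool s) → (Vec Bool t → Vec Bool t) → Vec Bool (s + t) → Vec Bool (s + t)
  onBoth g h x = g (Vec.take s x) Vec.++ h (Vec.drop s x)

  parallel : StreamAlgorithm I (O × Q) p (s + t)
  parallel = record
    { init    = init A Vec.++ init B
    ; step    = λ x i → onBoth (λ y → step A y i) (λ z → step B z i) x
    ; endPass = onBoth (endPass A) (endPass B)
    ; output  = λ x → output A (Vec.take s x) , output B (Vec.drop s x)
    }

  take-drop-++ : (y : Vec Bool s) (z : Vec Bool t) → Vec.take s (y Vec.++ z) ≡ y × Vec.drop s (y Vec.++ z) ≡ z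
  take-drop-++ y z = Vec.++-injective (Vec.take s (y Vec.++ z)) y (Vec.take++drop≡id s (y Vec.++ z))

  onBoth-++ : ∀ g h y z → onBoth g h (y Vec.++ z) ≡ g y Vec.++ h z
  onBoth-++ g h y z = cong₂ (λ y′ z′ → g y′ Vec.++ h z′) (proj₁ (take-drop-++ y z)) (proj₂ (take-drop-++ y z))

  foldl-parallel : ∀ is y z → foldl (step parallel) (y Vec.++ z) is ≡ foldl (step A) y is Vec.++ foldl (step B) z is
  foldl-parallel []       y z = refl
  foldl-parallel (i ∷ is) y z = trans
    (cong (λ x → foldl (step parallel) x is) (onBoth-++ (λ y → step A y i) (λ z → step B z i) y z))
    (foldl-parallel is (step A y i) (step B z i))

  memoryA : List I → ℕ → Vec Bool s
  memoryA is = fold (init A) (onePass A is)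

  memoryB : List I → ℕ → Vec Bool t
  memoryB is = fold (init B) (onePass B is)

  fold-parallel : ∀ is k → fold (init parallel) (onePass parallel is) k ≡ memoryA is k Vec.++ memoryB is k
  fold-parallel is zero    = refl
  fold-parallel is (suc k) = trans (cong (onePass parallel is) (fold-parallel is k))
    (trans (cong (endPass parallel) (foldl-parallel is (memoryA is k) (memoryB is k)))
      (onBoth-++ (endPass A) (endPass B) (foldl (step A) (memoryA is k) is) (foldl (step B) (memoryB is k) is)))

  run-parallel : ∀ is → run parallel is ≡ (run A is , run B is)
  run-parallel is = trans (cong (output parallel) (fold-parallel is p))
    (cong₂ (λ y z → output A y , output B z)
      (proj₁ (take-drop-++ (memoryA is p) (memoryB is p))) (proj₂ (take-drop-++ (memoryA is p) (memoryB is p))))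

gather : {B : Set} → (ℕ → List B) → ℕ → List B
gather f zero    = []
gather f (suc k) = f k ++ gather f k

∈-gather⁺ : {B : Set} (f : ℕ → List B) {x : B} {i k : ℕ} → i < k → x ∈ f i → x ∈ gather f k
∈-gather⁺ f {i = i} {suc k} i<k x∈ with i ℕ.≟ k
... | yes refl = ∈-++⁺ˡ x∈
... | no i≢k   = ∈-++⁺ʳ (f k) (∈-gather⁺ f (≤∧≢⇒< (s≤s⁻¹ i<k) i≢k) x∈)

∈-gather⁻ : {B : Set} (f : ℕ → List B) {x : B} (k : ℕ) → x ∈ gather f k → Σ[ i ∈ ℕ ] x ∈ f i
∈-gather⁻ f (suc k) x∈ with ∈-++⁻ (f k) x∈
... | inj₁ x∈fk = k , x∈fk
... | inj₂ x∈   = ∈-gather⁻ f k x∈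

module _ {I O B : Set} {p s : ℕ} (A : ℕ → StreamAlgorithm I O p s) (f : ℕ → O → List B) where

  gatherParallel : (k : ℕ) → StreamAlgorithm I (List B) p (k * s)
  gatherParallel zero    = record
    { init = Vec.[] ; step = λ _ _ → Vec.[] ; endPass = λ _ → Vec.[] ; output = λ _ → [] }
  gatherParallel (suc k) = mapOutput (λ (o , bs) → f k o ++ bs) (parallel (A k) (gatherParallel k))

  run-gatherParallel : ∀ k is → run (gatherParallel k) is ≡ gather (λ i → f i (run (A i) is)) k
  run-gatherParallel zero    is = refl
  run-gatherParallel (suc k) is = trans
    (cong (λ (o , bs) → f k o ++ bs) (run-parallel (A k) (gatherParallel k) is))
    (cong (f k (run (A k) is) ++_) (run-gatherParallel k is))

-- Rational arithmetic

fromℕ-mkℚ : ∀ n → fromℕ n ≡ mkℚ (ℤ.+ n) 0 (Coprimality.sym (1-coprimeTo n))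
fromℕ-mkℚ n = ℚ.normalize-coprime (Coprimality.sym (1-coprimeTo n))

fromℕ-+ : ∀ m n → fromℕ (m + n) ≡ fromℕ m ℚ.+ fromℕ n
fromℕ-+ m n rewrite fromℕ-mkℚ m | fromℕ-mkℚ n =
  cong (ℚ._/ 1) (sym (cong₂ ℤ._+_ (ℤ.*-identityʳ (ℤ.+ m)) (ℤ.*-identityʳ (ℤ.+ n))))

fromℕ-* : ∀ m n → fromℕ (m * n) ≡ fromℕ m ℚ.* fromℕ n
fromℕ-* m n rewrite fromℕ-mkℚ m | fromℕ-mkℚ n = cong (ℚ._/ 1) (ℤ.pos-* m n)

fromℕ-mono-≤ : ∀ {m n} → m ≤ n → fromℕ m ℚ.≤ fromℕ n
fromℕ-mono-≤ {m} {n} m≤n rewrite fromℕ-mkℚ m | fromℕ-mkℚ n =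
  *≤* (ℤ.*-monoʳ-≤-nonNeg (ℤ.+ 1) (ℤ.+≤+ m≤n))

fromℕ-cancel-≤ : ∀ {m n} → fromℕ m ℚ.≤ fromℕ n → m ≤ n
fromℕ-cancel-≤ {m} {n} p rewrite fromℕ-mkℚ m | fromℕ-mkℚ n with p
... | *≤* q = ℤ.drop‿+≤+ (ℤ.*-cancelʳ-≤-pos (ℤ.+ m) (ℤ.+ n) (ℤ.+ 1) q)

fromℕ-cancel-< : ∀ {m n} → fromℕ m ℚ.< fromℕ n → m < n
fromℕ-cancel-< {m} {n} p = ≰⇒> (λ n≤m → ℚ.<-irrefl refl (ℚ.<-≤-trans p (fromℕ-mono-≤ {n} {m} n≤m)))

fromℕ-mono-< : ∀ {m n} → m < n → fromℕ m ℚ.< fromℕ n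
fromℕ-mono-< {m} {n} m<n = ℚ.≰⇒> (λ p → n≮n _ (<-≤-trans m<n (fromℕ-cancel-≤ {n} {m} p)))

0≤fromℕ : ∀ n → 0ℚ ℚ.≤ fromℕ n
0≤fromℕ n = fromℕ-mono-≤ {0} {n} z≤n

≤-fromℕ : ∀ x → x ℚ.≤ fromℕ ∣ ↥ x ∣
≤-fromℕ x rewrite fromℕ-mkℚ ∣ ↥ x ∣ = *≤* (ℤ.≤-trans
  (ℤ.≤-reflexive (ℤ.*-identityʳ (↥ x)))
  (bound (↥ x) (↧ₙ x)))
  where
  bound : ∀ i d .{{_ : NonZero d}} → i ℤ.≤ ℤ.+ ∣ i ∣ ℤ.* ℤ.+ d
  bound (ℤ.+ i)     d = ℤ.≤-trans (ℤ.+≤+ (m≤m*n i d)) (ℤ.≤-reflexive (ℤ.pos-* i d))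
  bound -[1+ i ] d = ℤ.≤-trans ℤ.-≤+ (ℤ.≤-reflexive (ℤ.pos-* (suc i) d))

1≤↧* : ∀ x → 0ℚ ℚ.< x → 1ℚ ℚ.≤ fromℕ (↧ₙ x) ℚ.* x
1≤↧* x@(mkℚ (ℤ.+ zero) _ _)    (*<* (ℤ.+<+ ()))
1≤↧* x@(mkℚ -[1+ _ ] _ _)    (*<* ())
1≤↧* x@(mkℚ (ℤ.+ suc i) d _) _ rewrite fromℕ-mkℚ (suc d) = ℚ.toℚᵘ-cancel-≤
  (ℚᵘ.≤-respʳ-≃ (ℚᵘ.≃-sym (ℚ.toℚᵘ-homo-* (mkℚ (ℤ.+ suc d) 0 (Coprimality.sym (1-coprimeTo (suc d)))) x)) (ℚᵘ.*≤* (ℤ.≤-trans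
    (ℤ.+≤+ (≤-trans (≤-reflexive (trans (*-identityˡ (suc (d + 0))) (cong suc (+-identityʳ d)))) (m≤m*n (suc d) (suc i))))
    (ℤ.≤-reflexive (sym (ℤ.*-identityʳ _))))))

*-mono-≤-nonNeg : ∀ {a b c d} → 0ℚ ℚ.≤ c → 0ℚ ℚ.≤ b → a ℚ.≤ b → c ℚ.≤ d → a ℚ.* c ℚ.≤ b ℚ.* d
*-mono-≤-nonNeg {b = b} {c} 0≤c 0≤b a≤b c≤d = ℚ.≤-trans
  (ℚ.*-monoʳ-≤-nonNeg c {{ℚ.nonNegative 0≤c}} a≤b) (ℚ.*-monoˡ-≤-nonNeg b {{ℚ.nonNegative 0≤b}} c≤d)

0≤* : ∀ {a b} → 0ℚ ℚ.≤ a → 0ℚ ℚ.≤ b → 0ℚ ℚ.≤ a ℚ.* b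
0≤* {a} {b} 0≤a 0≤b = ℚ.≤-trans (ℚ.≤-reflexive (sym (ℚ.*-zeroʳ a)))
  (ℚ.*-monoˡ-≤-nonNeg a {{ℚ.nonNegative 0≤a}} 0≤b)

0≤1 : 0ℚ ℚ.≤ 1ℚ
0≤1 = *≤* (ℤ.+≤+ z≤n)

^ℚ-+ : ∀ x m n → x ^ℚ (m + n) ≡ x ^ℚ m ℚ.* x ^ℚ n
^ℚ-+ = Exp.^-homo-* (CommutativeRing.semiring ℚ.+-*-commutativeRing)

^ℚ-assoc : ∀ x m n → (x ^ℚ m) ^ℚ n ≡ x ^ℚ (m * n)
^ℚ-assoc = Exp.^-assocʳ (CommutativeRing.semiring ℚ.+-*-commutativeRing)

^ℚ-distrib-* : ∀ x y n → (x ℚ.* y) ^ℚ n ≡ x ^ℚ n ℚ.* y ^ℚ n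
^ℚ-distrib-* = CommutativeExp.^-distrib-* (CommutativeRing.commutativeSemiring ℚ.+-*-commutativeRing)

fromℕ-^ : ∀ m n → fromℕ (m ^ n) ≡ fromℕ m ^ℚ n
fromℕ-^ m zero    = refl
fromℕ-^ m (suc n) = trans (fromℕ-* m (m ^ n)) (cong (fromℕ m ℚ.*_) (fromℕ-^ m n))

0≤^ : ∀ {x} n → 0ℚ ℚ.≤ x → 0ℚ ℚ.≤ x ^ℚ n
0≤^ zero    0≤x = 0≤1
0≤^ (suc n) 0≤x = 0≤* 0≤x (0≤^ n 0≤x)

^ℚ-mono-≤ : ∀ {x y} n → 0ℚ ℚ.≤ x → x ℚ.≤ y → x ^ℚ n ℚ.≤ y ^ℚ n
^ℚ-mono-≤ zero    0≤x x≤y = ℚ.≤-refl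
^ℚ-mono-≤ (suc n) 0≤x x≤y = *-mono-≤-nonNeg (0≤^ n 0≤x) (ℚ.≤-trans 0≤x x≤y) x≤y (^ℚ-mono-≤ n 0≤x x≤y)

1^ℚ : ∀ n → 1ℚ ^ℚ n ≡ 1ℚ
1^ℚ zero    = refl
1^ℚ (suc n) = trans (ℚ.*-identityˡ (1ℚ ^ℚ n)) (1^ℚ n)

1≤^ : ∀ {x} n → 1ℚ ℚ.≤ x → 1ℚ ℚ.≤ x ^ℚ n
1≤^ n 1≤x = ℚ.≤-trans (ℚ.≤-reflexive (sym (1^ℚ n))) (^ℚ-mono-≤ n 0≤1 1≤x)

^≤1 : ∀ {x} n → 0ℚ ℚ.≤ x → x ℚ.≤ 1ℚ → x ^ℚ n ℚ.≤ 1ℚ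
^≤1 n 0≤x x≤1 = ℚ.≤-trans (^ℚ-mono-≤ n 0≤x x≤1) (ℚ.≤-reflexive (1^ℚ n))

floorℕ : ℚ → ℕ
floorℕ x = search (λ j → x ℚ.<? fromℕ (suc j)) ∣ ↥ x ∣

<-floorℕ : ∀ x → x ℚ.< fromℕ (suc (floorℕ x))
<-floorℕ x = search-sound (λ j → x ℚ.<? fromℕ (suc j)) ∣ ↥ x ∣
  (ℚ.≤-<-trans (≤-fromℕ x) (fromℕ-mono-< (n<1+n ∣ ↥ x ∣)))

floorℕ-≤ : ∀ x → 0ℚ ℚ.≤ x → fromℕ (floorℕ x) ℚ.≤ x
floorℕ-≤ x 0≤x = go (floorℕ x) ≤-refl
  where
  go : ∀ j → j ≤ floorℕ x → fromℕ j ℚ.≤ x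
  go zero    _ = 0≤x
  go (suc j) p = ℚ.≮⇒≥ (search-least (λ j → x ℚ.<? fromℕ (suc j)) ∣ ↥ x ∣ p)

-- The parameters of the reduction

*-mono-1≤ : ∀ {x y} → 1ℚ ℚ.≤ x → 1ℚ ℚ.≤ y → 1ℚ ℚ.≤ x ℚ.* y
*-mono-1≤ {x} 1≤x 1≤y = *-mono-≤-nonNeg {1ℚ} {x} {1ℚ} 0≤1 (ℚ.≤-trans 0≤1 1≤x) 1≤x 1≤y

n<2^n : ∀ n → n < 2 ^ n
n<2^n zero    = s≤s z≤n
n<2^n (suc n) = ≤-trans (+-mono-≤ (m^n>0 2 n) (n<2^n n)) (≤-reflexive (cong (2 ^ n +_) (sym (+-identityʳ _))))

-- For ε^(-r) with r = 3 + a / B: inverse ε ≈ 1/ε, ratio ε ≈ ε^(-a/B), blowup ε ≈ ε^(-r).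
module Parameters (a B : ℕ) (1≤a : 1 ≤ a) (1≤B : 1 ≤ B) where

  inverse : ℚ → ℕ
  inverse ε = search (λ j → 1ℚ ℚ.≤? fromℕ j ℚ.* ε) (↧ₙ ε)

  ratio? : ∀ ε j → Dec (1ℚ ℚ.≤ fromℕ j ^ℚ B ℚ.* ε ^ℚ a)
  ratio? ε j = 1ℚ ℚ.≤? fromℕ j ^ℚ B ℚ.* ε ^ℚ a

  ratio : ℚ → ℕ
  ratio ε = search (ratio? ε) (inverse ε ^ a)

  blowup : ℚ → ℕ
  blowup ε = inverse ε * inverse ε * inverse ε * ratio ε

  windows : ℚ → ℚ → ℕ
  windows W ε = search (λ j → W ℚ.<? fromℕ (ratio ε ^ j)) ∣ ↥ W ∣

  J : ℕ
  J = 2 * B + 3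

  module Valid (ε : ℚ) (0<ε : 0ℚ ℚ.< ε) (ε<1 : ε ℚ.< 1ℚ) where

    q ρ K : ℕ
    q = inverse ε
    ρ = ratio ε
    K = blowup ε

    Q R : ℚ
    Q = fromℕ q
    R = fromℕ ρ

    0≤ε : 0ℚ ℚ.≤ ε
    0≤ε = ℚ.<⇒≤ 0<ε

    ε≤1 : ε ℚ.≤ 1ℚ
    ε≤1 = ℚ.<⇒≤ ε<1

    1≤qε : 1ℚ ℚ.≤ Q ℚ.* ε
    1≤qε = search-sound (λ j → 1ℚ ℚ.≤? fromℕ j ℚ.* ε) (↧ₙ ε) (1≤↧* ε 0<ε)

    qε≤2 : Q ℚ.* ε ℚ.≤ fromℕ 2
    qε≤2 = go q refl
      where
      go : ∀ j → j ≡ q → fromℕ j ℚ.* ε ℚ.≤ fromℕ 2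
      go zero    _  = ℚ.≤-trans (ℚ.≤-reflexive (ℚ.*-zeroˡ ε)) (0≤fromℕ 2)
      go (suc j) eq = begin
        fromℕ (1 + j) ℚ.* ε              ≡⟨ cong (ℚ._* ε) (fromℕ-+ 1 j) ⟩
        (1ℚ ℚ.+ fromℕ j) ℚ.* ε           ≡⟨ ℚ.*-distribʳ-+ ε 1ℚ (fromℕ j) ⟩
        1ℚ ℚ.* ε ℚ.+ fromℕ j ℚ.* ε       ≤⟨ ℚ.+-mono-≤ (ℚ.≤-trans (ℚ.≤-reflexive (ℚ.*-identityˡ ε)) ε≤1)
                                              (ℚ.<⇒≤ (ℚ.≰⇒> (search-least (λ j → 1ℚ ℚ.≤? fromℕ j ℚ.* ε) (↧ₙ ε)
                                                 (≤-reflexive eq)))) ⟩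
        1ℚ ℚ.+ 1ℚ                        ≡⟨⟩
        fromℕ 2                          ∎
        where open ℚ.≤-Reasoning

    1≤q : 1 ≤ q
    1≤q = n≢0⇒n>0 (λ q≡0 → ℚ.<-irrefl refl (ℚ.<-≤-trans (fromℕ-mono-< {0} {1} (s≤s z≤n))
      (ℚ.≤-trans 1≤qε (ℚ.≤-reflexive (trans (cong (λ j → fromℕ j ℚ.* ε) q≡0) (ℚ.*-zeroˡ ε))))))

    ≤-^ : ∀ {x} n → 1 ≤ n → 1ℚ ℚ.≤ x → x ℚ.≤ x ^ℚ n
    ≤-^ {x} (suc n) _ 1≤x = ℚ.≤-trans (ℚ.≤-reflexive (sym (ℚ.*-identityʳ x)))
      (ℚ.*-monoˡ-≤-nonNeg x {{ℚ.nonNegative (ℚ.≤-trans 0≤1 1≤x)}} (1≤^ n 1≤x))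

    ^-≤ : ∀ n → 1 ≤ n → ε ^ℚ n ℚ.≤ ε
    ^-≤ (suc n) _ = ℚ.≤-trans (ℚ.*-monoˡ-≤-nonNeg ε {{ℚ.nonNegative 0≤ε}} (^≤1 n 0≤ε ε≤1))
      (ℚ.≤-reflexive (ℚ.*-identityʳ ε))

    1≤ρ^ε^ : 1ℚ ℚ.≤ R ^ℚ B ℚ.* ε ^ℚ a
    1≤ρ^ε^ = search-sound (ratio? ε) (q ^ a) (begin
      1ℚ                                  ≤⟨ 1≤^ a 1≤qε ⟩
      (Q ℚ.* ε) ^ℚ a                      ≡⟨ ^ℚ-distrib-* Q ε a ⟩
      Q ^ℚ a ℚ.* ε ^ℚ a                   ≡⟨ cong (ℚ._* ε ^ℚ a) (fromℕ-^ q a) ⟨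
      fromℕ (q ^ a) ℚ.* ε ^ℚ a            ≤⟨ ℚ.*-monoʳ-≤-nonNeg (ε ^ℚ a) {{ℚ.nonNegative (0≤^ a 0≤ε)}}
                                               (≤-^ B 1≤B (fromℕ-mono-≤ (m^n>0 q {{>-nonZero 1≤q}} a))) ⟩
      fromℕ (q ^ a) ^ℚ B ℚ.* ε ^ℚ a       ∎)
      where open ℚ.≤-Reasoning

    small-ratio : ∀ {j} → fromℕ j ℚ.≤ 1ℚ → ¬ 1ℚ ℚ.≤ fromℕ j ^ℚ B ℚ.* ε ^ℚ a
    small-ratio {j} j≤1 p = ℚ.<-irrefl refl (ℚ.≤-<-trans p (ℚ.≤-<-trans
      (*-mono-≤-nonNeg (0≤^ a 0≤ε) 0≤1 (^≤1 B (0≤fromℕ j) j≤1) (^-≤ a 1≤a))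
      (ℚ.≤-<-trans (ℚ.≤-reflexive (ℚ.*-identityˡ ε)) ε<1)))

    2≤ρ : 2 ≤ ρ
    2≤ρ = ≮⇒≥ (λ ρ<2 → small-ratio {ρ} (fromℕ-mono-≤ {ρ} {1} (s≤s⁻¹ ρ<2)) 1≤ρ^ε^)

    ρ^ε^≤ : R ^ℚ B ℚ.* ε ^ℚ a ℚ.≤ fromℕ 2 ^ℚ B
    ρ^ε^≤ = go ρ refl 2≤ρ
      where
      go : ∀ j → j ≡ ρ → 2 ≤ j → fromℕ j ^ℚ B ℚ.* ε ^ℚ a ℚ.≤ fromℕ 2 ^ℚ B
      go (suc j) eq (s≤s 1≤j) = begin
        fromℕ (suc j) ^ℚ B ℚ.* ε ^ℚ a
          ≤⟨ ℚ.*-monoʳ-≤-nonNeg (ε ^ℚ a) {{ℚ.nonNegative (0≤^ a 0≤ε)}}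
               (^ℚ-mono-≤ B (0≤fromℕ (suc j)) (fromℕ-mono-≤ (≤-trans (+-monoˡ-≤ j 1≤j)
                 (≤-reflexive (cong (j +_) (sym (+-identityʳ j))))))) ⟩
        fromℕ (2 * j) ^ℚ B ℚ.* ε ^ℚ a
          ≡⟨ cong (ℚ._* ε ^ℚ a) (trans (cong (_^ℚ B) (fromℕ-* 2 j)) (^ℚ-distrib-* (fromℕ 2) (fromℕ j) B)) ⟩
        fromℕ 2 ^ℚ B ℚ.* fromℕ j ^ℚ B ℚ.* ε ^ℚ a
          ≡⟨ ℚ.*-assoc (fromℕ 2 ^ℚ B) _ _ ⟩
        fromℕ 2 ^ℚ B ℚ.* (fromℕ j ^ℚ B ℚ.* ε ^ℚ a)
          ≤⟨ ℚ.*-monoˡ-≤-nonNeg (fromℕ 2 ^ℚ B) {{ℚ.nonNegative (0≤^ B (0≤fromℕ 2))}}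
               (ℚ.<⇒≤ (ℚ.≰⇒> (search-least (ratio? ε) (q ^ a) (≤-reflexive eq)))) ⟩
        fromℕ 2 ^ℚ B ℚ.* 1ℚ
          ≡⟨ ℚ.*-identityʳ _ ⟩
        fromℕ 2 ^ℚ B ∎
        where open ℚ.≤-Reasoning

    1≤ρ^ε : 1ℚ ℚ.≤ R ^ℚ B ℚ.* ε
    1≤ρ^ε = ℚ.≤-trans 1≤ρ^ε^ (ℚ.*-monoˡ-≤-nonNeg (R ^ℚ B) {{ℚ.nonNegative (0≤^ B (0≤fromℕ ρ))}} (^-≤ a 1≤a))

    q≤ρ^ : q ≤ ρ ^ suc B
    q≤ρ^ = ≤-trans (fromℕ-cancel-≤ {q} {2 * ρ ^ B} (begin
      Q                               ≡⟨ ℚ.*-identityʳ Q ⟨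
      Q ℚ.* 1ℚ                        ≤⟨ ℚ.*-monoˡ-≤-nonNeg Q {{ℚ.nonNegative (0≤fromℕ q)}} 1≤ρ^ε ⟩
      Q ℚ.* (R ^ℚ B ℚ.* ε)            ≡⟨ solve 3 (λ q r e → q :* (r :* e) := (q :* e) :* r) refl Q (R ^ℚ B) ε ⟩
      Q ℚ.* ε ℚ.* R ^ℚ B              ≤⟨ ℚ.*-monoʳ-≤-nonNeg (R ^ℚ B) {{ℚ.nonNegative (0≤^ B (0≤fromℕ ρ))}} qε≤2 ⟩
      fromℕ 2 ℚ.* R ^ℚ B              ≡⟨ trans (fromℕ-* 2 (ρ ^ B)) (cong (fromℕ 2 ℚ.*_) (fromℕ-^ ρ B)) ⟨
      fromℕ (2 * ρ ^ B)               ∎)) (*-monoˡ-≤ (ρ ^ B) 2≤ρ)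
      where
      open ℚ.≤-Reasoning
      open +-*-Solver

    q²ρ≤ρ^J : q * q * ρ ≤ ρ ^ J
    q²ρ≤ρ^J = ≤-trans (*-monoˡ-≤ ρ (*-mono-≤ q≤ρ^ q≤ρ^)) (≤-reflexive (begin
      ρ ^ suc B * ρ ^ suc B * ρ       ≡⟨ cong₂ _*_ (sym (^-distribˡ-+-* ρ (suc B) (suc B))) (sym (*-identityʳ ρ)) ⟩
      ρ ^ (suc B + suc B) * ρ ^ 1     ≡⟨ ^-distribˡ-+-* ρ (suc B + suc B) 1 ⟨
      ρ ^ (suc B + suc B + 1)         ≡⟨ cong (ρ ^_) (exponent B) ⟩
      ρ ^ J                           ∎))
      where
      open ≡-Reasoning
      exponent : ∀ B → suc B + suc B + 1 ≡ 2 * B + 3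
      exponent = solve-∀

    blowup-power : fromℕ K ^ℚ B ℚ.* ε ^ℚ (3 * B + a) ≡ ((Q ℚ.* ε) ^ℚ 3) ^ℚ B ℚ.* (R ^ℚ B ℚ.* ε ^ℚ a)
    blowup-power = begin
      fromℕ K ^ℚ B ℚ.* ε ^ℚ (3 * B + a)
        ≡⟨ cong₂ (λ x y → x ^ℚ B ℚ.* y) K-split (^ℚ-+ ε (3 * B) a) ⟩
      (Q ^ℚ 3 ℚ.* R) ^ℚ B ℚ.* (ε ^ℚ (3 * B) ℚ.* ε ^ℚ a)
        ≡⟨ cong₂ (λ x y → x ℚ.* (y ℚ.* ε ^ℚ a)) (^ℚ-distrib-* (Q ^ℚ 3) R B) (sym (^ℚ-assoc ε 3 B)) ⟩
      (Q ^ℚ 3) ^ℚ B ℚ.* R ^ℚ B ℚ.* ((ε ^ℚ 3) ^ℚ B ℚ.* ε ^ℚ a)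
        ≡⟨ solve 4 (λ x y z w → x :* y :* (z :* w) := x :* z :* (y :* w)) refl ((Q ^ℚ 3) ^ℚ B) (R ^ℚ B) ((ε ^ℚ 3) ^ℚ B) (ε ^ℚ a) ⟩
      (Q ^ℚ 3) ^ℚ B ℚ.* (ε ^ℚ 3) ^ℚ B ℚ.* (R ^ℚ B ℚ.* ε ^ℚ a)
        ≡⟨ cong (ℚ._* (R ^ℚ B ℚ.* ε ^ℚ a)) (sym (trans (cong (_^ℚ B) (^ℚ-distrib-* Q ε 3)) (^ℚ-distrib-* (Q ^ℚ 3) (ε ^ℚ 3) B))) ⟩
      ((Q ℚ.* ε) ^ℚ 3) ^ℚ B ℚ.* (R ^ℚ B ℚ.* ε ^ℚ a) ∎
      where
      open ≡-Reasoning
      open +-*-Solver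
      K-split : fromℕ K ≡ Q ^ℚ 3 ℚ.* R
      K-split = trans (fromℕ-* (q * q * q) ρ) (cong (ℚ._* R) (trans (fromℕ-* (q * q) q)
        (trans (cong (ℚ._* Q) (fromℕ-* q q)) (trans (ℚ.*-assoc Q Q Q)
          (cong (λ x → Q ℚ.* (Q ℚ.* x)) (sym (ℚ.*-identityʳ Q)))))))

    1≤blowup : 1ℚ ℚ.≤ fromℕ K ^ℚ B ℚ.* ε ^ℚ (3 * B + a)
    1≤blowup = ℚ.≤-trans (*-mono-1≤ (1≤^ B (1≤^ 3 1≤qε)) 1≤ρ^ε^) (ℚ.≤-reflexive (sym blowup-power))

    blowup≤ : fromℕ K ^ℚ B ℚ.* ε ^ℚ (3 * B + a) ℚ.≤ fromℕ 16 ^ℚ B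
    blowup≤ = begin
      fromℕ K ^ℚ B ℚ.* ε ^ℚ (3 * B + a)
        ≡⟨ blowup-power ⟩
      ((Q ℚ.* ε) ^ℚ 3) ^ℚ B ℚ.* (R ^ℚ B ℚ.* ε ^ℚ a)
        ≤⟨ *-mono-≤-nonNeg (ℚ.≤-trans 0≤1 1≤ρ^ε^) (0≤^ B (0≤^ 3 (0≤fromℕ 2)))
             (^ℚ-mono-≤ B (0≤^ 3 0≤qε) (^ℚ-mono-≤ 3 0≤qε qε≤2)) ρ^ε^≤ ⟩
      (fromℕ 2 ^ℚ 3) ^ℚ B ℚ.* fromℕ 2 ^ℚ B
        ≡⟨ ^ℚ-distrib-* (fromℕ 2 ^ℚ 3) (fromℕ 2) B ⟨
      (fromℕ 2 ^ℚ 3 ℚ.* fromℕ 2) ^ℚ B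
        ≡⟨⟩
      fromℕ 16 ^ℚ B ∎
      where
      open ℚ.≤-Reasoning
      0≤qε : 0ℚ ℚ.≤ Q ℚ.* ε
      0≤qε = ℚ.≤-trans 0≤1 1≤qε

    scaled : ∀ x → (1ℚ ℚ.* fromℕ x) ^ℚ B ℚ.≤ fromℕ (x * K) ^ℚ B ℚ.* ε ^ℚ (3 * B + a)
                 × fromℕ (x * K) ^ℚ B ℚ.* ε ^ℚ (3 * B + a) ℚ.≤ (fromℕ 16 ℚ.* fromℕ x) ^ℚ B
    scaled x = (begin
        (1ℚ ℚ.* X) ^ℚ B                                     ≡⟨ cong (_^ℚ B) (ℚ.*-identityˡ X) ⟩
        X ^ℚ B                                              ≡⟨ ℚ.*-identityʳ _ ⟨
        X ^ℚ B ℚ.* 1ℚ                                       ≤⟨ ℚ.*-monoˡ-≤-nonNeg (X ^ℚ B) {{nonNeg}} 1≤blowup ⟩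
        X ^ℚ B ℚ.* (fromℕ K ^ℚ B ℚ.* ε ^ℚ (3 * B + a))      ≡⟨ factor ⟨
        fromℕ (x * K) ^ℚ B ℚ.* ε ^ℚ (3 * B + a)             ∎)
      , (begin
        fromℕ (x * K) ^ℚ B ℚ.* ε ^ℚ (3 * B + a)             ≡⟨ factor ⟩
        X ^ℚ B ℚ.* (fromℕ K ^ℚ B ℚ.* ε ^ℚ (3 * B + a))      ≤⟨ ℚ.*-monoˡ-≤-nonNeg (X ^ℚ B) {{nonNeg}} blowup≤ ⟩
        X ^ℚ B ℚ.* fromℕ 16 ^ℚ B                            ≡⟨ ℚ.*-comm (X ^ℚ B) _ ⟩
        fromℕ 16 ^ℚ B ℚ.* X ^ℚ B                            ≡⟨ ^ℚ-distrib-* (fromℕ 16) X B ⟨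
        (fromℕ 16 ℚ.* X) ^ℚ B                               ∎)
      where
      open ℚ.≤-Reasoning
      X : ℚ
      X = fromℕ x
      nonNeg : ℚ.NonNegative (X ^ℚ B)
      nonNeg = ℚ.nonNegative (0≤^ B (0≤fromℕ x))
      factor : fromℕ (x * K) ^ℚ B ℚ.* ε ^ℚ (3 * B + a) ≡ X ^ℚ B ℚ.* (fromℕ K ^ℚ B ℚ.* ε ^ℚ (3 * B + a))
      factor = trans (cong (ℚ._* ε ^ℚ (3 * B + a)) (trans (cong (_^ℚ B) (fromℕ-* x K)) (^ℚ-distrib-* X (fromℕ K) B)))
        (ℚ.*-assoc (X ^ℚ B) _ _)

    module Range (W : ℚ) (1≤W : 1ℚ ℚ.≤ W) where

      k : ℕ
      k = windows W ε

      W<ρ^k : W ℚ.< fromℕ (ρ ^ k)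
      W<ρ^k = search-sound (λ j → W ℚ.<? fromℕ (ρ ^ j)) ∣ ↥ W ∣ (ℚ.≤-<-trans (≤-fromℕ W)
        (fromℕ-mono-< (<-≤-trans (n<2^n ∣ ↥ W ∣) (^-monoˡ-≤ ∣ ↥ W ∣ 2≤ρ))))

      ρ^-≤W : ∀ {j} → j < k → fromℕ (ρ ^ j) ℚ.≤ W
      ρ^-≤W j<k = ℚ.≮⇒≥ (search-least (λ j → W ℚ.<? fromℕ (ρ ^ j)) ∣ ↥ W ∣ j<k)

      at-most-log : ∀ σ → AtMostTimesLog ε W (2 * B * σ) (k * σ)
      at-most-log σ = by-cases k refl
        where
        by-cases : ∀ j → j ≡ k → AtMostTimesLog ε W (2 * B * σ) (j * σ)
        by-cases zero          _  = inj₁ z≤n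
        by-cases (suc zero)    _  = inj₁ (*-monoˡ-≤ σ (≤-trans 1≤B (m≤m+n B _)))
        by-cases (suc (suc j)) eq = inj₂ (begin
          1ℚ
            ≤⟨ 1≤^ σ base ⟩
          (W ^ℚ (2 * B) ℚ.* ε ^ℚ (suc (suc j))) ^ℚ σ
            ≡⟨ ^ℚ-distrib-* (W ^ℚ (2 * B)) _ σ ⟩
          (W ^ℚ (2 * B)) ^ℚ σ ℚ.* (ε ^ℚ suc (suc j)) ^ℚ σ
            ≡⟨ cong₂ ℚ._*_ (^ℚ-assoc W (2 * B) σ) (^ℚ-assoc ε (suc (suc j)) σ) ⟩
          W ^ℚ (2 * B * σ) ℚ.* ε ^ℚ (suc (suc j) * σ) ∎)
          where
          open ℚ.≤-Reasoning
          i : ℕ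
          i = 2 * suc j
          i-split : i ≡ suc (suc j) + j
          i-split = double j
            where
            double : ∀ j → 2 * suc j ≡ suc (suc j) + j
            double = solve-∀
          0≤W : 0ℚ ℚ.≤ W
          0≤W = ℚ.≤-trans 0≤1 1≤W
          exponents : (R ^ℚ suc j) ^ℚ (2 * B) ≡ (R ^ℚ B) ^ℚ i
          exponents = trans (^ℚ-assoc R (suc j) (2 * B)) (trans (cong (R ^ℚ_) (commute (suc j) B))
            (sym (^ℚ-assoc R B i)))
            where
            commute : ∀ j B → j * (2 * B) ≡ B * (2 * j)
            commute = solve-∀
          base : 1ℚ ℚ.≤ W ^ℚ (2 * B) ℚ.* ε ^ℚ suc (suc j)
          base = begin
            1ℚ                                                ≤⟨ 1≤^ i 1≤ρ^ε ⟩
            (R ^ℚ B ℚ.* ε) ^ℚ i                               ≡⟨ ^ℚ-distrib-* (R ^ℚ B) ε i ⟩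
            (R ^ℚ B) ^ℚ i ℚ.* ε ^ℚ i                          ≡⟨ cong₂ ℚ._*_ (sym exponents) (trans (cong (ε ^ℚ_) i-split) (^ℚ-+ ε (suc (suc j)) j)) ⟩
            (R ^ℚ suc j) ^ℚ (2 * B) ℚ.* (ε ^ℚ suc (suc j) ℚ.* ε ^ℚ j)
              ≤⟨ *-mono-≤-nonNeg (0≤* (0≤^ (suc (suc j)) 0≤ε) (0≤^ j 0≤ε)) (0≤^ (2 * B) 0≤W)
                   (^ℚ-mono-≤ (2 * B) (0≤^ (suc j) (0≤fromℕ ρ))
                     (ℚ.≤-trans (ℚ.≤-reflexive (sym (fromℕ-^ ρ (suc j)))) (ρ^-≤W (≤-reflexive eq))))
                   (ℚ.≤-trans (ℚ.*-monoˡ-≤-nonNeg (ε ^ℚ suc (suc j)) {{ℚ.nonNegative (0≤^ (suc (suc j)) 0≤ε)}} (^≤1 j 0≤ε ε≤1))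
                     (ℚ.≤-reflexive (ℚ.*-identityʳ _))) ⟩
            W ^ℚ (2 * B) ℚ.* ε ^ℚ suc (suc j)                 ∎

-- The streaming reduction

≤-minus : ∀ {x y z} → x ℚ.≤ y ℚ.+ z → x ℚ.- z ℚ.≤ y
≤-minus {x} {y} {z} p = ℚ.≤-trans (ℚ.+-monoˡ-≤ (ℚ.- z) p) (ℚ.≤-reflexive
  (trans (ℚ.+-assoc y z (ℚ.- z)) (trans (cong (y ℚ.+_) (ℚ.+-inverseʳ z)) (ℚ.+-identityʳ y))))

additive⇒multiplicative : ∀ {Q κ ε a b} → 0ℚ ℚ.≤ κ → 0ℚ ℚ.≤ ε → 0ℚ ℚ.≤ a → 1ℚ ℚ.≤ Q ℚ.* ε →
  Q ℚ.* a ℚ.≤ Q ℚ.* b ℚ.+ κ ℚ.* a → (1ℚ ℚ.- κ ℚ.* ε) ℚ.* a ℚ.≤ b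
additive⇒multiplicative {Q} {κ} {ε} {a} {b} 0≤κ 0≤ε 0≤a 1≤Qε p = ℚ.≤-trans
  (ℚ.≤-reflexive (solve 3 (λ k e a → (con 1ℚ :- k :* e) :* a := a :- k :* e :* a) refl κ ε a))
  (≤-minus bound)
  where
  open +-*-Solver
  0≤κεa : 0ℚ ℚ.≤ κ ℚ.* ε ℚ.* a
  0≤κεa = 0≤* (0≤* 0≤κ 0≤ε) 0≤a
  bound : a ℚ.≤ b ℚ.+ κ ℚ.* ε ℚ.* a
  bound with ℚ.≤-total a b
  ... | inj₁ a≤b = ℚ.≤-trans a≤b (ℚ.≤-trans (ℚ.≤-reflexive (sym (ℚ.+-identityʳ b))) (ℚ.+-monoʳ-≤ b 0≤κεa))
  ... | inj₂ b≤a = begin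
    a
      ≡⟨ solve 2 (λ a b → a := b :+ con 1ℚ :* (a :- b)) refl a b ⟩
    b ℚ.+ 1ℚ ℚ.* (a ℚ.- b)
      ≤⟨ ℚ.+-monoʳ-≤ b (ℚ.*-monoʳ-≤-nonNeg (a ℚ.- b) {{ℚ.nonNegative 0≤a-b}} 1≤Qε) ⟩
    b ℚ.+ Q ℚ.* ε ℚ.* (a ℚ.- b)
      ≡⟨ solve 4 (λ q e a b → b :+ q :* e :* (a :- b) := b :+ e :* (q :* a :- q :* b)) refl Q ε a b ⟩
    b ℚ.+ ε ℚ.* (Q ℚ.* a ℚ.- Q ℚ.* b)
      ≤⟨ ℚ.+-monoʳ-≤ b (ℚ.*-monoˡ-≤-nonNeg ε {{ℚ.nonNegative 0≤ε}}
           (≤-minus (ℚ.≤-trans p (ℚ.≤-reflexive (ℚ.+-comm (Q ℚ.* b) (κ ℚ.* a)))))) ⟩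
    b ℚ.+ ε ℚ.* (κ ℚ.* a)
      ≡⟨ solve 4 (λ k e a b → b :+ e :* (k :* a) := b :+ k :* e :* a) refl κ ε a b ⟩
    b ℚ.+ κ ℚ.* ε ℚ.* a ∎
    where
    open ℚ.≤-Reasoning
    0≤a-b : 0ℚ ℚ.≤ a ℚ.- b
    0≤a-b = ℚ.≤-trans (ℚ.≤-reflexive (sym (ℚ.+-inverseʳ b))) (ℚ.+-monoˡ-≤ (ℚ.- b) b≤a)

module StreamReduction (n q ρ k : ℕ) {p s : ℕ}
  (A : StreamAlgorithm (Edge (n * (q * q * q * ρ))) (List (Edge (n * (q * q * q * ρ)))) p s) where

  open Unfolding {n} q (q * q * q * ρ)

  -- Weights are rounded down to multiples of 1/q².
  integral : ℚ → ℕ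
  integral w = floorℕ (w ℚ.* fromℕ (q * q))

  item : ℕ → Edge n × ℚ → List (Edge (n * (q * q * q * ρ)))
  item i (e , w) = unfold (e , quot (integral w) (ρ ^ i))

  rescale : ℕ → Edge n × ℕ → Edge n × ℕ
  rescale i (e , w) = e , ρ ^ i * w

  candidatesOf : ℕ → List (Edge (n * (q * q * q * ρ))) → List (Edge n × ℕ)
  candidatesOf i M′ = map (rescale i) (map refold M′)

  ∈-candidatesOf⁻ : ∀ i M′ {e w} → (e , w) ∈ candidatesOf i M′ → Σ[ w′ ∈ ℕ ] (e , w′) ∈ map refold M′ × w ≡ ρ ^ i * w′
  ∈-candidatesOf⁻ i M′ p∈ with ∈-map⁻ (rescale i) p∈
  ... | (e , w′) , p′∈ , refl = w′ , p′∈ , refl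

  select-heaviest : List (Edge n × ℕ) → List (Edge n)
  select-heaviest candidates = map proj₁ (Heaviest.heaviest candidates)

  algorithm : StreamAlgorithm (Edge n × ℚ) (List (Edge n)) p (k * s)
  algorithm = mapOutput select-heaviest (gatherParallel (λ i → expandStream (item i) A) candidatesOf k)

  module Correctness (1≤q : 1 ≤ q) (2≤ρ : 2 ≤ ρ) (J : ℕ) (q²ρ≤ρ^J : q * q * ρ ≤ ρ ^ J)
    (W ε : ℚ) (W<ρ^k : W ℚ.< fromℕ (ρ ^ k)) (0≤ε : 0ℚ ℚ.≤ ε)
    (1≤qε : 1ℚ ℚ.≤ fromℕ q ℚ.* ε) (qε≤2 : fromℕ q ℚ.* ε ℚ.≤ fromℕ 2)
    (m : ℕ) (A-correct : ∀ H → Bipartite H → length (edges H) ≤ m * (q * q * q * ρ) →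
      ApproxMCM H (1ℚ ℚ.- ε) (run A (edges H)))
    (G : WeightedGraph n) (bipartite : Bipartite (graph G)) (G≤m : length (edges (graph G)) ≤ m)
    (weights : WeightsIn[1, W ] G) where

    S : ℚ
    S = fromℕ (q * q)

    v : Edge n → ℕ
    v e = integral (weight G e)

    weight-same : ∀ {e f} → SameEdge e f → weight G e ≡ weight G f
    weight-same (inj₁ (refl , refl)) = refl
    weight-same (inj₂ (refl , refl)) = weight-sym G _ _

    0≤S : 0ℚ ℚ.≤ S
    0≤S = 0≤fromℕ (q * q)

    S-positive : ℚ.Positive S
    S-positive = ℚ.positive (fromℕ-mono-< {0} {q * q} (*-mono-≤ 1≤q 1≤q))

    v-bounds : ∀ {e} → e ∈ edges (graph G) → q * (q * 1) ≤ v e × v e < q * (q * ρ ^ k)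
    v-bounds {e} e∈ =
        s≤s⁻¹ (fromℕ-cancel-< {q * (q * 1)} {suc (v e)} (ℚ.≤-<-trans lower (<-floorℕ (weight G e ℚ.* S))))
      , fromℕ-cancel-< {v e} {q * (q * ρ ^ k)} (ℚ.≤-<-trans
          (ℚ.≤-trans (floorℕ-≤ (weight G e ℚ.* S) (0≤* (ℚ.≤-trans 0≤1 1≤w) 0≤S))
            (ℚ.*-monoʳ-≤-nonNeg S {{ℚ.nonNegative 0≤S}} w≤W))
          (ℚ.<-≤-trans (ℚ.*-monoˡ-<-pos S {{S-positive}} W<ρ^k)
            (ℚ.≤-reflexive (trans (sym (fromℕ-* (ρ ^ k) (q * q))) (cong fromℕ (regroup q (ρ ^ k)))))))
      where
      1≤w : 1ℚ ℚ.≤ weight G e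
      1≤w = proj₁ (All.lookup weights e∈)
      w≤W : weight G e ℚ.≤ W
      w≤W = proj₂ (All.lookup weights e∈)
      regroup : ∀ q x → x * (q * q) ≡ q * (q * x)
      regroup = solve-∀
      lower : fromℕ (q * (q * 1)) ℚ.≤ weight G e ℚ.* S
      lower = ℚ.≤-trans (ℚ.≤-reflexive (trans (cong (λ x → fromℕ (q * x)) (*-identityʳ q)) (sym (ℚ.*-identityˡ S))))
        (ℚ.*-monoʳ-≤-nonNeg S {{ℚ.nonNegative 0≤S}} 1≤w)

    module R = WeightReduction q ρ 1≤q 2≤ρ J q²ρ≤ρ^J (graph G) bipartite v
      (λ same → cong integral (weight-same same)) k v-bounds

    open R using (InG)

    M′ : ℕ → List (Edge (n * (q * q * q * ρ)))
    M′ i = run A (edges (R.Window.U i))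

    M′-approx : ∀ i → ApproxMCM (R.Window.U i) (1ℚ ℚ.- ε) (M′ i)
    M′-approx i = A-correct (R.Window.U i) (R.Window.U-bipartite i bipartite) (R.Window.U-size i G≤m)

    run-window : ∀ i → run (expandStream (item i) A) (weightedEdges G) ≡ M′ i
    run-window i = trans (run-expandStream (item i) A (weightedEdges G))
      (cong (run A) (List.concatMap-map (item i) (λ e → e , weight G e) (edges (graph G))))

    approx : ∀ i X → IsMatching (R.Window.U i) X → q * length X ≤ q * length (M′ i) + 2 * length X
    approx i X isM = fromℕ-cancel-≤ {q * length X} {q * length (M′ i) + 2 * length X} (begin
      fromℕ (q * length X)
        ≡⟨ fromℕ-* q (length X) ⟩
      Q ℚ.* x
        ≡⟨ solve 3 (λ q e x → q :* x := q :* ((con 1ℚ :- e) :* x) :+ q :* e :* x) refl Q ε x ⟩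
      Q ℚ.* ((1ℚ ℚ.- ε) ℚ.* x) ℚ.+ Q ℚ.* ε ℚ.* x
        ≤⟨ ℚ.+-mono-≤ (ℚ.*-monoˡ-≤-nonNeg Q {{ℚ.nonNegative (0≤fromℕ q)}} (IsApproxMaximum.approx (M′-approx i) X isM))
             (ℚ.*-monoʳ-≤-nonNeg x {{ℚ.nonNegative (0≤fromℕ (length X))}} qε≤2) ⟩
      Q ℚ.* fromℕ (length (M′ i)) ℚ.+ fromℕ 2 ℚ.* x
        ≡⟨ cong₂ ℚ._+_ (fromℕ-* q (length (M′ i))) (fromℕ-* 2 (length X)) ⟨
      fromℕ (q * length (M′ i)) ℚ.+ fromℕ (2 * length X)
        ≡⟨ fromℕ-+ (q * length (M′ i)) (2 * length X) ⟨
      fromℕ (q * length (M′ i) + 2 * length X) ∎)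
      where
      open ℚ.≤-Reasoning
      open +-*-Solver
      Q x : ℚ
      Q = fromℕ q
      x = fromℕ (length X)

    candidates : List (Edge n × ℕ)
    candidates = gather (λ i → candidatesOf i (run (expandStream (item i) A) (weightedEdges G))) k

    candidates-sound : ∀ {e w} → (e , w) ∈ candidates →
      Σ[ i ∈ ℕ ] Σ[ w′ ∈ ℕ ] (e , w′) ∈ map refold (M′ i) × w ≡ ρ ^ i * w′
    candidates-sound {e} p∈ =
      let i , p∈i = ∈-gather⁻ (λ i → candidatesOf i (run (expandStream (item i) A) (weightedEdges G))) k p∈
          w′ , p′∈ , scaled = ∈-candidatesOf⁻ i (run (expandStream (item i) A) (weightedEdges G)) p∈i
      in i , w′ , subst (λ M → (e , w′) ∈ map refold M) (run-window i) p′∈ , scaled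

    candidates-complete : ∀ {i e w} → i < k → (e , w) ∈ map refold (M′ i) → (e , ρ ^ i * w) ∈ candidates
    candidates-complete {i} {e} {w} i<k p∈ =
      ∈-gather⁺ (λ i → candidatesOf i (run (expandStream (item i) A) (weightedEdges G))) i<k
      (∈-map⁺ (rescale i) (subst (λ M → (e , w) ∈ map refold M) (sym (run-window i)) p∈))

    O : List (Edge n × ℕ)
    O = Heaviest.heaviest candidates

    module C = R.Combine M′ (λ i → IsApproxMaximum.isMatching (M′-approx i)) approx candidates
      candidates-sound candidates-complete O (proj₁ (Heaviest.heaviest-valid candidates)) (Heaviest.heaviest-maximal candidates)

    0≤weight : ∀ {e} → InG e → 0ℚ ℚ.≤ weight G e
    0≤weight = R.InG-elim (λ same → subst (0ℚ ℚ.≤_) (sym (weight-same same)))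
      (λ e∈ → ℚ.≤-trans 0≤1 (proj₁ (All.lookup weights e∈)))

    total-≥ : ∀ {M} → All InG M → fromℕ (∑ M v) ℚ.≤ totalWeight G M ℚ.* S
    total-≥ []                     = ℚ.≤-reflexive (sym (ℚ.*-zeroˡ S))
    total-≥ {e ∷ M} (e∈G ∷ M⊆G) = begin
      fromℕ (v e + ∑ M v)                              ≡⟨ fromℕ-+ (v e) (∑ M v) ⟩
      fromℕ (v e) ℚ.+ fromℕ (∑ M v)                    ≤⟨ ℚ.+-mono-≤ (floorℕ-≤ (weight G e ℚ.* S) (0≤* (0≤weight e∈G) 0≤S)) (total-≥ M⊆G) ⟩
      weight G e ℚ.* S ℚ.+ totalWeight G M ℚ.* S       ≡⟨ ℚ.*-distribʳ-+ S (weight G e) (totalWeight G M) ⟨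
      (weight G e ℚ.+ totalWeight G M) ℚ.* S           ∎
      where open ℚ.≤-Reasoning

    total-≤ : ∀ M → totalWeight G M ℚ.* S ℚ.≤ fromℕ (∑ M v + length M)
    total-≤ []      = ℚ.≤-reflexive (ℚ.*-zeroˡ S)
    total-≤ (e ∷ M) = begin
      (weight G e ℚ.+ totalWeight G M) ℚ.* S           ≡⟨ ℚ.*-distribʳ-+ S (weight G e) (totalWeight G M) ⟩
      weight G e ℚ.* S ℚ.+ totalWeight G M ℚ.* S       ≤⟨ ℚ.+-mono-≤ (ℚ.<⇒≤ (<-floorℕ (weight G e ℚ.* S))) (total-≤ M) ⟩
      fromℕ (suc (v e)) ℚ.+ fromℕ (∑ M v + length M)   ≡⟨ fromℕ-+ (suc (v e)) (∑ M v + length M) ⟨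
      fromℕ (suc (v e) + (∑ M v + length M))           ≡⟨ cong fromℕ (regroup (v e) (∑ M v) (length M)) ⟩
      fromℕ (v e + ∑ M v + suc (length M))             ∎
      where
      open ℚ.≤-Reasoning
      regroup : ∀ x y z → suc x + (y + z) ≡ x + y + suc z
      regroup = solve-∀

    result : List (Edge n)
    result = map proj₁ O

    κ′ : ℕ
    κ′ = R.κ + 1

    approximate : ∀ M → IsMatching (graph G) M →
      (1ℚ ℚ.- fromℕ κ′ ℚ.* ε) ℚ.* totalWeight G M ℚ.≤ totalWeight G result
    approximate M isM = ℚ.*-cancelʳ-≤-pos S {{S-positive}} (ℚ.≤-trans
      (ℚ.≤-reflexive (ℚ.*-assoc (1ℚ ℚ.- fromℕ κ′ ℚ.* ε) (totalWeight G M) S))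
      (additive⇒multiplicative {fromℕ q} {fromℕ κ′} {ε} {x} {y} (0≤fromℕ κ′) 0≤ε
        (ℚ.≤-trans (0≤fromℕ (∑ M v)) (total-≥ M⊆G)) 1≤qε additive))
      where
      open ℚ.≤-Reasoning
      M⊆G : All InG M
      M⊆G = IsMatching.subset isM
      mM : Matching M
      mM = matching (All.map (R.Window.InG-loopless 0) M⊆G) (IsMatching.disjoint isM)
      x y : ℚ
      x = totalWeight G M ℚ.* S
      y = totalWeight G result ℚ.* S
      q-length : q * length M ≤ ∑ M v
      q-length = ≤-trans (≤-reflexive (trans (*-comm q _) (sym (∑-const q M))))
        (∑-mono-All (All.map (λ e∈G → ≤-trans (≤-trans (≤-reflexive (sym (*-identityʳ q)))
          (*-monoʳ-≤ q (≤-trans 1≤q (≤-reflexive (sym (*-identityʳ q)))))) (proj₁ (R.InG-bounds e∈G))) M⊆G))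
      natural : q * (∑ M v + length M) ≤ q * ∑ result v + κ′ * ∑ M v
      natural = ≤-trans (≤-reflexive (*-distribˡ-+ q (∑ M v) (length M)))
        (≤-trans (+-mono-≤ (C.approximate M mM M⊆G) q-length)
          (≤-reflexive (regroup (q * ∑ result v) R.κ (∑ M v))))
        where
        regroup : ∀ a k x → a + k * x + x ≡ a + (k + 1) * x
        regroup = solve-∀
      additive : fromℕ q ℚ.* x ℚ.≤ fromℕ q ℚ.* y ℚ.+ fromℕ κ′ ℚ.* x
      additive = begin
        fromℕ q ℚ.* x
          ≤⟨ ℚ.*-monoˡ-≤-nonNeg (fromℕ q) {{ℚ.nonNegative (0≤fromℕ q)}} (total-≤ M) ⟩
        fromℕ q ℚ.* fromℕ (∑ M v + length M)
          ≡⟨ fromℕ-* q (∑ M v + length M) ⟨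
        fromℕ (q * (∑ M v + length M))
          ≤⟨ fromℕ-mono-≤ natural ⟩
        fromℕ (q * ∑ result v + κ′ * ∑ M v)
          ≡⟨ trans (fromℕ-+ (q * ∑ result v) (κ′ * ∑ M v)) (cong₂ ℚ._+_ (fromℕ-* q (∑ result v)) (fromℕ-* κ′ (∑ M v))) ⟩
        fromℕ q ℚ.* fromℕ (∑ result v) ℚ.+ fromℕ κ′ ℚ.* fromℕ (∑ M v)
          ≤⟨ ℚ.+-mono-≤ (ℚ.*-monoˡ-≤-nonNeg (fromℕ q) {{ℚ.nonNegative (0≤fromℕ q)}} (total-≥ C.O⊆G))
               (ℚ.*-monoˡ-≤-nonNeg (fromℕ κ′) {{ℚ.nonNegative (0≤fromℕ κ′)}} (total-≥ M⊆G)) ⟩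
        fromℕ q ℚ.* y ℚ.+ fromℕ κ′ ℚ.* x ∎

    correct : ApproxMWM G (1ℚ ℚ.- fromℕ κ′ ℚ.* ε) (run algorithm (weightedEdges G))
    correct = subst (ApproxMWM G (1ℚ ℚ.- fromℕ κ′ ℚ.* ε)) (cong select-heaviest (sym
      (run-gatherParallel (λ i → expandStream (item i) A) candidatesOf k (weightedEdges G))))
      (record
        { isMatching = record { subset = C.O⊆G ; disjoint = proj₂ (Heaviest.heaviest-valid candidates) }
        ; approx     = approximate
        })

-- Space bounds

Log : ℕ → ℕ
Log n = suc ⌊log₂ n ⌋

log₂-scale : ∀ j n .{{_ : NonZero n}} → ⌊log₂ (2 ^ j * n) ⌋ ≡ j + ⌊log₂ n ⌋
log₂-scale zero    n = cong ⌊log₂_⌋ (+-identityʳ n)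
log₂-scale (suc j) n = trans (cong ⌊log₂_⌋ (*-assoc 2 (2 ^ j) n))
  (trans (⌊log₂[2*b]⌋≡1+⌊log₂b⌋ (2 ^ j * n) {{m*n≢0 (2 ^ j) n {{m^n≢0 2 j}}}}) (cong suc (log₂-scale j n)))

n≤2^Log : ∀ n → n ≤ 2 ^ Log n
n≤2^Log n = ≮⇒≥ (λ lt → n≮n _ (≤-trans (≤-reflexive (sym (⌊log₂[2^n]⌋≡n (Log n)))) (⌊log₂⌋-mono-≤ (<⇒≤ lt))))

Log-scale : ∀ n K → 1 ≤ n → Log (n * K) ≤ suc K * Log n
Log-scale n K 1≤n = begin
  suc ⌊log₂ (n * K) ⌋      ≤⟨ s≤s (⌊log₂⌋-mono-≤ (≤-trans (*-monoʳ-≤ n (<⇒≤ (n<2^n K))) (≤-reflexive (*-comm n (2 ^ K))))) ⟩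
  suc ⌊log₂ (2 ^ K * n) ⌋  ≡⟨ cong suc (log₂-scale K n {{>-nonZero 1≤n}}) ⟩
  suc (K + ⌊log₂ n ⌋)      ≡⟨ trans (cong suc (+-comm K _)) (+-comm (Log n) K) ⟩
  K + Log n                ≤⟨ +-monoˡ-≤ (Log n) (m≤m*n K (Log n)) ⟩
  K * Log n + Log n        ≡⟨ +-comm (K * Log n) (Log n) ⟩
  suc K * Log n            ∎
  where open ≤-Reasoning

exponent-≤-Log : ∀ a d n j → 2 ^ j ≤ a * n ^ d → suc j ≤ suc (a + d) * Log n
exponent-≤-Log a d n j p = begin
  suc j                           ≡⟨ cong suc (⌊log₂[2^n]⌋≡n j) ⟨
  suc ⌊log₂ (2 ^ j) ⌋             ≤⟨ s≤s (⌊log₂⌋-mono-≤ (≤-trans p (*-mono-≤ (<⇒≤ (n<2^n a)) (^-monoˡ-≤ d (n≤2^Log n))))) ⟩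
  suc ⌊log₂ (2 ^ a * (2 ^ Log n) ^ d) ⌋
                                  ≡⟨ cong (λ x → suc ⌊log₂ x ⌋) (trans (cong (2 ^ a *_) (^-*-assoc 2 (Log n) d))
                                       (sym (^-distribˡ-+-* 2 a (Log n * d)))) ⟩
  suc ⌊log₂ (2 ^ (a + Log n * d)) ⌋
                                  ≡⟨ cong suc (⌊log₂[2^n]⌋≡n (a + Log n * d)) ⟩
  suc (a + Log n * d)             ≤⟨ s≤s (+-mono-≤ (m≤m*n a (Log n)) (≤-reflexive (*-comm (Log n) d))) ⟩
  1 + (a * Log n + d * Log n)     ≤⟨ +-monoˡ-≤ (a * Log n + d * Log n) (s≤s (z≤n {⌊log₂ n ⌋})) ⟩
  Log n + (a * Log n + d * Log n) ≡⟨ cong (Log n +_) (*-distribʳ-+ (Log n) a d) ⟨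
  suc (a + d) * Log n             ∎
  where open ≤-Reasoning

^-distrib-* : ∀ x y k → (x * y) ^ k ≡ x ^ k * y ^ k
^-distrib-* x y zero    = refl
^-distrib-* x y (suc k) = trans (cong (x * y *_) (^-distrib-* x y k)) (regroup x y (x ^ k) (y ^ k))
  where
  regroup : ∀ x y a b → x * y * (a * b) ≡ x * a * (y * b)
  regroup = solve-∀

polylog-blowup : ∀ C k n K → polylogSpace C k (n * K) ≤ polylogSpace (C * K * suc K ^ k) k n
polylog-blowup C k zero    K = ≤-trans (≤-reflexive (*-zeroʳ C)) z≤n
polylog-blowup C k (suc n) K = begin
  C * (suc n * K * Log (suc n * K) ^ k)
    ≤⟨ *-monoʳ-≤ C (*-monoʳ-≤ (suc n * K) (^-monoˡ-≤ k (Log-scale (suc n) K (s≤s z≤n)))) ⟩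
  C * (suc n * K * (suc K * Log (suc n)) ^ k)
    ≡⟨ cong (λ x → C * (suc n * K * x)) (^-distrib-* (suc K) (Log (suc n)) k) ⟩
  C * (suc n * K * (suc K ^ k * Log (suc n) ^ k))
    ≡⟨ regroup C (suc n) K (suc K ^ k) (Log (suc n) ^ k) ⟩
  C * K * suc K ^ k * (suc n * Log (suc n) ^ k) ∎
  where
  open ≤-Reasoning
  regroup : ∀ C n K x y → C * (n * K * (x * y)) ≡ C * K * x * (n * y)
  regroup = solve-∀

polylog-times-Log : ∀ b C k n → b * Log n * polylogSpace C k n ≡ polylogSpace (b * C) (suc k) n
polylog-times-Log b C k n = regroup b C n (Log n) (Log n ^ k)
  where
  regroup : ∀ b C n l x → b * l * (C * (n * x)) ≡ b * C * (n * (l * x))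
  regroup = solve-∀

module _ (a B : ℕ) (1≤a : 1 ≤ a) (1≤B : 1 ≤ B) (s : ℕ → ℕ → ℚ → ℕ) where

  open Parameters a B 1≤a 1≤B

  reducedSpace : ℕ → ℕ → ℚ → ℚ → ℕ
  reducedSpace n m W ε = windows W ε * s (n * blowup ε) (m * blowup ε) ε

  module _ (ε : ℚ) (0<ε : 0ℚ ℚ.< ε) (ε<1 : ε ℚ.< 1ℚ) where

    open Valid ε 0<ε ε<1

    1≤K : 1 ≤ K
    1≤K = *-mono-≤ (*-mono-≤ (*-mono-≤ 1≤q 1≤q) 1≤q) (≤-trans (s≤s z≤n) 2≤ρ)

    blowup-edges : ∀ n m → m ≤ n * n → m * K ≤ n * K * (n * K)
    blowup-edges n m m≤n² = ≤-trans (*-monoˡ-≤ K m≤n²) (≤-trans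
      (m≤m*n (n * n * K) K {{>-nonZero 1≤K}}) (≤-reflexive (regroup n K)))
      where
      regroup : ∀ n K → n * n * K * K ≡ n * K * (n * K)
      regroup = solve-∀

    windows-≤ : ∀ w d n W → 1ℚ ℚ.≤ W → W ℚ.≤ fromℕ (w * n ^ d) → windows W ε ≤ suc (w + d) * Log n
    windows-≤ w d n W 1≤W W≤ = go (windows W ε) refl
      where
      open Range W 1≤W using (ρ^-≤W)
      go : ∀ j → j ≡ windows W ε → j ≤ suc (w + d) * Log n
      go zero    _  = z≤n
      go (suc j) eq = exponent-≤-Log w d n j (≤-trans (^-monoˡ-≤ j 2≤ρ)
        (fromℕ-cancel-≤ {ρ ^ j} {w * n ^ d} (ℚ.≤-trans (ρ^-≤W (≤-reflexive eq)) W≤)))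

    reducedSpace-≤ : ∀ C e → (∀ n m → m ≤ n * n → s n m ε ≤ polylogSpace C e n) →
      ∀ w d n m W → m ≤ n * n → 1ℚ ℚ.≤ W → W ℚ.≤ fromℕ (w * n ^ d) →
      reducedSpace n m W ε ≤ polylogSpace (suc (w + d) * (C * K * suc K ^ e)) (suc e) n
    reducedSpace-≤ C e bound w d n m W m≤n² 1≤W W≤ = begin
      windows W ε * s (n * K) (m * K) ε
        ≤⟨ *-mono-≤ (windows-≤ w d n W 1≤W W≤)
             (≤-trans (bound (n * K) (m * K) (blowup-edges n m m≤n²)) (polylog-blowup C e n K)) ⟩
      suc (w + d) * Log n * polylogSpace (C * K * suc K ^ e) e n
        ≡⟨ polylog-times-Log (suc (w + d)) (C * K * suc K ^ e) e n ⟩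
      polylogSpace (suc (w + d) * (C * K * suc K ^ e)) (suc e) n ∎
      where open ≤-Reasoning

  reducedSpace-semiStreaming : SemiStreaming s → SemiStreamingWeighted reducedSpace
  reducedSpace-semiStreaming semi ε 0<ε ε<1 w d =
    let C , e , bound = semi ε 0<ε ε<1
    in suc (w + d) * (C * blowup ε * suc (blowup ε) ^ e) , suc e , reducedSpace-≤ ε 0<ε ε<1 C e bound w d

fromℕ-<⇒↥ : ∀ {n x} → fromℕ n ℚ.< x → n * ↧ₙ x < ∣ ↥ x ∣
fromℕ-<⇒↥ {n} {x} p rewrite fromℕ-mkℚ n with p
... | *<* q = magnitude (↥ x) (ℤ.<-≤-trans
  (ℤ.≤-<-trans (ℤ.≤-reflexive (ℤ.pos-* n (↧ₙ x))) q) (ℤ.≤-reflexive (ℤ.*-identityʳ (↥ x))))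
  where
  magnitude : ∀ {m} i → ℤ.+ m ℤ.< i → m < ∣ i ∣
  magnitude (ℤ.+ _) (ℤ.+<+ lt) = lt

theorem6p12 : (c : ℚ) → 0ℚ ℚ.< c →
    Σ[ lo ∈ ℚ ] Σ[ hi ∈ ℚ ] Σ[ κ ∈ ℚ ] Σ[ C ∈ ℕ ]
    ( 0ℚ ℚ.< lo
    × ( (p s : ℕ → ℕ → ℚ → ℕ) →
    SemiStreaming s →
    SolvesBipartiteMCM p s →
    Σ[ p′ ∈ (ℕ → ℕ → ℚ → ℚ → ℕ) ] Σ[ s′ ∈ (ℕ → ℕ → ℚ → ℚ → ℕ) ]
    ( SemiStreamingWeighted s′
    × SolvesBipartiteMWM κ p′ s′
    × ReductionBounds c lo hi C p s p′ s′ ) ) )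
theorem6p12 c 0<c =
  1ℚ , fromℕ 16 , fromℕ (12 * (2 * J + 8) + 6 + 1) , 2 * B , *<* (ℤ.+<+ (s≤s z≤n)) , λ p s semi solves →
    (λ n m W ε → p (n * blowup ε) (m * blowup ε) ε)
  , reducedSpace a B 1≤a 1≤B s
  , reducedSpace-semiStreaming a B 1≤a 1≤B s semi
  , solvesMWM p s solves
  , λ n m W ε 1≤W 0<ε ε<1 →
      n * blowup ε , m * blowup ε , ε
    , scaledBy ε 0<ε ε<1 n
    , scaledBy ε 0<ε ε<1 m
    , ℚ.≤-reflexive (ℚ.*-identityˡ ε)
    , ℚ.≤-trans (ℚ.≤-reflexive (sym (ℚ.*-identityˡ ε)))
        (ℚ.*-monoʳ-≤-nonNeg ε {{ℚ.nonNegative (ℚ.<⇒≤ 0<ε)}} (fromℕ-mono-≤ {1} {16} (s≤s z≤n)))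
    , ε<1
    , refl
    , Valid.Range.at-most-log ε 0<ε ε<1 W 1≤W (s (n * blowup ε) (m * blowup ε) ε)
  where
  r : ℚ
  r = fromℕ 3 ℚ.+ c
  B a : ℕ
  B = ↧ₙ r
  a = ∣ ↥ r ∣ ∸ 3 * B
  1≤B : 1 ≤ B
  1≤B = s≤s z≤n
  3B<A : 3 * B < ∣ ↥ r ∣
  3B<A = fromℕ-<⇒↥ {3} {r} (ℚ.≤-<-trans (ℚ.≤-reflexive (sym (ℚ.+-identityʳ (fromℕ 3)))) (ℚ.+-monoʳ-< (fromℕ 3) 0<c))
  1≤a : 1 ≤ a
  1≤a = m<n⇒0<n∸m 3B<A
  open Parameters a B 1≤a 1≤B
  scaledBy : ∀ ε → 0ℚ ℚ.< ε → ε ℚ.< 1ℚ → ∀ x → ScaledBy 1ℚ (fromℕ 16) ε r x (x * blowup ε)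
  scaledBy ε 0<ε ε<1 x = subst
    (λ A → (1ℚ ℚ.* fromℕ x) ^ℚ B ℚ.≤ fromℕ (x * blowup ε) ^ℚ B ℚ.* ε ^ℚ A
         × fromℕ (x * blowup ε) ^ℚ B ℚ.* ε ^ℚ A ℚ.≤ (fromℕ 16 ℚ.* fromℕ x) ^ℚ B)
    (m+[n∸m]≡n (<⇒≤ 3B<A)) (Valid.scaled ε 0<ε ε<1 x)
  solvesMWM : ∀ p s → SolvesBipartiteMCM p s →
    SolvesBipartiteMWM (fromℕ (12 * (2 * J + 8) + 6 + 1))
      (λ n m W ε → p (n * blowup ε) (m * blowup ε) ε) (reducedSpace a B 1≤a 1≤B s)
  solvesMWM p s solves n m W ε 1≤W 0<ε ε<1 = algorithm , λ G bipartite G≤m weights →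
    Correctness.correct 1≤q 2≤ρ J q²ρ≤ρ^J W ε W<ρ^k 0≤ε 1≤qε qε≤2 m (proj₂ base) G bipartite G≤m weights
    where
    open Valid ε 0<ε ε<1
    open Range W 1≤W
    base : Σ[ A ∈ StreamAlgorithm (Edge (n * K)) (List (Edge (n * K))) (p (n * K) (m * K) ε) (s (n * K) (m * K) ε) ]
      (∀ H → Bipartite H → length (edges H) ≤ m * K → ApproxMCM H (1ℚ ℚ.- ε) (run A (edges H)))
    base = solves (n * K) (m * K) ε 0<ε ε<1
    open StreamReduction n q ρ k (proj₁ base)
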